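{- Let $G$ be a finite connected simple cubic graph that has a $6$-cycle double cover. Then $G$ has a Hamiltonian cycle.
   Context: All graphs are finite, connected, undirected, with no multiple edges or self-loops. A cubic graph is a $3$-regular graph. A cycle double cover (CDC) of a graph $G$ is a collection of cycles of $G$ such that every edge of $G$ belongs to exactly two of the cycles in the collection. A $6$-cycle double cover ($6$-CDC) is a CDC in which every cycle has length $6$. -}

module Defs where

open import Data.Fin using (Fin; _≟_)
open import Data.List using (List; []; _∷_; _∷ʳ_; length; filter; zip; allFin)
open import Data.List.Membership.Propositional using (_∈_)
import Data.List.Membership.DecPropositional as DecMembership
open import Data.List.Relation.Unary.All using (All)
open import Data.List.Relation.Unary.Unique.Propositional using (Unique)
open import Data.Nat using (ℕ; _≤_; NonZero)
open import Data.Product using (Σ-syntax; _×_; _,_; uncurry)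
open import Data.Product.Properties using (≡-dec)
open import Data.Sum using (_⊎_)
open import Level using (0ℓ)
open import Relation.Binary.Core using (Rel)
open import Relation.Binary.Definitions using (Decidable; Symmetric)
open import Relation.Binary.Construct.Closure.ReflexiveTransitive using (Star)
open import Relation.Binary.PropositionalEquality using (_≡_)
open import Relation.Nullary using (¬_; Dec)
open import Relation.Nullary.Decidable using (_⊎-dec_)

record Graph : Set₁ where
  field
    order     : ℕ
    Adj       : Rel (Fin order) 0ℓ
    adj?      : Decidable Adj
    symmetric : Symmetric Adj
    loopless  : ∀ v → ¬ Adj v v

  Vertex : Set
  Vertex = Fin order

  degree : Vertex → ℕ
  degree v = length (filter (adj? v) (allFin order))

open Graph public using (Vertex; degree)

-- The graph with no vertices does not count as connected.
Connected : Graph → Set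
Connected G = NonZero order × (∀ u v → Star Adj u v)
  where open Graph G using (order; Adj)

Cubic : Graph → Set
Cubic G = ∀ v → degree G v ≡ 3

-- Consecutive pairs of a list read cyclically:
-- [v₀, …, vₖ₋₁] gives (v₀ , v₁), …, (vₖ₋₂ , vₖ₋₁), (vₖ₋₁ , v₀).
cyclicPairs : ∀ {A : Set} → List A → List (A × A)
cyclicPairs []       = []
cyclicPairs (x ∷ xs) = zip (x ∷ xs) (xs ∷ʳ x)

-- A cycle is given by listing its vertices in order, from some starting
-- vertex and in one of the two directions; the cycle as a subgraph is
-- recovered through the predicate EdgeOf below.
record Cycle (G : Graph) : Set where
  field
    vertices : List (Vertex G)
    long     : 3 ≤ length vertices
    distinct : Unique vertices
    adjacent : All (uncurry (Graph.Adj G)) (cyclicPairs vertices)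

open Cycle public using (vertices)

cycleLength : ∀ {G} → Cycle G → ℕ
cycleLength C = length (vertices C)

EdgeOf : ∀ {G} → Vertex G → Vertex G → Cycle G → Set
EdgeOf u v C = (u , v) ∈ cyclicPairs (vertices C)
             ⊎ (v , u) ∈ cyclicPairs (vertices C)

edgeOf? : ∀ {G} (u v : Vertex G) (C : Cycle G) → Dec (EdgeOf u v C)
edgeOf? u v C = (u , v) ∈? cyclicPairs (vertices C)
          ⊎-dec (v , u) ∈? cyclicPairs (vertices C)
  where open DecMembership (≡-dec _≟_ _≟_) using (_∈?_)

-- A collection of cycles is a list, so a repeated cycle counts with its
-- multiplicity.
CycleDoubleCover : (G : Graph) → List (Cycle G) → Set
CycleDoubleCover G 𝒞 =
  ∀ u v → Graph.Adj G u v → length (filter (edgeOf? u v) 𝒞) ≡ 2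

Has6CDC : Graph → Set
Has6CDC G = Σ[ 𝒞 ∈ List (Cycle G) ]
  CycleDoubleCover G 𝒞 × All (λ C → cycleLength C ≡ 6) 𝒞

Hamiltonian : Graph → Set
Hamiltonian G = Σ[ C ∈ Cycle G ] (∀ v → v ∈ vertices C)

{-# OPTIONS --safe #-}
-- A 6-cycle double cover of a cubic graph makes it a map of type {6,3}: a
-- quotient of the hexagonal tiling of the plane by a group acting freely on
-- flags.  Such a group contains no rotations, so it preserves one of the three
-- directions of edges.  Removing the edges in that direction leaves zigzag
-- cycles, the rows, and the removed edges join each row to the next.
--
-- A Hamiltonian cycle is obtained from the rows by exchanging edges along
-- strands, which climb through the rows and move alternately left and right:
-- where a strand crosses a row, one edge of the row is removed.  Following the
-- resulting 2-factor upwards through two rows leads from a strand to itself.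
-- If the sequence of rows is a path, then at its two ends a row is joined to
-- itself or has only one side, and two strands suffice.  If it is a cycle of
-- even length, one takes the strands that form an orbit under going once
-- around.  If its length is odd, the strands through all rows but the first
-- act as chords of the first row; this cubic graph has one Hamiltonian cycle,
-- the row, hence by Thomason's lollipop argument a second one, which uses
-- chords and determines the strands.
module Submission where

open import Data.Bool using (Bool; true; false; not)
open import Data.Empty using (⊥; ⊥-elim; ⊥-elim-irr)
open import Data.Fin using (Fin; zero; suc; toℕ; combine)
open import Data.Fin.Patterns
import Data.Fin.Properties as Finₚ
open import Data.List using (List; []; _∷_; _∷ʳ_; _++_; _ʳ++_; reverse; length; zip; filter; lookup; allFin; applyUpTo)
open import Data.List.Membership.Propositional using (_∈_; _∉_)
open import Data.List.Membership.Propositional.Properties using (∈-applyUpTo⁺; ∈-filter⁺; ∈-filter⁻; ∈-allFin; ∈-lookup)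
open import Data.List.Properties using (≡-dec; length-applyUpTo; ++-cancelʳ; ∷-injectiveˡ; ∷-injectiveʳ; ʳ++-defn; reverse-involutive; unfold-reverse)
open import Data.List.Relation.Binary.Permutation.Propositional using (_↭_; ↭-refl; ↭-sym; ↭-trans; ↭⇒↭ₛ)
open import Data.List.Relation.Binary.Permutation.Propositional.Properties using (∈-resp-↭; ↭-length; ↭-reverse; ++⁺ʳ)
import Data.List.Relation.Binary.Permutation.Setoid.Properties as Permₛ
open import Data.List.Relation.Unary.All using (All; []; _∷_)
import Data.List.Relation.Unary.All as All
import Data.List.Relation.Unary.All.Properties as Allₚ
open import Data.List.Relation.Unary.AllPairs using ([]; _∷_)
import Data.List.Relation.Unary.AllPairs as AllPairs
open import Data.List.Relation.Unary.Any using (here; there)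
open import Data.List.Relation.Unary.Linked using (Linked; []; [-]; _∷_)
open import Data.List.Relation.Unary.Unique.Propositional using (Unique)
import Data.List.Relation.Unary.Unique.Propositional.Properties as Uniqueₚ
open import Data.Nat hiding (_≟_)
open import Data.Nat.DivMod using (_%_; _/_; m≡m%n+[m/n]*n; m%n<n)
open import Data.Nat.Induction using (<-rec)
open import Data.Nat.Properties hiding (_≟_)
open import Data.Product using (∃; ∃₂; _×_; _,_; proj₁; proj₂; uncurry)
open import Data.Sum using (_⊎_; inj₁; inj₂; [_,_]′)
import Data.Sum as Sum
open import Defs
open import Function using (_∘_)
open import Level using (0ℓ)
open import Relation.Binary.Construct.Closure.ReflexiveTransitive using (Star; ε; _◅_)
open import Relation.Binary.Definitions using (DecidableEquality; Tri; tri<; tri≈; tri>)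
open import Relation.Binary.PropositionalEquality
open import Relation.Nullary using (¬_; Dec; yes; no; contradiction)
import Relation.Nullary.Decidable as Dec
open import Relation.Nullary.Decidable using (_⊎-dec_; ¬?; recompute)
open import Relation.Unary using (Pred; Decidable)

-- Iteration and finite sets

-- Neither the tiling nor the group is ever built. Words in `r₀`, `r₁`, `r₂` move the flags of the
-- finite map, and a group element appears as a word that fixes a flag. A rotation would fix the
-- centre of a face, the midpoint of an edge or a vertex; this is impossible because the corners of
-- a face are distinct and the two faces at an edge differ. Modulo translations at most one
-- reflection is left, since two would compose to a rotation, and every reflection of a hexagon
-- preserves the direction of one of its edges.
--
-- The obstacle is parity. A strand changes hands from row to row, so the 2-factor follows it only
-- through an even number of rows; for a cyclic sequence of odd length one row has to be treated by
-- other means. Parity also rules out a sequence that has a row joined to itself at one end and a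
-- one-sided row at the other: the translation along a row has the same order in all rows, and this
-- order is even in the first case and odd in the second.

halve : ∀ n → ∃ λ q → n ≡ q + q ⊎ n ≡ suc (q + q)
halve zero    = 0 , inj₁ refl
halve (suc n) with halve n
... | q , inj₁ refl = q , inj₂ refl
... | q , inj₂ refl = suc q , inj₁ (cong suc (sym (+-suc q q)))

least : {P : Pred ℕ 0ℓ} → Decidable P → ∃ P → ∃ λ n → P n × (∀ k → k < n → ¬ P k)
least {P} P? (n , pn) = search n pn
  where
  search : ∀ n → P n → ∃ λ n → P n × (∀ k → k < n → ¬ P k)
  search = <-rec _ λ n rec pn → case′ n rec pn (anyUpTo? P? n)
    where
    case′ : ∀ n → (∀ {k} → k < n → P k → ∃ λ n → P n × (∀ k → k < n → ¬ P k)) → P n →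
            Dec (∃ λ k → k < n × P k) → ∃ λ n → P n × (∀ k → k < n → ¬ P k)
    case′ n rec pn (yes (k , k<n , pk)) = rec k<n pk
    case′ n rec pn (no ¬p) = n , pn , λ k k<n pk → ¬p (k , k<n , pk)

least⁺ : {P : Pred ℕ 0ℓ} → Decidable P → (∃ λ n → P (suc n)) →
         ∃ λ n → P (suc n) × (∀ k → 0 < k → k < suc n → ¬ P k)
least⁺ P? w with least (P? ∘ suc) w
... | n , pn , min = n , pn , λ { (suc k) _ (s≤s k<n) → min k k<n }

module _ {A : Set} where

  iter : (A → A) → ℕ → A → A
  iter f zero    x = x
  iter f (suc n) x = f (iter f n x)

  iter-suc : ∀ f n x → iter f n (f x) ≡ f (iter f n x)
  iter-suc f zero    x = refl
  iter-suc f (suc n) x = cong f (iter-suc f n x)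

  iter-+ : ∀ f m n x → iter f (m + n) x ≡ iter f m (iter f n x)
  iter-+ f zero    n x = refl
  iter-+ f (suc m) n x = cong f (iter-+ f m n x)

  iter-* : ∀ f m n x → iter f (m * n) x ≡ iter (iter f n) m x
  iter-* f zero    n x = refl
  iter-* f (suc m) n x = trans (iter-+ f n (m * n) x) (cong (iter f n) (iter-* f m n x))

  iter-comm : ∀ f m n x → iter f m (iter f n x) ≡ iter f n (iter f m x)
  iter-comm f m n x = trans (sym (iter-+ f m n x)) (trans (cong (λ k → iter f k x) (+-comm m n)) (iter-+ f n m x))

  iter-conj : ∀ (h f g : A → A) → (∀ x → h (f x) ≡ g (h x)) → ∀ n x → h (iter f n x) ≡ iter g n (h x)
  iter-conj h f g hf zero    x = refl
  iter-conj h f g hf (suc n) x = trans (hf _) (cong g (iter-conj h f g hf n x))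

  iter-inverse : ∀ (f g : A → A) → (∀ x → g (f x) ≡ x) → ∀ n x → iter g n (iter f n x) ≡ x
  iter-inverse f g gf zero    x = refl
  iter-inverse f g gf (suc n) x =
    trans (sym (iter-suc g n _)) (trans (cong (iter g n) (gf _)) (iter-inverse f g gf n x))

  iter-fixed : ∀ f {x} → f x ≡ x → ∀ n → iter f n x ≡ x
  iter-fixed f fx zero    = refl
  iter-fixed f fx (suc n) = trans (cong f (iter-fixed f fx n)) fx

  iter-periodic : ∀ f {p x} → iter f p x ≡ x → ∀ k → iter f (k * p) x ≡ x
  iter-periodic f {p} {x} fp k = trans (iter-* f k p x) (iter-fixed (iter f p) fp k)

  iter-% : ∀ f {p x} .{{_ : NonZero p}} → iter f p x ≡ x → ∀ n → iter f (n % p) x ≡ iter f n x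
  iter-% f {p} {x} fp n = sym (begin
    iter f n x                              ≡⟨ cong (λ k → iter f k x) (m≡m%n+[m/n]*n n p) ⟩
    iter f (n % p + n / p * p) x            ≡⟨ iter-+ f (n % p) _ x ⟩
    iter f (n % p) (iter f (n / p * p) x)   ≡⟨ cong (iter f (n % p)) (iter-periodic f fp (n / p)) ⟩
    iter f (n % p) x                        ∎)
    where open ≡-Reasoning

record Finite (A : Set) : Set where
  field
    size           : ℕ
    code           : A → Fin size
    code-injective : ∀ {x y} → code x ≡ code y → x ≡ y

  infix 4 _≟′_
  _≟′_ : DecidableEquality A
  x ≟′ y = Dec.map′ code-injective (cong code) (code x Finₚ.≟ code y)

module Permutation {A : Set} (fin : Finite A) (f g : A → A) (gf : ∀ x → g (f x) ≡ x) where
  open Finite fin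

  iter-injective : ∀ n {x y} → iter f n x ≡ iter f n y → x ≡ y
  iter-injective n {x} {y} eq =
    trans (sym (iter-inverse f g gf n x)) (trans (cong (iter g n) eq) (iter-inverse f g gf n y))

  iter-cancel : ∀ {m n x} → m ≤ n → iter f m x ≡ iter f n x → iter f (n ∸ m) x ≡ x
  iter-cancel {m} {n} {x} m≤n eq = iter-injective m
    (trans (sym (iter-+ f m (n ∸ m) x)) (trans (cong (λ k → iter f k x) (m+[n∸m]≡n m≤n)) (sym eq)))

  period : ∀ x → ∃ λ p → iter f (suc p) x ≡ x
  period x with Finₚ.pigeonhole (n<1+n size) (λ i → code (iter f (toℕ i) x))
  ... | i , j , i<j , eq = toℕ j ∸ suc (toℕ i) ,
    trans (cong (λ k → iter f k x) (suc-∸ i<j)) (iter-cancel (<⇒≤ i<j) (code-injective eq))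
    where
    suc-∸ : ∀ {m n} → m < n → suc (n ∸ suc m) ≡ n ∸ m
    suc-∸ {m} {n} m<n = sym (+-∸-assoc 1 m<n)

  reach? : ∀ x y → Dec (∃ λ n → iter f n x ≡ y)
  reach? x y with period x
  ... | p , fp = Dec.map′ (λ (n , _ , eq) → n , eq)
                          (λ (n , eq) → n % suc p , m%n<n n (suc p) , trans (iter-% f fp n) eq)
                          (anyUpTo? (λ n → iter f n x ≟′ y) (suc p))

  -- The point just before the orbit closes up. Because of it reachability by forward iteration is
  -- already symmetric, and orbits need no negative exponents.
  inverse-reach : ∀ x → ∃ λ n → iter f n x ≡ g x
  inverse-reach x with period x
  ... | p , fp = p , trans (sym (gf _)) (cong g fp)

  iter-inverse-reach : ∀ n x → ∃ λ m → iter f m x ≡ iter g n x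
  iter-inverse-reach zero    x = 0 , refl
  iter-inverse-reach (suc n) x with iter-inverse-reach n x
  ... | m , eq with inverse-reach (iter g n x)
  ... | k , eq′ = k + m , trans (iter-+ f k m x) (trans (cong (iter f k) eq) eq′)

  reach-sym : ∀ {x y} n → iter f n x ≡ y → ∃ λ m → iter f m y ≡ x
  reach-sym {x} n refl with iter-inverse-reach n (iter f n x)
  ... | m , eq = m , trans eq (iter-inverse f g gf n x)

  fg : ∀ x → f (g x) ≡ x
  fg x with period x
  ... | p , fp = trans (cong (f ∘ g) (sym fp)) (trans (cong f (gf _)) fp)

  minimal-period : ∀ x → ∃ λ p → iter f (suc p) x ≡ x × (∀ k → 0 < k → k < suc p → iter f k x ≢ x)
  minimal-period x = least⁺ (λ n → iter f n x ≟′ x) (period x)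

  any-iter? : {P : Pred A 0ℓ} → Decidable P → ∀ x → Dec (∃ λ n → P (iter f n x))
  any-iter? {P} P? x with period x
  ... | p , fp = Dec.map′ (λ (n , _ , q) → n , q)
                          (λ (n , q) → n % suc p , m%n<n n (suc p) , subst P (sym (iter-% f fp n)) q)
                          (anyUpTo? (λ n → P? (iter f n x)) (suc p))

-- Flags, translations and the choice of a direction

-- The flags of a map of type {6,3}: r₀, r₁ and r₂ change the vertex, the edge
-- and the face of a flag.
record Hexagonal (F : Set) : Set where
  field
    finite  : Finite F
    r₀ r₁ r₂ : F → F
    r₀-involutive : ∀ φ → r₀ (r₀ φ) ≡ φ
    r₁-involutive : ∀ φ → r₁ (r₁ φ) ≡ φ
    r₂-involutive : ∀ φ → r₂ (r₂ φ) ≡ φ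
    r₀r₂ : ∀ φ → r₀ (r₂ φ) ≡ r₂ (r₀ φ)
    r₁r₂ : ∀ φ → r₁ (r₂ (r₁ φ)) ≡ r₂ (r₁ (r₂ φ))
    r₀r₁ : ∀ φ → r₀ (r₁ (r₀ (r₁ (r₀ (r₁ φ))))) ≡ r₁ (r₀ (r₁ (r₀ (r₁ (r₀ φ)))))
    r₀-free   : ∀ φ → r₀ φ ≢ φ
    r₂-free   : ∀ φ → r₂ φ ≢ φ
    -- From here on: no half-turn about an edge, no third of a turn about a vertex, no third or half
    -- of a turn about a face. A rotation by 60° is excluded along with its square.
    r₂r₀-free : ∀ φ → r₂ (r₀ φ) ≢ φ
    r₂r₁-free : ∀ φ → r₂ (r₁ φ) ≢ φ
    r₀r₁²-free : ∀ φ → r₀ (r₁ (r₀ (r₁ φ))) ≢ φ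
    r₀r₁³-free : ∀ φ → r₀ (r₁ (r₀ (r₁ (r₀ (r₁ φ))))) ≢ φ

module Translations {F : Set} (H : Hexagonal F) where
  open Hexagonal H

  -- c, h and b are the rotations by 60° and 180° about the centre of the face
  -- and by 180° about the midpoint of the edge.
  c c⁻ b h x x⁻ y y⁻ z : F → F
  c  φ = r₀ (r₁ φ)
  c⁻ φ = r₁ (r₀ φ)
  b  φ = r₂ (r₀ φ)
  h  φ = c (c (c φ))
  -- Half-turns about two different centres compose to a translation; conjugation by `c` yields
  -- three translations in directions 60° apart.
  x  φ = h (b φ)
  x⁻ φ = b (h φ)
  y  φ = c (x (c⁻ φ))
  y⁻ φ = c (x⁻ (c⁻ φ))
  z  φ = c (y (c⁻ φ))

  cc⁻ : ∀ φ → c (c⁻ φ) ≡ φ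
  cc⁻ φ = trans (cong r₀ (r₁-involutive _)) (r₀-involutive φ)

  c⁻c : ∀ φ → c⁻ (c φ) ≡ φ
  c⁻c φ = trans (cong r₁ (r₀-involutive _)) (r₁-involutive φ)

  bb : ∀ φ → b (b φ) ≡ φ
  bb φ = trans (cong r₂ (r₀r₂ _)) (trans (r₂-involutive _) (r₀-involutive φ))

  h≡c⁻³ : ∀ φ → h φ ≡ c⁻ (c⁻ (c⁻ φ))
  h≡c⁻³ = r₀r₁

  hh : ∀ φ → h (h φ) ≡ φ
  hh φ = trans (cong h (h≡c⁻³ φ))
    (trans (cong (λ θ → c (c θ)) (cc⁻ _)) (trans (cong c (cc⁻ _)) (cc⁻ φ)))

  cch : ∀ φ → c (c (h φ)) ≡ c⁻ φ
  cch φ = trans (cong (λ θ → c (c θ)) (h≡c⁻³ φ)) (trans (cong c (cc⁻ _)) (cc⁻ _))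

  ch : ∀ φ → c (h φ) ≡ c⁻ (c⁻ φ)
  ch φ = trans (cong c (h≡c⁻³ φ)) (cc⁻ _)

  c⁻c⁻h : ∀ φ → c⁻ (c⁻ (h φ)) ≡ c φ
  c⁻c⁻h φ = trans (cong c⁻ (c⁻c _)) (c⁻c _)

  c⁻h : ∀ φ → c⁻ (h φ) ≡ h (c⁻ φ)
  c⁻h φ = trans (cong c⁻ (h≡c⁻³ φ)) (sym (h≡c⁻³ _))

  bc⁻b : ∀ φ → b (c⁻ (b φ)) ≡ c (b (c φ))
  bc⁻b φ = begin
    r₂ (r₀ (r₁ (r₀ (r₂ (r₀ φ)))))   ≡⟨ cong (λ θ → r₂ (r₀ (r₁ θ))) (trans (r₀r₂ _) (cong r₂ (r₀-involutive φ))) ⟩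
    r₂ (r₀ (r₁ (r₂ φ)))             ≡⟨ sym (r₀r₂ _) ⟩
    r₀ (r₂ (r₁ (r₂ φ)))             ≡⟨ cong r₀ (sym (r₁r₂ φ)) ⟩
    r₀ (r₁ (r₂ (r₁ φ)))             ≡⟨ cong (λ θ → r₀ (r₁ (r₂ θ))) (sym (r₀-involutive _)) ⟩
    r₀ (r₁ (r₂ (r₀ (r₀ (r₁ φ)))))   ∎
    where open ≡-Reasoning

  bcb : ∀ φ → b (c (b φ)) ≡ c⁻ (b (c⁻ φ))
  bcb φ = begin
    r₂ (r₀ (r₀ (r₁ (r₂ (r₀ φ)))))   ≡⟨ cong r₂ (r₀-involutive _) ⟩
    r₂ (r₁ (r₂ (r₀ φ)))             ≡⟨ sym (r₁r₂ _) ⟩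
    r₁ (r₂ (r₁ (r₀ φ)))             ≡⟨ cong (λ θ → r₁ (r₂ θ)) (sym (r₀-involutive _)) ⟩
    r₁ (r₂ (r₀ (r₀ (r₁ (r₀ φ)))))   ≡⟨ cong r₁ (sym (r₀r₂ _)) ⟩
    r₁ (r₀ (r₂ (r₀ (r₁ (r₀ φ)))))   ∎
    where open ≡-Reasoning

  x⁻x : ∀ φ → x⁻ (x φ) ≡ φ
  x⁻x φ = trans (cong b (hh _)) (bb φ)

  xx⁻ : ∀ φ → x (x⁻ φ) ≡ φ
  xx⁻ φ = trans (cong h (bb _)) (hh φ)

  y⁻y : ∀ φ → y⁻ (y φ) ≡ φ
  y⁻y φ = trans (cong (λ θ → c (x⁻ θ)) (c⁻c _)) (trans (cong c (x⁻x _)) (cc⁻ φ))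

  yy⁻ : ∀ φ → y (y⁻ φ) ≡ φ
  yy⁻ φ = trans (cong (λ θ → c (x θ)) (c⁻c _)) (trans (cong c (xx⁻ _)) (cc⁻ φ))

  cx : ∀ φ → c (x φ) ≡ y (c φ)
  cx φ = cong (λ θ → c (x θ)) (sym (c⁻c φ))

  cy : ∀ φ → c (y φ) ≡ z (c φ)
  cy φ = cong (λ θ → c (y θ)) (sym (c⁻c φ))

  z≡ : ∀ φ → z φ ≡ c⁻ (b (c⁻ (c⁻ φ)))
  z≡ φ = cch _

  -- The triangle relation of the lattice, `y` being the sum of `x` and `z`. It is needed in both
  -- orders, since comparing them shows that `x` and `y` commute.
  xz : ∀ φ → x (z φ) ≡ y φ
  xz φ = trans (cong x (z≡ φ)) (trans (cong h (bc⁻b _)) (cong (λ θ → h (c (b θ))) (cc⁻ _)))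

  zx : ∀ φ → z (x φ) ≡ y φ
  zx φ = begin
    z (x φ)                        ≡⟨ z≡ _ ⟩
    c⁻ (b (c⁻ (c⁻ (h (b φ)))))     ≡⟨ cong (λ θ → c⁻ (b θ)) (c⁻c⁻h _) ⟩
    c⁻ (b (c (b φ)))               ≡⟨ cong c⁻ (bcb φ) ⟩
    c⁻ (c⁻ (b (c⁻ φ)))             ≡⟨ sym (ch _) ⟩
    c (h (b (c⁻ φ)))               ∎
    where open ≡-Reasoning

  xy : ∀ φ → x (y φ) ≡ y (x φ)
  xy φ = trans (cong x (sym (zx φ))) (xz (x φ))

  z≡x⁻y : ∀ φ → z φ ≡ x⁻ (y φ)
  z≡x⁻y φ = trans (sym (x⁻x _)) (cong x⁻ (xz φ))

  hx : ∀ φ → h (x φ) ≡ x⁻ (h φ)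
  hx φ = trans (hh _) (cong b (sym (hh φ)))

  hy : ∀ φ → h (y φ) ≡ y⁻ (h φ)
  hy φ = trans (cong c (hh _))
    (cong (λ θ → c (b θ)) (trans (sym (hh _)) (cong h (sym (c⁻h φ)))))

  r₀c : ∀ φ → r₀ (c φ) ≡ c⁻ (r₀ φ)
  r₀c φ = trans (r₀-involutive _) (cong r₁ (sym (r₀-involutive φ)))

  r₀h : ∀ φ → r₀ (h φ) ≡ h (r₀ φ)
  r₀h φ = trans (r₀c _) (trans (cong c⁻ (r₀c _)) (trans (cong (λ θ → c⁻ (c⁻ θ)) (r₀c φ)) (sym (h≡c⁻³ _))))

  r₀b : ∀ φ → r₀ (b φ) ≡ b (r₀ φ)
  r₀b φ = r₀r₂ _

  r₀x : ∀ φ → r₀ (x φ) ≡ x (r₀ φ)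
  r₀x φ = trans (r₀h _) (cong h (r₀b φ))

  yc⁻x : ∀ φ → y (c⁻ (x φ)) ≡ c⁻ (y φ)
  yc⁻x φ = trans (sym (c⁻c _)) (cong c⁻ (zx φ))

  -- `y ∘ r₀` is a glide reflection with square `x`: it is one step along a zigzag, and two steps
  -- make a translation.
  yr₀y : ∀ φ → y (r₀ (y φ)) ≡ x (r₀ φ)
  yr₀y φ = begin
    y (r₀ (c (x (c⁻ φ))))     ≡⟨ cong y (r₀c _) ⟩
    y (c⁻ (r₀ (x (c⁻ φ))))    ≡⟨ cong (λ θ → y (c⁻ θ)) (r₀x _) ⟩
    y (c⁻ (x (c (r₀ φ))))     ≡⟨ yc⁻x _ ⟩
    c⁻ (y (c (r₀ φ)))         ≡⟨ cong c⁻ (sym (cx _)) ⟩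
    c⁻ (c (x (r₀ φ)))         ≡⟨ c⁻c _ ⟩
    x (r₀ φ)                  ∎
    where open ≡-Reasoning

  r₀y : ∀ φ → r₀ (y φ) ≡ y⁻ (x (r₀ φ))
  r₀y φ = trans (sym (y⁻y _)) (cong y⁻ (yr₀y φ))

  r₂≡hxr₀ : ∀ φ → r₂ φ ≡ h (x (r₀ φ))
  r₂≡hxr₀ φ = trans (cong r₂ (sym (r₀-involutive φ))) (sym (hh _))

  step≡yr₀ : ∀ φ → r₁ (r₀ (r₁ (r₂ (r₁ φ)))) ≡ y (r₀ φ)
  step≡yr₀ φ = sym (begin
    c (h (b (c⁻ (r₀ φ))))                      ≡⟨ ch _ ⟩
    r₁ (r₀ (r₁ (r₀ (r₂ (r₀ (r₁ (r₀ (r₀ φ)))))))) ≡⟨ cong (λ θ → r₁ (r₀ (r₁ (r₀ (r₂ (r₀ (r₁ θ))))))) (r₀-involutive φ) ⟩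
    r₁ (r₀ (r₁ (r₀ (r₂ (r₀ (r₁ φ))))))         ≡⟨ cong (λ θ → r₁ (r₀ (r₁ θ))) (trans (r₀r₂ _) (cong r₂ (r₀-involutive _))) ⟩
    r₁ (r₀ (r₁ (r₂ (r₁ φ))))                   ∎)
    where open ≡-Reasoning

  module X = Permutation finite x x⁻ x⁻x
  module Y = Permutation finite y y⁻ y⁻y

  infix 4 _≈_
  _≈_ : F → F → Set
  φ ≈ ψ = ∃₂ λ m n → iter x m (iter y n φ) ≡ ψ

  ≈-refl : ∀ {φ} → φ ≈ φ
  ≈-refl = 0 , 0 , refl

  ≈-reflexive : ∀ {φ ψ} → φ ≡ ψ → φ ≈ ψ
  ≈-reflexive refl = ≈-refl

  iter-xy : ∀ m n φ → iter x m (iter y n φ) ≡ iter y n (iter x m φ)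
  iter-xy m n φ = sym (iter-conj (iter y n) x x (λ ψ → sym (iter-conj x y y xy n ψ)) m φ)

  ≈-trans : ∀ {φ ψ θ} → φ ≈ ψ → ψ ≈ θ → φ ≈ θ
  ≈-trans {φ} (m , n , refl) (m′ , n′ , refl) = m′ + m , n′ + n , (begin
    iter x (m′ + m) (iter y (n′ + n) φ)            ≡⟨ iter-+ x m′ m _ ⟩
    iter x m′ (iter x m (iter y (n′ + n) φ))       ≡⟨ cong (λ θ → iter x m′ (iter x m θ)) (iter-+ y n′ n φ) ⟩
    iter x m′ (iter x m (iter y n′ (iter y n φ)))  ≡⟨ cong (iter x m′) (iter-xy m n′ _) ⟩
    iter x m′ (iter y n′ (iter x m (iter y n φ)))  ∎)
    where open ≡-Reasoning

  ≈-sym : ∀ {φ ψ} → φ ≈ ψ → ψ ≈ φ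
  ≈-sym {φ} (m , n , refl) with X.reach-sym m refl | Y.reach-sym n refl
  ... | m′ , eq | n′ , eq′ = m′ , n′ , (begin
    iter x m′ (iter y n′ (iter x m (iter y n φ)))  ≡⟨ iter-xy m′ n′ _ ⟩
    iter y n′ (iter x m′ (iter x m (iter y n φ)))  ≡⟨ cong (iter y n′) eq ⟩
    iter y n′ (iter y n φ)                         ≡⟨ eq′ ⟩
    φ                                              ∎)
    where open ≡-Reasoning

  x-≈ : ∀ {φ} → φ ≈ x φ
  x-≈ = 1 , 0 , refl

  y-≈ : ∀ {φ} → φ ≈ y φ
  y-≈ = 0 , 1 , refl

  x⁻-≈ : ∀ {φ} → φ ≈ x⁻ φ
  x⁻-≈ = ≈-sym (≈-trans x-≈ (≈-reflexive (xx⁻ _)))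

  y⁻-≈ : ∀ {φ} → φ ≈ y⁻ φ
  y⁻-≈ = ≈-sym (≈-trans y-≈ (≈-reflexive (yy⁻ _)))

  iter-≈ : ∀ {f} → (∀ φ → φ ≈ f φ) → ∀ n φ → φ ≈ iter f n φ
  iter-≈ f≈ zero    φ = ≈-refl
  iter-≈ f≈ (suc n) φ = ≈-trans (iter-≈ f≈ n φ) (f≈ _)

  _≈?_ : ∀ φ ψ → Dec (φ ≈ ψ)
  φ ≈? ψ with Y.period φ
  ... | p , yp = Dec.map′
    (λ (n , _ , m , eq) → m , n , eq)
    (λ (m , n , eq) → n % suc p , m%n<n n (suc p) , m , trans (cong (iter x m) (iter-% y yp n)) eq)
    (anyUpTo? (λ n → X.reach? (iter y n φ) ψ) (suc p))
    where open import Data.Nat.DivMod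

  -- Translations form a normal subgroup, so every map that conjugates them to translations acts on
  -- the classes of `_≈_`. There only the dihedral group of a hexagon is left to act.
  normal : ∀ f u v → (∀ φ → f (x φ) ≡ u (f φ)) → (∀ φ → f (y φ) ≡ v (f φ)) →
           (∀ φ → φ ≈ u φ) → (∀ φ → φ ≈ v φ) → ∀ {φ ψ} → φ ≈ ψ → f φ ≈ f ψ
  normal f u v fx fy u≈ v≈ {φ} (m , n , refl) =
    ≈-trans (iter-≈ v≈ n (f φ)) (≈-trans (iter-≈ u≈ m _)
      (≈-reflexive (sym (trans (iter-conj f x u fx m _) (cong (iter u m) (iter-conj f y v fy n φ))))))

  c-≈ : ∀ {φ ψ} → φ ≈ ψ → c φ ≈ c ψ
  c-≈ = normal c y z cx cy (λ _ → y-≈) (λ φ → ≈-trans (≈-trans y-≈ x⁻-≈) (≈-reflexive (sym (z≡x⁻y φ))))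

  r₀-≈ : ∀ {φ ψ} → φ ≈ ψ → r₀ φ ≈ r₀ ψ
  r₀-≈ = normal r₀ x (λ φ → y⁻ (x φ)) r₀x r₀y (λ _ → x-≈) (λ _ → ≈-trans x-≈ y⁻-≈)

  h-≈ : ∀ {φ ψ} → φ ≈ ψ → h φ ≈ h ψ
  h-≈ e = c-≈ (c-≈ (c-≈ e))

  -- A half-turn composed with a translation t is conjugate to the half-turn
  -- composed with t s², for every translation s.
  h-fixed-free : ∀ m n φ → h φ ≢ iter x m (iter y n φ)
  h-fixed-free zero zero φ = r₀r₁³-free φ
  h-fixed-free (suc (suc m)) n φ eq = h-fixed-free m n (x φ) (begin
    h (x φ)                                  ≡⟨ hx φ ⟩
    x⁻ (h φ)                                 ≡⟨ cong x⁻ eq ⟩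
    x⁻ (x (x (iter x m (iter y n φ))))       ≡⟨ x⁻x _ ⟩
    x (iter x m (iter y n φ))                ≡⟨ sym (iter-suc x m _) ⟩
    iter x m (x (iter y n φ))                ≡⟨ cong (iter x m) (iter-conj x y y xy n φ) ⟩
    iter x m (iter y n (x φ))                ∎)
    where open ≡-Reasoning
  h-fixed-free m (suc (suc n)) φ eq = h-fixed-free m n (y φ) (begin
    h (y φ)                                  ≡⟨ hy φ ⟩
    y⁻ (h φ)                                 ≡⟨ cong y⁻ eq ⟩
    y⁻ (iter x m (iter y (2 + n) φ))         ≡⟨ cong y⁻ (iter-xy m (2 + n) φ) ⟩
    y⁻ (y (y (iter y n (iter x m φ))))       ≡⟨ y⁻y _ ⟩
    y (iter y n (iter x m φ))                ≡⟨ sym (iter-xy m (suc n) φ) ⟩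
    iter x m (y (iter y n φ))                ≡⟨ cong (iter x m) (sym (iter-suc y n φ)) ⟩
    iter x m (iter y n (y φ))                ∎)
    where open ≡-Reasoning
  -- Besides the half-turn about the face, three remain modulo squares: the half-turns about edges
  -- of the three directions. Each is `b` at a suitable flag.
  h-fixed-free 1 zero φ eq = r₂r₀-free φ (sym (trans (sym (hh φ)) (trans (cong h eq) (hh _))))
  h-fixed-free zero 1 φ eq = r₂r₀-free (c⁻ φ) (sym (trans (cong c⁻ (trans (sym (hh φ)) (trans (cong h eq) (cong c (hh _))))) (c⁻c _)))
  h-fixed-free 1 1 φ eq = r₂r₀-free (c⁻ (c⁻ (x φ))) (begin
    b (c⁻ (c⁻ (x φ)))          ≡⟨ sym (cc⁻ _) ⟩
    c (c⁻ (b (c⁻ (c⁻ (x φ))))) ≡⟨ cong c (sym (z≡ (x φ))) ⟩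
    c (z (x φ))                ≡⟨ cong c (zx φ) ⟩
    c (y φ)                    ≡⟨ cong c (sym (x⁻x _)) ⟩
    c (x⁻ (x (y φ)))           ≡⟨ cong (λ θ → c (x⁻ θ)) (sym eq) ⟩
    c (x⁻ (h φ))               ≡⟨ cong c (sym (hx φ)) ⟩
    c (h (x φ))                ≡⟨ ch _ ⟩
    c⁻ (c⁻ (x φ))              ∎)
    where open ≡-Reasoning

  h≉ : ∀ {φ} → ¬ φ ≈ h φ
  h≉ (m , n , eq) = h-fixed-free m n _ (sym eq)

  -- Conjugating the rotation `c²` by the translation `x y` changes the exponent of `x` by three.
  -- Only residues modulo three matter then: 0 is a rotation about a face, 1 and 2 are rotations
  -- about the two classes of vertices.
  c²-shift : ∀ {φ θ} → c (c φ) ≡ x θ → c (c (x (y φ))) ≡ x⁻ (x⁻ (y (x θ)))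
  c²-shift {φ} {θ} eq = begin
    c (c (x (y φ)))           ≡⟨ cong c (cx _) ⟩
    c (y (c (y φ)))           ≡⟨ cy _ ⟩
    z (c (c (y φ)))           ≡⟨ cong (λ ψ → z (c ψ)) (cy φ) ⟩
    z (c (z (c φ)))           ≡⟨ cong (λ ψ → z (c ψ)) (z≡x⁻y _) ⟩
    z (c (x⁻ (y (c φ))))      ≡⟨ z≡x⁻y _ ⟩
    x⁻ (y (c (x⁻ (y (c φ))))) ≡⟨ cong x⁻ (sym (cx _)) ⟩
    x⁻ (c (x (x⁻ (y (c φ))))) ≡⟨ cong (λ ψ → x⁻ (c ψ)) (xx⁻ _) ⟩
    x⁻ (c (y (c φ)))          ≡⟨ cong x⁻ (cy _) ⟩
    x⁻ (z (c (c φ)))          ≡⟨ cong x⁻ (z≡x⁻y _) ⟩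
    x⁻ (x⁻ (y (c (c φ))))     ≡⟨ cong (λ ψ → x⁻ (x⁻ (y ψ))) eq ⟩
    x⁻ (x⁻ (y (x θ)))         ∎
    where open ≡-Reasoning

  c²≢x⁻ : ∀ φ → c (c φ) ≢ x⁻ φ
  c²≢x⁻ φ eq = r₂r₁-free (b (h φ)) (begin
    r₂ (r₁ (b (h φ)))         ≡⟨ cong r₂ (sym (r₀-involutive _)) ⟩
    b (c (b (h φ)))           ≡⟨ cong (λ θ → b (c θ)) (sym eq) ⟩
    b (h φ)                   ∎)
    where open ≡-Reasoning

  c²-x-free : ∀ n φ → c (c φ) ≢ iter x n φ
  c²-x-free 0 φ = r₀r₁²-free φ
  c²-x-free 1 φ eq = r₂r₁-free (b φ) (begin
    r₂ (r₁ (b φ))         ≡⟨ cong r₂ (sym (r₀-involutive _)) ⟩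
    b (c (b φ))           ≡⟨ cong b (trans (sym (c⁻c⁻h _)) (trans (cong (λ θ → c⁻ (c⁻ θ)) (sym eq)) (trans (cong c⁻ (c⁻c _)) (c⁻c _)))) ⟩
    b φ                   ∎)
    where open ≡-Reasoning
  -- The shift by three turns the exponent 2 into -1.
  c²-x-free 2 φ eq = c²≢x⁻ (x (y φ)) (begin
    c (c (x (y φ)))       ≡⟨ c²-shift eq ⟩
    x⁻ (x⁻ (y (x (x φ)))) ≡⟨ cong (λ θ → x⁻ (x⁻ θ)) (trans (sym (xy _)) (cong x (sym (xy φ)))) ⟩
    x⁻ (x⁻ (x (x (y φ)))) ≡⟨ cong x⁻ (x⁻x _) ⟩
    x⁻ (x (y φ))          ∎)
    where open ≡-Reasoning
  c²-x-free (suc (suc (suc n))) φ eq = c²-x-free n (x (y φ)) (begin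
    c (c (x (y φ)))                          ≡⟨ c²-shift eq ⟩
    x⁻ (x⁻ (y (x (x (x (iter x n φ))))))     ≡⟨ cong (λ θ → x⁻ (x⁻ θ)) (trans (sym (xy _)) (cong x (sym (xy _)))) ⟩
    x⁻ (x⁻ (x (x (y (x (iter x n φ))))))     ≡⟨ cong x⁻ (x⁻x _) ⟩
    x⁻ (x (y (x (iter x n φ))))              ≡⟨ x⁻x _ ⟩
    y (x (iter x n φ))                       ≡⟨ cong y (sym (iter-suc x n φ)) ⟩
    y (iter x n (x φ))                       ≡⟨ sym (iter-xy n 1 (x φ)) ⟩
    iter x n (y (x φ))                       ≡⟨ cong (iter x n) (sym (xy φ)) ⟩
    iter x n (x (y φ))                       ∎)
    where open ≡-Reasoning

  x⁻y : ∀ φ → x⁻ (y φ) ≡ y (x⁻ φ)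
  x⁻y φ = trans (cong (λ θ → x⁻ (y θ)) (sym (xx⁻ φ))) (trans (cong x⁻ (sym (xy _))) (x⁻x _))

  c²y : ∀ φ → c (c (y φ)) ≡ x⁻ (c (c φ))
  c²y φ = trans (sym (y⁻y _)) (trans (cong y⁻ (begin
    y (c (c (y φ)))           ≡⟨ cong (λ θ → y (c θ)) (trans (cy φ) (z≡x⁻y _)) ⟩
    y (c (x⁻ (y (c φ))))      ≡⟨ sym (cx _) ⟩
    c (x (x⁻ (y (c φ))))      ≡⟨ cong c (xx⁻ _) ⟩
    c (y (c φ))               ≡⟨ trans (cy _) (z≡x⁻y _) ⟩
    x⁻ (y (c (c φ)))          ≡⟨ x⁻y _ ⟩
    y (x⁻ (c (c φ)))          ∎)) (y⁻y _))
    where open ≡-Reasoning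

  -- Moving the base flag along `y` trades powers of `y` for powers of `x⁻`, by `c²y`, so that only
  -- an exponent of `x` is left.
  c²≉ : ∀ {φ} → ¬ φ ≈ c (c φ)
  c²≉ {φ} (m , n , eq) with X.iter-inverse-reach n (iter x m (iter y n φ))
  ... | k , eq′ = c²-x-free (k + m) (iter y n φ) (begin
    c (c (iter y n φ))                       ≡⟨ iter-conj (λ θ → c (c θ)) y x⁻ c²y n φ ⟩
    iter x⁻ n (c (c φ))                      ≡⟨ cong (iter x⁻ n) (sym eq) ⟩
    iter x⁻ n (iter x m (iter y n φ))        ≡⟨ sym eq′ ⟩
    iter x k (iter x m (iter y n φ))         ≡⟨ sym (iter-+ x k m _) ⟩
    iter x (k + m) (iter y n φ)              ∎)
    where open ≡-Reasoning

  c≉ : ∀ {φ} → ¬ φ ≈ c φ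
  c≉ e = c²≉ (≈-trans e (c-≈ e))

  -- Mirror k φ says that the reflection φ ↦ r₀ (cᵏ φ), followed by a suitable
  -- translation, is a symmetry of the map as seen from φ.
  Mirror : ℕ → F → Set
  Mirror k φ = φ ≈ r₀ (iter c k φ)

  iter-c-≈ : ∀ k {φ ψ} → φ ≈ ψ → iter c k φ ≈ iter c k ψ
  iter-c-≈ zero    e = e
  iter-c-≈ (suc k) e = c-≈ (iter-c-≈ k e)

  r₀-swap : ∀ {φ ψ} → r₀ φ ≈ ψ → φ ≈ r₀ ψ
  r₀-swap e = ≈-trans (≈-reflexive (sym (r₀-involutive _))) (r₀-≈ e)

  h-swap : ∀ {φ ψ} → h φ ≈ ψ → φ ≈ h ψ
  h-swap e = ≈-trans (≈-reflexive (sym (hh _))) (h-≈ e)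

  -- Two mirrors compose to a rotation.
  mirrors : ∀ {φ} k l → Mirror k φ → Mirror l φ → iter c k φ ≈ iter c l φ
  mirrors k l m m′ = ≈-trans (≈-trans (≈-reflexive (sym (r₀-involutive _))) (r₀-≈ (≈-trans (≈-sym m) m′)))
                             (≈-reflexive (r₀-involutive _))

  -- The mirrors of index 0 and 3 are perpendicular and parallel to the edge of `φ` and preserve its
  -- direction; the other four do not.
  Good : F → Set
  Good φ = ¬ Mirror 1 φ × ¬ Mirror 2 φ × ¬ Mirror 4 φ × ¬ Mirror 5 φ

  mirror₀⇒good : ∀ {φ} → Mirror 0 φ → Good φ
  mirror₀⇒good {φ} m =
      (λ e → c≉ (mirrors 0 1 m e))
    , (λ e → c²≉ (mirrors 0 2 m e))
    , (λ e → c²≉ (≈-sym (≈-trans (c-≈ (c-≈ (mirrors 0 4 m e))) (≈-reflexive (hh φ)))))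
    , (λ e → c≉ (≈-sym (≈-trans (c-≈ (mirrors 0 5 m e)) (≈-reflexive (hh φ)))))

  mirror₃⇒good : ∀ {φ} → Mirror 3 φ → Good φ
  mirror₃⇒good m =
      (λ e → c²≉ (≈-sym (mirrors 3 1 m e)))
    , (λ e → c≉ (≈-sym (mirrors 3 2 m e)))
    , (λ e → c≉ (mirrors 3 4 m e))
    , (λ e → c²≉ (mirrors 3 5 m e))

  -- Passing from `φ` to `c φ` lowers the index of a mirror by two modulo six, so one or two
  -- rotations bring it to 0 or 3.
  good-flag : F → ∃ Good
  good-flag φ with φ ≈? r₀ (iter c 1 φ) | φ ≈? r₀ (iter c 2 φ) | φ ≈? r₀ (iter c 4 φ) | φ ≈? r₀ (iter c 5 φ)
  ... | yes m | _ | _ | _ = c (c φ) , mirror₃⇒good (≈-trans (c-≈ (c-≈ m))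
          (≈-reflexive (cong r₀ (trans (cong c⁻ (c⁻c _)) (sym (cch φ))))))
  ... | no _ | yes m | _ | _ = c φ , mirror₀⇒good (≈-trans (c-≈ m) (≈-reflexive (cong r₀ (c⁻c _))))
  ... | no _ | no _ | yes m | _ = c (c φ) , mirror₀⇒good (≈-trans (c-≈ (c-≈ m))
          (≈-reflexive (cong r₀ (trans (cong c⁻ (c⁻c _)) (c⁻c _)))))
  ... | no _ | no _ | no _ | yes m = c φ , mirror₃⇒good (≈-trans (c-≈ m) (≈-reflexive (cong r₀ (c⁻c _))))
  ... | no ¬1 | no ¬2 | no ¬4 | no ¬5 = φ , ¬1 , ¬2 , ¬4 , ¬5

  -- The flags seen from φ in the same position relative to the direction of
  -- the edge of φ, up to the reflections in that edge and its bisector.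
  data Class (φ ψ : F) : Set where
    one  : φ ≈ ψ → Class φ ψ
    flip : φ ≈ r₀ ψ → Class φ ψ
    half : φ ≈ h ψ → Class φ ψ
    both : φ ≈ h (r₀ ψ) → Class φ ψ

  class-refl : ∀ {φ} → Class φ φ
  class-refl = one ≈-refl

  class-≈ : ∀ {φ ψ χ} → ψ ≈ χ → Class φ ψ → Class φ χ
  class-≈ e (one p)  = one (≈-trans p e)
  class-≈ e (flip p) = flip (≈-trans p (r₀-≈ e))
  class-≈ e (half p) = half (≈-trans p (h-≈ e))
  class-≈ e (both p) = both (≈-trans p (h-≈ (r₀-≈ e)))

  class-r₀ : ∀ {φ ψ} → Class φ ψ → Class φ (r₀ ψ)
  class-r₀ (one p)  = flip (≈-trans p (≈-reflexive (sym (r₀-involutive _))))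
  class-r₀ (flip p) = one p
  class-r₀ (half p) = both (≈-trans p (≈-reflexive (cong h (sym (r₀-involutive _)))))
  class-r₀ (both p) = half p

  class-h : ∀ {φ ψ} → Class φ ψ → Class φ (h ψ)
  class-h (one p)  = half (≈-trans p (≈-reflexive (sym (hh _))))
  class-h (flip p) = both (≈-trans p (≈-reflexive (trans (sym (hh _)) (cong h (sym (r₀h _))))))
  class-h (half p) = one p
  class-h (both p) = flip (≈-trans p (≈-reflexive (sym (r₀h _))))

  class-trans : ∀ {φ ψ χ} → Class φ ψ → Class ψ χ → Class φ χ
  class-trans a (one p)  = class-≈ p a
  class-trans a (flip p) = class-≈ (≈-sym (r₀-swap (≈-sym p))) (class-r₀ a)
  class-trans a (half p) = class-≈ (≈-sym (h-swap (≈-sym p))) (class-h a)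
  class-trans a (both p) = class-≈ (≈-sym (r₀-swap (h-swap (≈-sym p)))) (class-r₀ (class-h a))

  class-sym : ∀ {φ ψ} → Class φ ψ → Class ψ φ
  class-sym (one p)  = one (≈-sym p)
  class-sym (flip p) = flip (r₀-swap (≈-sym p))
  class-sym (half p) = half (h-swap (≈-sym p))
  class-sym (both p) = both (≈-trans (r₀-swap (h-swap (≈-sym p))) (≈-reflexive (r₀h _)))

  mirror-≈ : ∀ k {φ ψ} → φ ≈ ψ → Mirror k φ → Mirror k ψ
  mirror-≈ k e m = ≈-trans (≈-sym e) (≈-trans m (r₀-≈ (iter-c-≈ k e)))

  mirror-r₀-1 : ∀ {φ} → Mirror 1 (r₀ φ) → Mirror 5 φ
  mirror-r₀-1 m = ≈-trans (≈-trans (r₀-swap m) (≈-reflexive (r₀-involutive _))) (≈-reflexive (cong r₀ (sym (cch _))))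

  mirror-r₀-4 : ∀ {φ} → Mirror 4 (r₀ φ) → Mirror 2 φ
  mirror-r₀-4 {φ} m = ≈-trans (≈-trans (r₀-swap m) (≈-reflexive (r₀-involutive _)))
    (≈-reflexive (cong r₀ (trans (cong c⁻ (sym (h≡c⁻³ φ))) (c⁻c _))))

  mirror-h : ∀ k {φ} → iter c k (h φ) ≡ h (iter c k φ) → Mirror k (h φ) → Mirror k φ
  mirror-h k eq m = ≈-trans (≈-trans (h-swap m) (h-≈ (≈-reflexive (trans (cong r₀ eq) (r₀h _))))) (≈-reflexive (hh _))

  good-class : ∀ {φ ψ} → Good φ → Class φ ψ → ¬ Mirror 1 ψ × ¬ Mirror 4 ψ
  good-class (¬1 , ¬2 , ¬4 , ¬5) (one p)  = (λ m → ¬1 (mirror-≈ 1 (≈-sym p) m)) , (λ m → ¬4 (mirror-≈ 4 (≈-sym p) m))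
  good-class (¬1 , ¬2 , ¬4 , ¬5) (flip p) =
    let q = ≈-sym (r₀-swap (≈-sym p)) in
    (λ m → ¬5 (mirror-r₀-1 (mirror-≈ 1 (≈-sym q) m))) , (λ m → ¬2 (mirror-r₀-4 (mirror-≈ 4 (≈-sym q) m)))
  good-class (¬1 , ¬2 , ¬4 , ¬5) (half p) =
    let q = ≈-sym (h-swap (≈-sym p)) in
    (λ m → ¬1 (mirror-h 1 refl (mirror-≈ 1 (≈-sym q) m))) , (λ m → ¬4 (mirror-h 4 refl (mirror-≈ 4 (≈-sym q) m)))
  good-class (¬1 , ¬2 , ¬4 , ¬5) (both p) =
    let q = ≈-sym (r₀-swap (h-swap (≈-sym p))) in
    (λ m → ¬5 (mirror-h 5 refl (mirror-r₀-1 (mirror-≈ 1 (≈-sym q) m)))) ,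
    (λ m → ¬2 (mirror-h 2 refl (mirror-r₀-4 (mirror-≈ 4 (≈-sym q) m))))

  -- Comparing `ψ` with `r₁ ψ`, each of the four relations of `Class` amounts to a rotation or to a
  -- mirror of index 1 or 4. Hence the class singles out one edge at every vertex.
  class-r₁ : ∀ {φ ψ} → Good φ → Class φ ψ → ¬ Class φ (r₁ ψ)
  class-r₁ {φ} {ψ} good a a′ with good-class good a | class-trans (class-sym a) a′
  ... | ¬1 , ¬4 | one p  = ¬1 (≈-trans p (≈-reflexive (sym (r₀-involutive _))))
  ... | ¬1 , ¬4 | flip p = c≉ p
  ... | ¬1 , ¬4 | half p = ¬4 (≈-trans p (≈-reflexive (trans (cong h (sym (r₀-involutive _))) (sym (r₀h _)))))
  ... | ¬1 , ¬4 | both p = c²≉ (≈-sym (≈-trans (c-≈ (c-≈ p)) (≈-reflexive (trans (cch _) (c⁻c ψ)))))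

-- Rows and strands

-- A frame is a vertex together with an orientation (left or right) of
-- the zigzag row through it.  E moves one step along the row, U crosses the
-- third edge of the vertex, and ρ reverses the orientation.
record Rows (G : Graph) : Set₁ where
  open Graph G using (Adj)
  field
    Frame   : Set
    finite  : Finite Frame
    E U ρ   : Frame → Frame
    ρρ      : ∀ φ → ρ (ρ φ) ≡ φ
    UU      : ∀ φ → U (U φ) ≡ φ
    Uρ      : ∀ φ → U (ρ φ) ≡ ρ (U φ)
    EρE     : ∀ φ → E (ρ (E φ)) ≡ ρ φ
    EEU     : ∀ φ → E (E (U φ)) ≡ U (E (E φ))
    ρ-free  : ∀ φ → ρ φ ≢ φ
    U-free  : ∀ φ → U φ ≢ φ
    -- What remains of freeness: up to translation, `ρ ∘ U` and `ρ ∘ E` are half-turns about the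
    -- midpoints of a third edge and of a row edge.
    ρU-free : ∀ n φ → ρ (U φ) ≢ iter (E ∘ E) n φ
    E-free  : ∀ n φ → E φ ≢ ρ (iter (E ∘ E) n φ)

    Valid   : Frame → Set
    base    : ∃ Valid
    valid-E : ∀ {φ} → Valid φ → Valid (E φ)
    valid-U : ∀ {φ} → Valid φ → Valid (U φ)
    valid-ρ : ∀ {φ} → Valid φ → Valid (ρ φ)
    vertex  : Frame → Vertex G
    vertex-ρ         : ∀ φ → vertex (ρ φ) ≡ vertex φ
    vertex-injective : ∀ {φ ψ} → Valid φ → Valid ψ → vertex φ ≡ vertex ψ → ψ ≡ φ ⊎ ψ ≡ ρ φ
    adj-U      : ∀ φ → Adj (vertex φ) (vertex (U φ))
    adj-E      : ∀ φ → Adj (vertex φ) (vertex (E φ))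
    U≢E        : ∀ φ → vertex (U φ) ≢ vertex (E φ)
    E≢E        : ∀ φ → vertex (E φ) ≢ vertex (E (ρ φ))
    neighbours : ∀ φ {v} → Adj (vertex φ) v →
                 v ≡ vertex (U φ) ⊎ v ≡ vertex (E φ) ⊎ v ≡ vertex (E (ρ φ))

module Walk {G : Graph} (R : Rows G) where
  open Rows R
  open Finite finite
  open Graph G using (Adj; loopless)

  -- `K` crosses the third edge and takes one more step, to stand on the far side of the next row,
  -- facing back. A strand is an orbit of `K`; the reversal makes it turn alternately left and
  -- right.
  E⁻ A A⁻ K K⁻ : Frame → Frame
  E⁻ φ = ρ (E (ρ φ))
  A φ = E (E φ)
  A⁻ φ = E⁻ (E⁻ φ)
  K φ = ρ (E (U φ))
  K⁻ φ = U (ρ (E φ))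

  E⁻E : ∀ φ → E⁻ (E φ) ≡ φ
  E⁻E φ = trans (cong ρ (EρE φ)) (ρρ φ)

  EE⁻ : ∀ φ → E (E⁻ φ) ≡ φ
  EE⁻ φ = trans (EρE _) (ρρ φ)

  A⁻A : ∀ φ → A⁻ (A φ) ≡ φ
  A⁻A φ = trans (cong E⁻ (E⁻E _)) (E⁻E φ)

  AA⁻ : ∀ φ → A (A⁻ φ) ≡ φ
  AA⁻ φ = trans (cong E (EE⁻ _)) (EE⁻ φ)

  -- The set of removed row edges, presented by its ends: Cut φ means that the
  -- row edge from φ to E φ is replaced by the edge from φ to U φ.
  record Strands : Set₁ where
    field
      Cut   : Frame → Set
      cut?  : ∀ φ → Dec (Cut φ)
      -- These conditions describe a 2-factor: a removed edge is seen from both ends, a third edge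
      -- is used at both ends or at neither, and no vertex loses two row edges.
      cut-E : ∀ {φ} → Cut φ → Cut (ρ (E φ))
      cut-U : ∀ {φ} → Cut φ → Cut (U φ) ⊎ Cut (ρ (U φ))
      cut-ρ : ∀ {φ} → Cut φ → ¬ Cut (ρ φ)

    -- A frame faces the direction of travel. After crossing a third edge it must turn away from the
    -- edge removed at the arrival, hence the test at `U φ`.
    next : Frame → Frame
    next φ with cut? φ | cut? (U φ)
    ... | yes _ | yes _ = ρ (U φ)
    ... | yes _ | no  _ = U φ
    ... | no  _ | _     = E φ

    next-E : ∀ {φ} → ¬ Cut φ → next φ ≡ E φ
    next-E {φ} ¬c with cut? φ
    ... | yes c = contradiction c ¬c
    ... | no _  = refl

    next-ρU : ∀ {φ} → Cut φ → Cut (U φ) → next φ ≡ ρ (U φ)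
    next-ρU {φ} c c′ with cut? φ | cut? (U φ)
    ... | yes _ | yes _ = refl
    ... | yes _ | no ¬c = contradiction c′ ¬c
    ... | no ¬c | _     = contradiction c ¬c

    next-U : ∀ {φ} → Cut φ → Cut (ρ (U φ)) → next φ ≡ U φ
    next-U {φ} c c′ with cut? φ | cut? (U φ)
    ... | yes _ | yes d = contradiction c′ (cut-ρ d)
    ... | yes _ | no _  = refl
    ... | no ¬c | _     = contradiction c ¬c

    next-ρ-next : ∀ φ → next (ρ (next φ)) ≡ ρ φ
    next-ρ-next φ with cut? φ
    next-ρ-next φ | no ¬c with cut? (U φ)
    ... | _ = trans (next-E (λ c → ¬c (subst Cut (trans (cong ρ (EρE φ)) (ρρ φ)) (cut-E c)))) (EρE φ)
    next-ρ-next φ | yes c with cut? (U φ)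
    ... | yes d = trans (cong next (ρρ _)) (trans (next-ρU d (subst Cut (sym (UU φ)) c)) (cong ρ (UU φ)))
    ... | no ¬d with cut-U c
    ... | inj₁ d = contradiction d ¬d
    ... | inj₂ d = trans (next-U d (subst Cut (trans (sym (ρρ φ)) (cong ρ (trans (sym (cong ρ (UU φ))) (sym (Uρ (U φ)))))) c))
                         (trans (Uρ _) (cong ρ (UU φ)))

    previous : Frame → Frame
    previous φ = ρ (next (ρ φ))

    previous-next : ∀ φ → previous (next φ) ≡ φ
    previous-next φ = trans (cong ρ (next-ρ-next φ)) (ρρ φ)

    adj-next : ∀ φ → Adj (vertex φ) (vertex (next φ))
    adj-next φ with cut? φ | cut? (U φ)
    ... | yes _ | yes _ = subst (Adj _) (sym (vertex-ρ _)) (adj-U φ)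
    ... | yes _ | no  _ = adj-U φ
    ... | no  _ | _     = adj-E φ

    valid-next : ∀ {φ} → Valid φ → Valid (next φ)
    valid-next {φ} v with cut? φ | cut? (U φ)
    ... | yes _ | yes _ = valid-ρ (valid-U v)
    ... | yes _ | no  _ = valid-U v
    ... | no  _ | _     = valid-E v

    vertex-next : ∀ φ → (Cut φ × vertex (next φ) ≡ vertex (U φ)) ⊎ vertex (next φ) ≡ vertex (E φ)
    vertex-next φ with cut? φ | cut? (U φ)
    ... | yes c | yes _ = inj₁ (c , vertex-ρ _)
    ... | yes c | no  _ = inj₁ (c , refl)
    ... | no  _ | _     = inj₂ refl

    no-turn-back : ∀ φ → vertex (next φ) ≢ vertex (next (ρ φ))
    no-turn-back φ eq with vertex-next φ | vertex-next (ρ φ)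
    ... | inj₁ (c , e) | inj₁ (c′ , _) = cut-ρ c c′
    ... | inj₁ (c , e) | inj₂ e′ = U≢E (ρ φ) (trans (trans (cong vertex (Uρ φ)) (vertex-ρ _)) (trans (sym e) (trans eq e′)))
    ... | inj₂ e | inj₁ (c , e′) = U≢E φ (sym (trans (sym e) (trans eq (trans e′ (trans (cong vertex (Uρ φ)) (vertex-ρ _))))))
    ... | inj₂ e | inj₂ e′ = E≢E φ (trans (sym e) (trans eq e′))

    next-loopless : ∀ {φ ψ} → vertex φ ≡ vertex ψ → next φ ≢ ψ
    next-loopless {φ} eq refl = loopless _ (subst (Adj _) (sym eq) (adj-next φ))

    -- The walk never returns to a vertex in the opposite direction: such a
    -- return would retrace the walk, down to a frame with next φ ≡ ρ φ.
    no-reversal : ∀ n φ → iter next n φ ≢ ρ φ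
    no-reversal zero    φ eq = ρ-free φ (sym eq)
    no-reversal (suc zero) φ eq = next-loopless (sym (vertex-ρ φ)) eq
    no-reversal (suc (suc n)) φ eq = no-reversal n (next φ) (begin
      iter next n (next φ)                 ≡⟨ iter-suc next n φ ⟩
      iter next (suc n) φ                  ≡⟨ sym (previous-next _) ⟩
      previous (iter next (suc (suc n)) φ) ≡⟨ cong previous eq ⟩
      ρ (next (ρ (ρ φ)))                   ≡⟨ cong (ρ ∘ next) (ρρ φ) ⟩
      ρ (next φ)                           ∎)
      where open ≡-Reasoning

    -- Lying on the same cycle of the 2-factor traversed by next.
    infix 4 _~_
    data _~_ : Frame → Frame → Set where
      ~-refl  : ∀ {φ} → φ ~ φ
      ~-sym   : ∀ {φ ψ} → φ ~ ψ → ψ ~ φ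
      ~-trans : ∀ {φ ψ χ} → φ ~ ψ → ψ ~ χ → φ ~ χ
      ~-ρ     : ∀ {φ} → φ ~ ρ φ
      ~-next  : ∀ {φ} → φ ~ next φ

    ~-reflexive : ∀ {φ ψ} → φ ≡ ψ → φ ~ ψ
    ~-reflexive refl = ~-refl

    ~-E : ∀ {φ} → ¬ Cut φ → φ ~ E φ
    ~-E ¬c = ~-trans ~-next (~-reflexive (next-E ¬c))

    ~-U : ∀ {φ} → Cut φ → φ ~ U φ
    ~-U {φ} c with cut-U c
    ... | inj₁ d = ~-trans ~-next (~-trans (~-reflexive (next-ρU c d)) (~-sym ~-ρ))
    ... | inj₂ d = ~-trans ~-next (~-reflexive (next-U c d))

    module Cyclic {φ₀} (v₀ : Valid φ₀) (connected : ∀ {φ} → Valid φ → φ₀ ~ φ) where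
      open Permutation finite next previous previous-next

      at : ℕ → Frame
      at n = iter next n φ₀

      valid-at : ∀ n → Valid (at n)
      valid-at zero    = v₀
      valid-at (suc n) = valid-next (valid-at n)

      Visited : Frame → Set
      Visited φ = ∃ λ n → at n ≡ φ ⊎ at n ≡ ρ φ

      visited-ρ : ∀ {φ} → Visited φ → Visited (ρ φ)
      visited-ρ (n , inj₁ e) = n , inj₂ (trans e (sym (ρρ _)))
      visited-ρ (n , inj₂ e) = n , inj₁ e

      visited-next : ∀ {φ} → Visited φ → Visited (next φ)
      visited-next (n , inj₁ e) = suc n , inj₁ (cong next e)
      -- The walk passed here in the opposite direction, so `next φ` was met one step earlier; by
      -- periodicity that is also a later time.
      visited-next {φ} (n , inj₂ e) with inverse-reach (at n)
      ... | m , e′ = m + n , inj₂ (trans (iter-+ next m n φ₀)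
        (trans e′ (trans (cong previous e) (cong (ρ ∘ next) (ρρ φ)))))

      visited-previous : ∀ {φ} → Visited (next φ) → Visited φ
      visited-previous (n , inj₁ e) with inverse-reach (at n)
      ... | m , e′ = m + n , inj₁ (trans (iter-+ next m n φ₀) (trans e′ (trans (cong previous e) (previous-next _))))
      visited-previous {φ} (n , inj₂ e) = suc n , inj₂ (trans (cong next e) (next-ρ-next φ))

      visited-~ : ∀ {φ ψ} → φ ~ ψ → (Visited φ → Visited ψ) × (Visited ψ → Visited φ)
      visited-~ ~-refl = (λ v → v) , (λ v → v)
      visited-~ (~-sym p) with visited-~ p
      ... | f , g = g , f
      visited-~ (~-trans p q) with visited-~ p | visited-~ q
      ... | f , g | f′ , g′ = f′ ∘ f , g ∘ g′
      visited-~ ~-ρ = visited-ρ , (λ v → subst Visited (ρρ _) (visited-ρ v))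
      visited-~ ~-next = visited-next , visited-previous

      path : ℕ → Vertex G
      path n = vertex (at n)

      visited-vertex : ∀ {φ} → Visited φ → ∃ λ n → path n ≡ vertex φ
      visited-vertex (n , inj₁ e) = n , cong vertex e
      visited-vertex (n , inj₂ e) = n , trans (cong vertex e) (vertex-ρ _)

      path-all : (∀ v → ∃ λ φ → Valid φ × vertex φ ≡ v) → ∀ v → ∃ λ n → path n ≡ v
      path-all cover v with cover v
      ... | φ , vφ , eq with visited-vertex (proj₁ (visited-~ (connected vφ)) (0 , inj₁ refl))
      ... | n , e = n , trans e eq

      -- The cycle is one minimal period of the walk. A repeated vertex would give equal frames,
      -- against minimality, or opposite ones, against `no-reversal`.
      hamiltonian : (∀ v → ∃ λ φ → Valid φ × vertex φ ≡ v) → Hamiltonian G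
      hamiltonian cover with minimal-period φ₀
      ... | p , fp , min = cycle , λ v → ∈-path v (path-all cover v)
        where
        distinct-path : ∀ {i j} → i < j → j < suc p → path i ≢ path j
        distinct-path {i} {j} i<j j<p eq with vertex-injective (valid-at i) (valid-at j) eq
        ... | inj₁ e = min (j ∸ i) (m<n⇒0<n∸m i<j) (≤-<-trans (m∸n≤m j i) j<p)
                           (iter-cancel (<⇒≤ i<j) (sym e))
        ... | inj₂ e = no-reversal (j ∸ i) (at i)
          (trans (sym (iter-+ next (j ∸ i) i φ₀)) (trans (cong at (m∸n+n≡m (<⇒≤ i<j))) e))

        closing : ∀ {f : ℕ → Vertex G} n → (∀ i → Adj (f i) (f (suc i))) →
                  All (uncurry Adj) (zip (applyUpTo f (suc n)) (applyUpTo (f ∘ suc) n ∷ʳ f (suc n)))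
        closing zero    a = a 0 ∷ []
        closing (suc n) a = a 0 ∷ closing n (a ∘ suc)

        long-enough : ∀ n → iter next (suc n) φ₀ ≡ φ₀ → 3 ≤ suc n
        long-enough 0 e = contradiction e (next-loopless refl)
        long-enough 1 e = contradiction
          (trans (cong vertex (trans (sym (previous-next _)) (cong previous e))) (vertex-ρ _))
          (no-turn-back φ₀)
        long-enough (suc (suc n)) e = s≤s (s≤s (s≤s z≤n))

        cycle : Cycle G
        cycle = record
          { vertices = applyUpTo path (suc p)
          ; long     = subst (3 ≤_) (sym (length-applyUpTo path (suc p))) (long-enough p fp)
          ; distinct = Uniqueₚ.applyUpTo⁺₁ path (suc p) distinct-path
          ; adjacent = subst (λ v → All (uncurry Adj) (zip (applyUpTo path (suc p)) (applyUpTo (path ∘ suc) p ∷ʳ v)))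
                             (cong vertex fp) (closing p (λ i → adj-next (at i)))
          }

        ∈-path : ∀ v → (∃ λ n → path n ≡ v) → v ∈ applyUpTo path (suc p)
        ∈-path v (n , e) = subst (_∈ applyUpTo path (suc p)) (trans (cong vertex (iter-% next fp n)) e)
                                 (∈-applyUpTo⁺ path (m%n<n n (suc p)))

  -- A path in the graph is lifted to frames. Its last frame is determined by the vertex only up to
  -- `ρ`, which `P` therefore has to respect.
  valid-induction : (∀ u v → Star Adj u v) → {P : Frame → Set} → ∀ {φ₀} → Valid φ₀ → P φ₀ →
    (∀ {φ} → Valid φ → P φ → P (ρ φ)) → (∀ {φ} → Valid φ → P φ → P (E φ)) → (∀ {φ} → Valid φ → P φ → P (U φ)) →
    (∀ {φ} → Valid φ → P φ) × (∀ v → ∃ λ φ → Valid φ × vertex φ ≡ v)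
  valid-induction star {P} {φ₀} v₀ p₀ pρ pE pU =
    (λ {φ} vφ → at-vertex vφ (reach (star (vertex φ₀) (vertex φ)) φ₀ refl v₀ p₀)) ,
    (λ v → let (φ , vφ , _ , e) = reach (star (vertex φ₀) v) φ₀ refl v₀ p₀ in φ , vφ , e)
    where
    at-vertex : ∀ {φ} → Valid φ → (∃ λ ψ → Valid ψ × P ψ × vertex ψ ≡ vertex φ) → P φ
    at-vertex vφ (ψ , vψ , pψ , e) with vertex-injective vψ vφ e
    ... | inj₁ refl = pψ
    ... | inj₂ refl = pρ vψ pψ
    reach : ∀ {u v} → Star Adj u v → ∀ φ → vertex φ ≡ u → Valid φ → P φ →
            ∃ λ ψ → Valid ψ × P ψ × vertex ψ ≡ v
    reach ε φ e vφ pφ = φ , vφ , pφ , e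
    reach (a ◅ as) φ refl vφ pφ with neighbours φ a
    ... | inj₁ refl        = reach as (U φ) refl (valid-U vφ) (pU vφ pφ)
    ... | inj₂ (inj₁ refl) = reach as (E φ) refl (valid-E vφ) (pE vφ pφ)
    ... | inj₂ (inj₂ refl) = reach as (E (ρ φ)) refl (valid-E (valid-ρ vφ)) (pE (valid-ρ vφ) (pρ vφ pφ))

-- The two sides of a row

module Sides {G : Graph} (R : Rows G) where
  open Rows R
  open Finite finite
  open Walk R public

  module 𝔸 = Permutation finite A A⁻ A⁻A

  ρE : ∀ φ → ρ (E φ) ≡ E⁻ (ρ φ)
  ρE φ = cong (ρ ∘ E) (sym (ρρ φ))

  Eρ : ∀ φ → E (ρ φ) ≡ ρ (E⁻ φ)
  Eρ φ = sym (ρρ _)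

  ρA : ∀ φ → ρ (A φ) ≡ A⁻ (ρ φ)
  ρA φ = trans (ρE _) (cong E⁻ (ρE φ))

  UA : ∀ φ → U (A φ) ≡ A (U φ)
  UA φ = sym (EEU φ)

  UA⁻ : ∀ φ → U (A⁻ φ) ≡ A⁻ (U φ)
  UA⁻ φ = trans (sym (A⁻A _)) (cong A⁻ (trans (EEU _) (cong U (AA⁻ φ))))

  E⁻A : ∀ φ → E⁻ (A φ) ≡ E φ
  E⁻A φ = E⁻E (E φ)

  KA : ∀ φ → K (A φ) ≡ A⁻ (K φ)
  KA φ = trans (cong (ρ ∘ E) (UA φ)) (ρA _)

  KA⁻ : ∀ φ → K (A⁻ φ) ≡ A (K φ)
  KA⁻ φ = trans (sym (AA⁻ _)) (cong A (trans (sym (KA _)) (cong K (AA⁻ φ))))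

  K⁻K : ∀ φ → K⁻ (K φ) ≡ φ
  K⁻K φ = trans (cong (U ∘ ρ) (EρE _)) (trans (cong U (ρρ _)) (UU φ))

  KK⁻ : ∀ φ → K (K⁻ φ) ≡ φ
  KK⁻ φ = trans (cong (ρ ∘ E) (UU _)) (trans (cong ρ (EρE φ)) (ρρ φ))

  K⁻A : ∀ φ → K⁻ (A φ) ≡ A⁻ (K⁻ φ)
  K⁻A φ = trans (cong (K⁻ ∘ A) (sym (KK⁻ φ))) (trans (cong K⁻ (sym (KA⁻ _))) (K⁻K _))

  module 𝕂 = Permutation finite K K⁻ K⁻K

  ρE-involutive : ∀ φ → ρ (E (ρ (E φ))) ≡ φ
  ρE-involutive φ = E⁻E φ

  iter-A-E : ∀ n φ → iter A n φ ≡ iter E n (iter E n φ)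
  iter-A-E zero    φ = refl
  iter-A-E (suc n) φ = cong E (trans (cong E (iter-A-E n φ)) (trans (sym (iter-suc E n _)) refl))

  -- The frame half-way between `φ` and its reversal would be fixed by `ρ`.
  A-ρ-free : ∀ n φ → iter A n φ ≢ ρ φ
  A-ρ-free n φ eq = ρ-free (iter E n φ) (begin
    ρ (iter E n φ)                     ≡⟨ iter-conj ρ E E⁻ ρE n φ ⟩
    iter E⁻ n (ρ φ)                    ≡⟨ cong (iter E⁻ n) (trans (sym eq) (iter-A-E n φ)) ⟩
    iter E⁻ n (iter E n (iter E n φ))  ≡⟨ iter-inverse E E⁻ E⁻E n _ ⟩
    iter E n φ                         ∎)
    where open ≡-Reasoning

  infix 4 _⟶_ _∥_
  -- φ ⟶ ψ: ψ is an even number of steps along the row from φ.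
  -- φ ∥ ψ: the same up to orientation, so that the third edges of φ and ψ
  -- leave the row on the same side.
  _⟶_ _∥_ : Frame → Frame → Set
  φ ⟶ ψ = ∃ λ n → iter A n φ ≡ ψ
  φ ∥ ψ = φ ⟶ ψ ⊎ φ ⟶ ρ ψ

  _⟶?_ : ∀ φ ψ → Dec (φ ⟶ ψ)
  _⟶?_ = 𝔸.reach?

  _∥?_ : ∀ φ ψ → Dec (φ ∥ ψ)
  φ ∥? ψ = (φ ⟶? ψ) ⊎-dec (φ ⟶? ρ ψ)

  ⟶-refl : ∀ {φ} → φ ⟶ φ
  ⟶-refl = 0 , refl

  ⟶-reflexive : ∀ {φ ψ} → φ ≡ ψ → φ ⟶ ψ
  ⟶-reflexive e = 0 , e

  ⟶-sym : ∀ {φ ψ} → φ ⟶ ψ → ψ ⟶ φ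
  ⟶-sym (n , e) = 𝔸.reach-sym n e

  ⟶-trans : ∀ {φ ψ χ} → φ ⟶ ψ → ψ ⟶ χ → φ ⟶ χ
  ⟶-trans {φ} (n , refl) (m , e) = m + n , trans (iter-+ A m n φ) e

  ⟶-A : ∀ {φ} → φ ⟶ A φ
  ⟶-A = 1 , refl

  ⟶-iterA : ∀ n {φ} → φ ⟶ iter A n φ
  ⟶-iterA n = n , refl

  ⟶-iterA⁻ : ∀ n {φ} → φ ⟶ iter A⁻ n φ
  ⟶-iterA⁻ n {φ} = 𝔸.iter-inverse-reach n φ

  ⟶-A⁻ : ∀ {φ} → φ ⟶ A⁻ φ
  ⟶-A⁻ = ⟶-iterA⁻ 1

  ⟶-cong : ∀ {f} → (∀ φ → f (A φ) ≡ A (f φ)) ⊎ (∀ φ → f (A φ) ≡ A⁻ (f φ)) →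
           ∀ {φ ψ} → φ ⟶ ψ → f φ ⟶ f ψ
  ⟶-cong {f} (inj₁ fA) {φ} (n , refl) = n , sym (iter-conj f A A fA n φ)
  ⟶-cong {f} (inj₂ fA) {φ} (n , refl) =
    subst (f φ ⟶_) (sym (iter-conj f A A⁻ fA n φ)) (⟶-iterA⁻ n)

  ⟶-ρ : ∀ {φ ψ} → φ ⟶ ψ → ρ φ ⟶ ρ ψ
  ⟶-ρ = ⟶-cong (inj₂ ρA)

  ⟶-E : ∀ {φ ψ} → φ ⟶ ψ → E φ ⟶ E ψ
  ⟶-E = ⟶-cong (inj₁ λ _ → refl)

  ⟶-U : ∀ {φ ψ} → φ ⟶ ψ → U φ ⟶ U ψ
  ⟶-U = ⟶-cong (inj₁ UA)

  ⟶-K : ∀ {φ ψ} → φ ⟶ ψ → K φ ⟶ K ψ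
  ⟶-K = ⟶-cong (inj₂ KA)

  ⟶-K⁻ : ∀ {φ ψ} → φ ⟶ ψ → K⁻ φ ⟶ K⁻ ψ
  ⟶-K⁻ = ⟶-cong (inj₂ K⁻A)

  ⟶-iter : ∀ {f} → (∀ {φ ψ} → φ ⟶ ψ → f φ ⟶ f ψ) → ∀ n {φ ψ} → φ ⟶ ψ → iter f n φ ⟶ iter f n ψ
  ⟶-iter f⟶ zero    p = p
  ⟶-iter f⟶ (suc n) p = f⟶ (⟶-iter f⟶ n p)

  ⟶-¬ρ : ∀ {φ} → ¬ φ ⟶ ρ φ
  ⟶-¬ρ (n , e) = A-ρ-free n _ e

  ∥-refl : ∀ {φ} → φ ∥ φ
  ∥-refl = inj₁ ⟶-refl

  ∥-reflexive : ∀ {φ ψ} → φ ≡ ψ → φ ∥ ψ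
  ∥-reflexive refl = ∥-refl

  ρ-swap : ∀ {φ ψ} → ρ φ ⟶ ψ → φ ⟶ ρ ψ
  ρ-swap p = subst (_⟶ _) (ρρ _) (⟶-ρ p)

  ∥-sym : ∀ {φ ψ} → φ ∥ ψ → ψ ∥ φ
  ∥-sym (inj₁ p) = inj₁ (⟶-sym p)
  ∥-sym (inj₂ p) = inj₂ (ρ-swap (⟶-sym p))

  ∥-trans : ∀ {φ ψ χ} → φ ∥ ψ → ψ ∥ χ → φ ∥ χ
  ∥-trans (inj₁ p) (inj₁ q) = inj₁ (⟶-trans p q)
  ∥-trans (inj₁ p) (inj₂ q) = inj₂ (⟶-trans p q)
  ∥-trans (inj₂ p) (inj₁ q) = inj₂ (⟶-trans p (⟶-ρ q))
  ∥-trans (inj₂ p) (inj₂ q) = inj₁ (⟶-trans p (subst (_ ⟶_) (ρρ _) (⟶-ρ q)))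

  ∥-ρ : ∀ {φ} → φ ∥ ρ φ
  ∥-ρ = inj₂ (⟶-reflexive (sym (ρρ _)))

  ∥-E : ∀ {φ ψ} → φ ∥ ψ → E φ ∥ E ψ
  ∥-E (inj₁ p) = inj₁ (⟶-E p)
  ∥-E {φ} {ψ} (inj₂ p) = inj₂ (⟶-trans (⟶-E p) (⟶-trans ⟶-A⁻
    (⟶-reflexive (trans (cong E⁻ (E⁻E _)) (sym (ρE ψ))))))

  ∥-U : ∀ {φ ψ} → φ ∥ ψ → U φ ∥ U ψ
  ∥-U (inj₁ p) = inj₁ (⟶-U p)
  ∥-U (inj₂ p) = inj₂ (subst (_ ⟶_) (Uρ _) (⟶-U p))

  ∥-ρρ : ∀ {φ ψ} → φ ∥ ψ → ρ φ ∥ ρ ψ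
  ∥-ρρ p = ∥-trans (∥-sym ∥-ρ) (∥-trans p ∥-ρ)

  ∥-K : ∀ {φ ψ} → φ ∥ ψ → K φ ∥ K ψ
  ∥-K p = ∥-ρρ (∥-E (∥-U p))

  ∥-K⁻ : ∀ {φ ψ} → φ ∥ ψ → K⁻ φ ∥ K⁻ ψ
  ∥-K⁻ p = ∥-U (∥-ρρ (∥-E p))

  ∥-iter : ∀ {f} → (∀ {φ ψ} → φ ∥ ψ → f φ ∥ f ψ) → ∀ n {φ ψ} → φ ∥ ψ → iter f n φ ∥ iter f n ψ
  ∥-iter f∥ zero    p = p
  ∥-iter f∥ (suc n) p = f∥ (∥-iter f∥ n p)

  ∥-K-cancel : ∀ n {φ ψ} → iter K n φ ∥ iter K n ψ → φ ∥ ψ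
  ∥-K-cancel n {φ} {ψ} p =
    subst₂ _∥_ (iter-inverse K K⁻ K⁻K n φ) (iter-inverse K K⁻ K⁻K n ψ) (∥-iter ∥-K⁻ n p)

  ∥-K-difference : ∀ {m n φ} → m ≤ n → iter K m φ ∥ iter K n φ → φ ∥ iter K (n ∸ m) φ
  ∥-K-difference {m} {n} {φ} m≤n p = ∥-K-cancel m (∥-trans p (∥-reflexive
    (trans (cong (λ k → iter K k φ) (sym (m+[n∸m]≡n m≤n))) (iter-+ K m (n ∸ m) φ))))

  -- Two consecutive rows of a stack, φ₀ standing below them: at every frame σ
  -- of the side of φ₀ with Q σ, both rows are cut next to the third edge of σ.
  module TwoRows (S : Strands) {φ₀ : Frame} (Q : Frame → Set) (Q? : ∀ φ → Dec (Q φ))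
    (cut-K : ∀ {σ} → φ₀ ⟶ σ → Strands.Cut S (K σ) → Q σ)
    (¬cut-ρU : ∀ {σ} → φ₀ ⟶ σ → ¬ Strands.Cut S (ρ (U σ)))
    where
    open Strands S

    -- Every second edge of the row survives: of the two row edges at `U σ`, only the one ahead can
    -- be cut.
    UA~K : ∀ {σ} → φ₀ ⟶ σ → U (A σ) ~ K σ
    UA~K {σ} p = ~-trans ~-ρ (~-trans (~-E (¬cut-ρU (⟶-trans p ⟶-A))) (~-reflexive (begin
      E (ρ (U (A σ)))   ≡⟨ Eρ _ ⟩
      ρ (E⁻ (U (A σ)))  ≡⟨ cong (ρ ∘ E⁻) (UA σ) ⟩
      ρ (E⁻ (A (U σ)))  ≡⟨ cong ρ (E⁻A _) ⟩
      ρ (E (U σ))       ∎)))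
      where open ≡-Reasoning

    K~U : ∀ {σ} → φ₀ ⟶ σ → ¬ Q σ → K σ ~ U σ
    K~U p ¬q = ~-trans (~-E (¬q ∘ cut-K p)) (~-trans (~-reflexive (EρE _)) (~-sym ~-ρ))

    -- The untouched piece of a row between two strands: it runs from the upper end of one removed
    -- edge to the lower end of the next.
    segment : ∀ g {σ} → φ₀ ⟶ σ → (∀ k → 0 < k → k < suc g → ¬ Q (iter A k σ)) →
              K σ ~ U (iter A (suc g) σ)
    segment zero    p gap = ~-sym (UA~K p)
    segment (suc g) {σ} p gap = ~-trans (segment g p (λ k 0<k k<g → gap k 0<k (m<n⇒m<1+n k<g)))
      (~-trans (~-sym (K~U q (gap (suc g) (s≤s z≤n) (n<1+n _)))) (~-sym (UA~K q)))
      where q = ⟶-trans p (⟶-iterA (suc g))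

    module _ {σ₁} (p₁ : φ₀ ⟶ σ₁) (q₁ : Q σ₁) where

      next-strand : ∀ {σ} → φ₀ ⟶ σ → ∃ λ g → Q (iter A (suc g) σ) ×
                    (∀ k → 0 < k → k < suc g → ¬ Q (iter A k σ))
      next-strand {σ} p with ⟶-trans (⟶-sym p) p₁ | 𝔸.period σ
      ... | n , e | t , per = least⁺ (λ n → Q? (iter A n σ))
        -- A full turn is added to make the exponent positive, in case `σ` carries the only strand.
        (t + n , subst Q (sym (trans (iter-+ A (suc t) n σ) (trans (iter-comm A (suc t) n σ)
          (trans (cong (iter A n) per) e)))) q₁)

      previous-strand : ∀ {σ} → φ₀ ⟶ σ → ∃ λ g → Q (iter A⁻ (suc g) σ) ×
                        (∀ k → 0 < k → k < suc g → ¬ Q (iter A⁻ k σ))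
      previous-strand {σ} p with ⟶-trans (⟶-sym p) p₁ | 𝔸′.period σ
        where module 𝔸′ = Permutation finite A⁻ A AA⁻
      ... | n , e | t , per with 𝔸″.iter-inverse-reach n σ
        where module 𝔸″ = Permutation finite A⁻ A AA⁻
      ... | n′ , e′ = least⁺ (λ n → Q? (iter A⁻ n σ))
        (t + n′ , subst Q (sym (trans (iter-+ A⁻ (suc t) n′ σ) (trans (iter-comm A⁻ (suc t) n′ σ)
          (trans (cong (iter A⁻ n′) per) (trans e′ e))))) q₁)

      K~strand : ∀ {σ} → φ₀ ⟶ σ → ∃ λ σ′ → φ₀ ⟶ σ′ × Q σ′ × K σ ~ U σ′
      K~strand {σ} p with next-strand p
      ... | g , q , gap = iter A (suc g) σ , ⟶-trans p (⟶-iterA (suc g)) , q , segment g p gap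

      U~strand : ∀ {σ} → φ₀ ⟶ σ → ∃ λ σ′ → φ₀ ⟶ σ′ × Q σ′ × U σ ~ U σ′
      U~strand {σ} p with Q? σ
      ... | yes q = σ , p , q , ~-refl
      ... | no ¬q with K~strand p
      ... | σ′ , p′ , q′ , c = σ′ , p′ , q′ , ~-trans (~-sym (K~U p ¬q)) c

-- A stack of q rows, cut along the strands through the frames in P: a strand
-- moves alternately left and right from row to row.
module Stack {G : Graph} (R : Rows G) {φ₀ : Rows.Frame R} (q : ℕ)
  (P : Rows.Frame R → Set) (P? : ∀ φ → Dec (P φ)) (P-side : ∀ {ψ} → P ψ → Sides._⟶_ R φ₀ ψ)
  (levels : ∀ d → 0 < d → d < q → ¬ Sides._∥_ R φ₀ (iter (Sides.K R) d φ₀))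
  (sides : ∀ {i j} → i < q → j < q →
    ¬ Sides._∥_ R (iter (Sides.K R) (suc i) φ₀) (Rows.U R (iter (Sides.K R) j φ₀)))
  where
  open Rows R
  open Finite finite
  open Sides R

  -- The two forms are the upper and the lower end of the edge that the strand from `ψ` removes from
  -- one row.
  Stacked : Frame → Set
  Stacked φ = ∃₂ λ i ψ → i < q × P ψ × (iter K (suc i) ψ ≡ φ ⊎ U (iter K i ψ) ≡ φ)

  iter-K-K⁻ : ∀ n φ → iter K n (iter K⁻ n φ) ≡ φ
  iter-K-K⁻ = iter-inverse K⁻ K KK⁻

  stacked? : ∀ φ → Dec (Stacked φ)
  stacked? φ = Dec.map′
    (λ { (i , i<q , inj₁ p) → i , _ , i<q , p , inj₁ (iter-K-K⁻ (suc i) φ)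
       ; (i , i<q , inj₂ p) → i , _ , i<q , p , inj₂ (trans (cong U (iter-K-K⁻ i (U φ))) (UU φ)) })
    (λ { (i , ψ , i<q , p , inj₁ refl) → i , i<q , inj₁ (subst P (sym (iter-inverse K K⁻ K⁻K (suc i) ψ)) p)
       ; (i , ψ , i<q , p , inj₂ refl) → i , i<q ,
           inj₂ (subst P (sym (trans (cong (iter K⁻ i) (UU _)) (iter-inverse K K⁻ K⁻K i ψ))) p) })
    (anyUpTo? (λ i → P? (iter K⁻ (suc i) φ) ⊎-dec P? (iter K⁻ i (U φ))) q)

  ⟶-iterK : ∀ n {φ ψ} → φ ⟶ ψ → iter K n φ ⟶ iter K n ψ
  ⟶-iterK = ⟶-iter ⟶-K

  level-unique : ∀ {i j ψ ψ′} → φ₀ ⟶ ψ → φ₀ ⟶ ψ′ → i < q → j < q → iter K i ψ ∥ iter K j ψ′ → i ≡ j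
  level-unique {i} {j} p p′ i<q j<q e with <-cmp i j
  ... | tri≈ _ eq _ = eq
  ... | tri< i<j _ _ = contradiction
    (∥-K-difference (<⇒≤ i<j) (∥-trans (inj₁ (⟶-iterK i p)) (∥-trans e (∥-sym (inj₁ (⟶-iterK j p′))))))
    (levels (j ∸ i) (m<n⇒0<n∸m i<j) (≤-<-trans (m∸n≤m j i) j<q))
  ... | tri> _ _ j<i = contradiction
    (∥-K-difference (<⇒≤ j<i) (∥-sym (∥-trans (inj₁ (⟶-iterK i p)) (∥-trans e (∥-sym (inj₁ (⟶-iterK j p′)))))))
    (levels (i ∸ j) (m<n⇒0<n∸m j<i) (≤-<-trans (m∸n≤m i j) i<q))

  sides-disjoint : ∀ {i j ψ ψ′} → φ₀ ⟶ ψ → φ₀ ⟶ ψ′ → i < q → j < q → ¬ iter K (suc i) ψ ∥ U (iter K j ψ′)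
  sides-disjoint {i} {j} p p′ i<q j<q e = sides i<q j<q
    (∥-trans (inj₁ (⟶-iterK (suc i) p)) (∥-trans e (∥-sym (∥-U (inj₁ (⟶-iterK j p′))))))

  K-stacked : ∀ {i ψ φ} → i < q → φ₀ ⟶ ψ → iter K (suc i) ψ ∥ φ → Stacked φ →
              ∃ λ ψ′ → P ψ′ × iter K (suc i) ψ′ ≡ φ
  K-stacked i<q p e (j , ψ′ , j<q , pψ′ , inj₁ refl)
    with refl ← level-unique p (P-side pψ′) i<q j<q (∥-K-cancel 1 e) = ψ′ , pψ′ , refl
  K-stacked i<q p e (j , ψ′ , j<q , pψ′ , inj₂ refl) =
    contradiction e (sides-disjoint p (P-side pψ′) i<q j<q)

  U-stacked : ∀ {i ψ φ} → i < q → φ₀ ⟶ ψ → U (iter K i ψ) ∥ φ → Stacked φ →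
              ∃ λ ψ′ → P ψ′ × U (iter K i ψ′) ≡ φ
  U-stacked i<q p e (j , ψ′ , j<q , pψ′ , inj₂ refl)
    with refl ← level-unique p (P-side pψ′) i<q j<q (subst₂ _∥_ (UU _) (UU _) (∥-U e)) = ψ′ , pψ′ , refl
  U-stacked i<q p e (j , ψ′ , j<q , pψ′ , inj₁ refl) =
    contradiction (∥-sym e) (sides-disjoint (P-side pψ′) p j<q i<q)

  P-K : ∀ {i ψ} → i < q → φ₀ ⟶ ψ → Stacked (iter K (suc i) ψ) → P ψ
  P-K {i} i<q p s with K-stacked i<q p ∥-refl s
  ... | ψ′ , pψ′ , e = subst P (𝕂.iter-injective (suc i) e) pψ′

  -- All strands start with the same orientation along the side of `φ₀`, and `K` preserves this
  -- agreement; a cut on the other hand would join a frame to its reversal.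
  ¬stacked-ρK : ∀ {i ψ} → i < q → φ₀ ⟶ ψ → ¬ Stacked (ρ (iter K (suc i) ψ))
  ¬stacked-ρK {i} {ψ} i<q p s with K-stacked i<q p ∥-ρ s
  ... | ψ′ , pψ′ , e = ⟶-¬ρ {iter K (suc i) ψ} (subst (iter K (suc i) ψ ⟶_) e (⟶-iterK (suc i) (⟶-trans (⟶-sym p) (P-side pψ′))))

  ¬stacked-ρU : ∀ {i ψ} → i < q → φ₀ ⟶ ψ → ¬ Stacked (ρ (U (iter K i ψ)))
  ¬stacked-ρU {i} {ψ} i<q p s with U-stacked i<q p ∥-ρ s
  ... | ψ′ , pψ′ , e = ⟶-¬ρ {U (iter K i ψ)} (subst (U (iter K i ψ) ⟶_) e (⟶-U (⟶-iterK i (⟶-trans (⟶-sym p) (P-side pψ′)))))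

  stacked-E : ∀ {φ} → Stacked φ → Stacked (ρ (E φ))
  stacked-E (i , ψ , i<q , p , inj₁ refl) = i , ψ , i<q , p , inj₂ (sym (ρE-involutive _))
  stacked-E (i , ψ , i<q , p , inj₂ refl) = i , ψ , i<q , p , inj₁ refl

  stacked-ρ : ∀ {φ} → Stacked φ → ¬ Stacked (ρ φ)
  stacked-ρ (i , ψ , i<q , p , inj₁ refl) = ¬stacked-ρK i<q (P-side p)
  stacked-ρ (i , ψ , i<q , p , inj₂ refl) = ¬stacked-ρU i<q (P-side p)

  InStack : Frame → Set
  InStack φ = ∃ λ i → i < q × (iter K (suc i) φ₀ ∥ φ ⊎ U (iter K i φ₀) ∥ φ)

  stacked⇒in : ∀ {φ} → Stacked φ → InStack φ
  stacked⇒in (i , ψ , i<q , p , inj₁ refl) = i , i<q , inj₁ (inj₁ (⟶-iterK (suc i) (P-side p)))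
  stacked⇒in (i , ψ , i<q , p , inj₂ refl) = i , i<q , inj₂ (inj₁ (⟶-U (⟶-iterK i (P-side p))))

  in-ρ : ∀ {φ} → InStack (ρ φ) → InStack φ
  in-ρ (i , i<q , inj₁ p) = i , i<q , inj₁ (∥-trans p (∥-sym ∥-ρ))
  in-ρ (i , i<q , inj₂ p) = i , i<q , inj₂ (∥-trans p (∥-sym ∥-ρ))

  -- X describes the cuts outside the stack.
  module Boundary (X : Frame → Set) where

    -- A row edge is missing at the vertex of `φ`, on either hand: where a strand leaves the stack,
    -- its continuation may have either orientation.
    Cut± : Frame → Set
    Cut± φ = (Stacked φ ⊎ X φ) ⊎ (Stacked (ρ φ) ⊎ X (ρ φ))

    cut±-ρ : ∀ {φ} → Cut± φ → Cut± (ρ φ)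
    cut±-ρ (inj₁ c) = inj₂ (subst (λ φ → Stacked φ ⊎ X φ) (sym (ρρ _)) c)
    cut±-ρ (inj₂ c) = inj₁ c

    module _ (bottom : ∀ {ψ} → P ψ → Cut± ψ) (top : ∀ {ψ} → P ψ → Cut± (U (iter K q ψ))) where

      above : ∀ {ψ} → P ψ → Cut± (U ψ)
      above p = go q refl
        where
        go : ∀ k → k ≡ q → Cut± (U _)
        -- In an empty stack the third edge at the bottom is also the one at the top.
        go zero    refl = top p
        go (suc k) refl = inj₁ (inj₁ (0 , _ , s≤s z≤n , p , inj₂ refl))

      below : ∀ {ψ} → P ψ → Cut± (iter K q ψ)
      below p = go q refl
        where
        go : ∀ k → k ≡ q → Cut± (iter K k _)
        go zero    refl = bottom p
        go (suc k) refl = inj₁ (inj₁ (k , _ , n<1+n k , p , inj₁ refl))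

  None : Frame → Set
  None _ = ⊥

  none? : ∀ φ → Dec (None φ)
  none? _ = no λ ()

  module Extend (X : Frame → Set) (X? : ∀ φ → Dec (X φ))
    (X-E : ∀ {φ} → X φ → X (ρ (E φ)))
    (X-ρ : ∀ {φ} → X φ → ¬ X (ρ φ))
    (X-out : ∀ {φ} → X φ → ¬ InStack φ)
    (X-U : ∀ {φ} → X φ → Boundary.Cut± X (U φ))
    (bottom : ∀ {ψ} → P ψ → Boundary.Cut± X ψ)
    (top : ∀ {ψ} → P ψ → Boundary.Cut± X (U (iter K q ψ)))
    where
    open Boundary X

    strands : Strands
    strands = record
      { Cut   = λ φ → Stacked φ ⊎ X φ
      ; cut?  = λ φ → stacked? φ ⊎-dec X? φ
      ; cut-E = λ { (inj₁ s) → inj₁ (stacked-E s) ; (inj₂ x) → inj₂ (X-E x) }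
      ; cut-U = cut-U
      ; cut-ρ = λ { (inj₁ s) (inj₁ s′) → stacked-ρ s s′
                  ; (inj₁ s) (inj₂ x)  → X-out x (in-ρ (subst InStack (sym (ρρ _)) (stacked⇒in s)))
                  ; (inj₂ x) (inj₁ s)  → X-out x (in-ρ (stacked⇒in s))
                  ; (inj₂ x) (inj₂ x′) → X-ρ x x′ }
      }
      where
      cut-U : ∀ {φ} → Stacked φ ⊎ X φ → Cut± (U φ)
      cut-U (inj₂ x) = X-U x
      cut-U (inj₁ (i , ψ , i<q , p , inj₁ refl)) with m≤n⇒m<n∨m≡n i<q
      ... | inj₁ i<q′ = inj₁ (inj₁ (suc i , ψ , i<q′ , p , inj₂ refl))
      ... | inj₂ refl = top p
      cut-U (inj₁ (zero , ψ , i<q , p , inj₂ refl)) =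
        subst Cut± (sym (UU ψ)) (bottom p)
      cut-U (inj₁ (suc i , ψ , i<q , p , inj₂ refl)) =
        inj₁ (inj₁ (i , ψ , <-trans (n<1+n i) i<q , p , inj₁ (sym (UU _))))

    open Strands strands public

    Q : ℕ → Frame → Set
    Q i σ = P (iter K⁻ i σ)

    unwind : ∀ i {σ} → iter K i φ₀ ⟶ σ → φ₀ ⟶ iter K⁻ i σ
    unwind i p = subst (_⟶ _) (iter-inverse K K⁻ K⁻K i φ₀) (⟶-iter ⟶-K⁻ i p)

    Q-intro : ∀ i {ψ} → P ψ → Q i (iter K i ψ)
    Q-intro i p = subst P (sym (iter-inverse K K⁻ K⁻K i _)) p

    Q-K : ∀ i {σ} → Q (suc i) (K σ) → Q i σ
    Q-K i {σ} = subst P (trans (sym (iter-suc K⁻ i _)) (cong (iter K⁻ i) (K⁻K σ)))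

    ~-U± : ∀ {φ} → Cut± φ → φ ~ U φ
    ~-U± (inj₁ c) = ~-U c
    ~-U± (inj₂ c) = ~-trans ~-ρ (~-trans (~-U c) (~-trans (~-reflexive (Uρ _)) (~-sym ~-ρ)))

    cut-Kσ : ∀ {i σ} → i < q → Q i σ → Cut (K σ)
    cut-Kσ {i} {σ} i<q p = inj₁ (i , _ , i<q , p , inj₁ (cong K (iter-K-K⁻ i σ)))

    cut-Uσ : ∀ {i σ} → i < q → Q i σ → Cut (U σ)
    cut-Uσ {i} {σ} i<q p = inj₁ (i , _ , i<q , p , inj₂ (cong U (iter-K-K⁻ i σ)))

    module RowAbove (i : ℕ) (i<q : i < q) where

      cut-K⇒Q : ∀ {σ} → iter K i φ₀ ⟶ σ → Cut (K σ) → Q i σ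
      cut-K⇒Q {σ} p (inj₁ s) = P-K i<q (unwind i p) (subst Stacked (cong K (sym (iter-K-K⁻ i σ))) s)
      cut-K⇒Q p (inj₂ x) = contradiction (i , i<q , inj₁ (inj₁ (⟶-K p))) (X-out x)

      ¬cut-ρU : ∀ {σ} → iter K i φ₀ ⟶ σ → ¬ Cut (ρ (U σ))
      ¬cut-ρU {σ} p (inj₁ s) = ¬stacked-ρU i<q (unwind i p) (subst Stacked (cong (ρ ∘ U) (sym (iter-K-K⁻ i σ))) s)
      ¬cut-ρU p (inj₂ x) = X-out x (i , i<q , inj₂ (∥-trans (inj₁ (⟶-U p)) ∥-ρ))

      open TwoRows strands (Q i) (λ σ → P? (iter K⁻ i σ)) cut-K⇒Q ¬cut-ρU public

    module _ {ψ₁} (p₁ : P ψ₁) where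

      -- Follow the row to the lower end of the next strand, cross down, and repeat. It then remains
      -- to connect the strands with each other at the bottom.
      to-bottom : ∀ i → i < q → ∀ {σ} → iter K i φ₀ ⟶ σ →
                  (∃ λ ψ → P ψ × U σ ~ U ψ) × (∃ λ ψ → P ψ × K σ ~ U ψ)
      to-bottom i i<q {σ} p = descend i i<q (U~strand (⟶-iterK i (P-side p₁)) (Q-intro i p₁) p) ,
                              descend i i<q (K~strand (⟶-iterK i (P-side p₁)) (Q-intro i p₁) p)
        where
        open RowAbove i i<q
        descend : ∀ i → i < q → ∀ {θ} → (∃ λ σ′ → iter K i φ₀ ⟶ σ′ × Q i σ′ × θ ~ U σ′) → ∃ λ ψ → P ψ × θ ~ U ψ
        descend zero    i<q (σ′ , p′ , q′ , e) = σ′ , q′ , e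
        descend (suc i) i<q (σ′ , p′ , q′ , e) =
          let i<q′  = <-trans (n<1+n i) i<q
              p″    = subst (_⟶ _) (K⁻K _) (⟶-K⁻ p′)
              (ψ , pψ , e′) = descend i i<q′ (RowAbove.K~strand i i<q′ (⟶-iterK i (P-side p₁)) (Q-intro i p₁) p″)
          in ψ , pψ , ~-trans e (~-trans (~-U (cut-Uσ i<q q′)) (~-trans (~-reflexive (trans (UU σ′) (sym (KK⁻ σ′)))) e′))

      in-stack : ∀ {φ} → InStack φ → ∃ λ ψ → P ψ × φ ~ U ψ
      in-stack (i , i<q , r) = [ [ K-side , reversed ∘ K-side ]′ , [ U-side , reversed ∘ U-side ]′ ]′ r
        where
        K-side : ∀ {φ} → iter K (suc i) φ₀ ⟶ φ → ∃ λ ψ → P ψ × φ ~ U ψ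
        K-side {φ} p = let (ψ , pψ , e) = proj₂ (to-bottom i i<q (subst (_⟶ K⁻ φ) (K⁻K _) (⟶-K⁻ p)))
                       in ψ , pψ , subst (_~ U ψ) (KK⁻ φ) e
        U-side : ∀ {φ} → U (iter K i φ₀) ⟶ φ → ∃ λ ψ → P ψ × φ ~ U ψ
        U-side {φ} p = let (ψ , pψ , e) = proj₁ (to-bottom i i<q (subst (_⟶ U φ) (UU _) (⟶-U p)))
                       in ψ , pψ , subst (_~ U ψ) (UU φ) e
        reversed : ∀ {φ} → (∃ λ ψ → P ψ × ρ φ ~ U ψ) → ∃ λ ψ → P ψ × φ ~ U ψ
        reversed (ψ , pψ , e) = ψ , pψ , ~-trans ~-ρ e

      -- From `U σ` the row is followed back to the previous strand `τ`, along which the walk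
      -- crosses to the next row. `K` has reversed the orientation there, so `σ` is again one strand
      -- back, and the same detour in the other direction ends at `K (K σ)`.
      up-two : ∀ i → suc i < q → ∀ {ψ} → P ψ → U (iter K i ψ) ~ iter K (suc (suc i)) ψ
      up-two i 1+i<q {ψ} pψ = ascend (Lower.previous-strand (⟶-iterK i (P-side p₁)) (Q-intro i p₁) σ-side)
        where
        i<q = <-trans (n<1+n i) 1+i<q
        module Lower = RowAbove i i<q
        module Upper = RowAbove (suc i) 1+i<q
        σ : Frame
        σ = iter K i ψ
        σ-side : iter K i φ₀ ⟶ σ
        σ-side = ⟶-iterK i (P-side pψ)
        back : ∀ {k n} → k ≤ n → iter A k (iter A⁻ n σ) ≡ iter A⁻ (n ∸ k) σ
        back {k} {n} k≤n = trans (cong (λ m → iter A k (iter A⁻ m σ)) (sym (m+[n∸m]≡n k≤n)))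
          (trans (cong (iter A k) (iter-+ A⁻ k (n ∸ k) σ)) (iter-inverse A⁻ A AA⁻ k _))
        ascend : (∃ λ g → Q i (iter A⁻ (suc g) σ) × (∀ k → 0 < k → k < suc g → ¬ Q i (iter A⁻ k σ))) →
                 U σ ~ K (K σ)
        ascend (g , qτ , gap) = ~-trans (~-sym lower) (~-trans (~-U (cut-Kσ i<q qτ)) (~-sym upper))
          where
          τ : Frame
          τ = iter A⁻ (suc g) σ
          lower : K τ ~ U σ
          lower = ~-trans (Lower.segment g (⟶-trans σ-side (⟶-iterA⁻ (suc g)))
              (λ k 0<k k<g c → gap (suc g ∸ k) (m<n⇒0<n∸m k<g) (∸-monoʳ-< 0<k (<⇒≤ k<g)) (subst (Q i) (back (<⇒≤ k<g)) c)))
            (~-reflexive (cong U (iter-inverse A⁻ A AA⁻ (suc g) σ)))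
          shift : ∀ k → iter A k (K σ) ≡ K (iter A⁻ k σ)
          shift k = sym (iter-conj K A⁻ A KA⁻ k σ)
          upper : K (K σ) ~ U (K τ)
          upper = ~-trans (Upper.segment g (⟶-K σ-side)
              (λ k 0<k k<g c → gap k 0<k k<g (Q-K i (subst (Q (suc i)) (shift k) c))))
            (~-reflexive (cong U (shift (suc g))))

      climb : ∀ l → 2 + 2 * l ≤ q → ∀ {ψ} → P ψ → U ψ ~ iter K (2 + 2 * l) ψ
      climb zero    b p = up-two 0 b p
      climb (suc l) b {ψ} p = ~-trans (climb l (≤-trans (n≤1+n _) (≤-trans (n≤1+n _) b′)) p)
        (~-trans (~-U (inj₁ (1 + 2 * l , ψ , ≤-trans (n≤1+n _) (≤-trans (n≤1+n _) b′) , p , inj₁ refl)))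
        (~-trans (up-two (2 + 2 * l) b′ p) (~-reflexive (cong (λ n → iter K n ψ) (sym (cong (2 +_) (*-suc 2 l)))))))
        where
        b′ : 4 + 2 * l ≤ q
        b′ = subst (λ n → 2 + n ≤ q) (*-suc 2 l) b

-- A second Hamiltonian cycle

-- Two involutions a and b join the elements of a finite set into paths and
-- cycles; a path ends at the fixed points of b.
module Involutions {S : Set} (fin : Finite S) (a b : S → S) (aa : ∀ x → a (a x) ≡ x) (bb : ∀ x → b (b x) ≡ x)
  (a-free : ∀ x → a x ≢ x) {x₀ : S} (bx₀ : b x₀ ≡ x₀) where

  f g : S → S
  f x = b (a x)
  g x = a (b x)

  gf : ∀ x → g (f x) ≡ x
  gf x = trans (cong a (bb _)) (aa x)

  open Permutation fin f g gf

  a-iter : ∀ i → a (iter f i x₀) ≡ iter g (suc i) x₀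
  a-iter i = begin
    a (iter f i x₀)    ≡⟨ iter-conj a f g (λ _ → refl) i x₀ ⟩
    iter g i (a x₀)    ≡⟨ cong (iter g i ∘ a) (sym bx₀) ⟩
    iter g i (g x₀)    ≡⟨ iter-suc g i x₀ ⟩
    iter g (suc i) x₀  ∎
    where open ≡-Reasoning

  back : ∀ i j → iter f (i + j) x₀ ≡ x₀ → iter g i x₀ ≡ iter f j x₀
  back i j e = trans (cong (iter g i) (sym e)) (trans (cong (iter g i) (iter-+ f i j x₀)) (iter-inverse f g gf i _))

  other-end : ∃ λ n → b (iter f n x₀) ≡ iter f n x₀ × iter f n x₀ ≢ x₀
  other-end with minimal-period x₀
  ... | n , per , min with halve (suc n)
  ... | l , inj₂ eq = ⊥-elim (a-free _ (trans (a-iter l) (back (suc l) l (subst (λ k → iter f k x₀ ≡ x₀) eq per))))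
  ... | zero , inj₁ ()
  ... | suc l , inj₁ eq = suc l ,
    trans (bb _) (trans (a-iter l) (back (suc l) (suc l) (subst (λ k → iter f k x₀ ≡ x₀) eq per))) ,
    min (suc l) (s≤s z≤n) (subst (suc l <_) (sym eq) (m<m+n (suc l) (s≤s z≤n)))

module _ {A : Set} where

  ∈-split : (_≟_ : ∀ (x y : A) → Dec (x ≡ y)) → ∀ {y} p → y ∈ p → ∃₂ λ pre rest → p ≡ pre ++ y ∷ rest × y ∉ pre
  ∈-split _≟_ {y} (x ∷ p) y∈p with y ≟ x
  ... | yes refl = [] , p , refl , λ ()
  ∈-split _≟_ {y} (x ∷ p) (here y≡x) | no y≢x = contradiction y≡x y≢x
  ∈-split _≟_ {y} (x ∷ p) (there y∈p) | no y≢x with ∈-split _≟_ p y∈p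
  ... | pre , rest , refl , y∉pre = x ∷ pre , rest , refl , λ { (here e) → y≢x e ; (there i) → y∉pre i }

  linked-ʳ++ : ∀ {R : A → A → Set} → (∀ {x y} → R x y → R y x) → ∀ x pre {acc} →
               Linked R (x ∷ pre) → Linked R (x ∷ acc) → Linked R ((x ∷ pre) ʳ++ acc)
  linked-ʳ++ R-sym x []        l         l′ = l′
  linked-ʳ++ R-sym x (w ∷ pre) (r ∷ l)   l′ = linked-ʳ++ R-sym w pre l (R-sym r ∷ l′)

  linked-++ˡ : ∀ {R : A → A → Set} pre {rest} → Linked R (pre ++ rest) → Linked R pre
  linked-++ˡ []            l       = []
  linked-++ˡ (x ∷ [])      l       = [-]
  linked-++ˡ (x ∷ w ∷ pre) (r ∷ l) = r ∷ linked-++ˡ (w ∷ pre) l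

  linked-++ʳ : ∀ {R : A → A → Set} pre {rest} → Linked R (pre ++ rest) → Linked R rest
  linked-++ʳ []            l       = l
  linked-++ʳ (x ∷ [])      {[]} l  = []
  linked-++ʳ (x ∷ [])      {_ ∷ _} (r ∷ l) = l
  linked-++ʳ (x ∷ w ∷ pre) (r ∷ l) = linked-++ʳ (w ∷ pre) l

  module Rotation (_≟_ : ∀ (x y : A) → Dec (x ≡ y)) where

    rotate : A → List A → List A → List A
    rotate y acc []      = []
    rotate y acc (x ∷ p) with x ≟ y
    ... | yes _ = acc ++ x ∷ p
    ... | no _  = rotate y (x ∷ acc) p

    rotate-acc : ∀ {y} pre {rest} acc → y ∉ pre → rotate y acc (pre ++ y ∷ rest) ≡ (pre ʳ++ acc) ++ y ∷ rest
    rotate-acc {y} [] acc y∉ with y ≟ y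
    ... | yes _  = refl
    ... | no y≢y = contradiction refl y≢y
    rotate-acc {y} (x ∷ pre) acc y∉ with x ≟ y
    ... | yes refl = contradiction (here refl) y∉
    ... | no _     = rotate-acc pre (x ∷ acc) (y∉ ∘ there)

    rotate-++ : ∀ {y} pre {rest} → y ∉ pre → rotate y [] (pre ++ y ∷ rest) ≡ reverse pre ++ y ∷ rest
    rotate-++ pre = rotate-acc pre []

-- The lollipop method: a second Hamiltonian cycle of a cubic graph.  Paths are
-- listed from their free end; the last two vertices v₁, v₀ never change.
module Lollipop {X : Set} (fin : Finite X) (Adj : X → X → Set) (adj-sym : ∀ {x y} → Adj x y → Adj y x)
  (adj-irreflexive : ∀ {x} → ¬ Adj x x)
  (third : X → X → X → X)
  (third-adj : ∀ {x y w} → Adj x y → Adj x w → y ≢ w → Adj x (third x y w))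
  (third≢ : ∀ x y w → third x y w ≢ y × third x y w ≢ w)
  (third-unique : ∀ {x y w u} → Adj x y → Adj x w → y ≢ w → Adj x u → u ≢ y → u ≢ w → u ≡ third x y w)
  (v₁ v₀ : X) (p₀ : List X) (p₀-unique : Unique p₀) (p₀-complete : ∀ x → x ∈ p₀) where

  open Finite fin
  open Rotation _≟′_

  data Ends : List X → Set where
    here  : Ends (v₁ ∷ v₀ ∷ [])
    there : ∀ {x p} → Ends p → Ends (x ∷ p)

  -- The goal is a neighbour of the free end off the path. A cubic graph offers two of them,
  -- exchanged by `turn`.
  Target : List X → X → Set
  Target (x ∷ w ∷ p) y = Adj x y × y ≢ w
  Target _           y = ⊥

  record Ok (p : List X) (y : X) : Set where
    field
      perm   : p ↭ p₀
      linked : Linked Adj p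
      ends   : Ends p
      target : Target p y

  -- The proof is irrelevant, so a state is determined by path and goal and the states form a finite
  -- set.
  record State : Set where
    constructor state
    field
      path : List X
      goal : X
      .ok  : Ok path goal

  open State

  state-≡ : ∀ {σ τ} → path σ ≡ path τ → goal σ ≡ goal τ → σ ≡ τ
  state-≡ refl refl = refl

  codes : ∀ n → List X → Fin (size ^ n)
  codes zero    p       = Fin.zero
  -- A filler; codes are compared only for lists of full length.
  codes (suc n) []      = combine (code v₀) (codes n [])
  codes (suc n) (x ∷ p) = combine (code x) (codes n p)

  codes-injective : ∀ p q → length p ≡ length q → codes (length p) p ≡ codes (length p) q → p ≡ q
  codes-injective []      []      e c = refl
  codes-injective (x ∷ p) (y ∷ q) e c with Finₚ.combine-injective (code x) (codes (length p) p) (code y) (codes (length p) q) c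
  ... | c₁ , c₂ = cong₂ _∷_ (code-injective c₁) (codes-injective p q (suc-injective e) c₂)

  path-length : ∀ σ → length (path σ) ≡ length p₀
  path-length (state p y o) = recompute (length p ≟ₙ length p₀) (↭-length (Ok.perm o))
    where _≟ₙ_ = Data.Nat._≟_

  states : Finite State
  states = record
    { size = size ^ length p₀ * size
    ; code = λ σ → combine (codes (length p₀) (path σ)) (code (goal σ))
    ; code-injective = λ {σ} {τ} e → inj σ τ (Finₚ.combine-injective (codes (length p₀) (path σ)) (code (goal σ))
                                                (codes (length p₀) (path τ)) (code (goal τ)) e)
    }
    where
    inj : ∀ σ τ → codes (length p₀) (path σ) ≡ codes (length p₀) (path τ) × code (goal σ) ≡ code (goal τ) → σ ≡ τ
    inj σ τ (c₁ , c₂) = state-≡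
      (codes-injective (path σ) (path τ) (trans (path-length σ) (sym (path-length τ)))
        (subst (λ n → codes n (path σ) ≡ codes n (path τ)) (sym (path-length σ)) c₁))
      (code-injective c₂)

  turn : List X → X → X
  turn (x ∷ w ∷ p) y = third x y w
  turn _           y = y

  turn-ok : ∀ {p y} → Ok p y → Ok p (turn p y)
  turn-ok {[]} o = ⊥-elim (Ok.target o)
  turn-ok {x ∷ []} o = ⊥-elim (Ok.target o)
  turn-ok {x ∷ w ∷ p} {y} o with Ok.target o | Ok.linked o
  ... | a , y≢w | a′ ∷ _ = record
    { perm = Ok.perm o ; linked = Ok.linked o ; ends = Ok.ends o
    ; target = third-adj a a′ y≢w , proj₂ (third≢ x y w) }

  turn-turn : ∀ {p y} → Ok p y → turn p (turn p y) ≡ y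
  turn-turn {[]} o = refl
  turn-turn {x ∷ []} o = refl
  turn-turn {x ∷ w ∷ p} {y} o with Ok.target o | Ok.linked o
  ... | a , y≢w | a′ ∷ _ = sym (third-unique (third-adj a a′ y≢w) a′ (proj₂ (third≢ x y w)) a
                                  (λ e → proj₁ (third≢ x y w) (sym e)) y≢w)

  turn-free : ∀ {p y} → Ok p y → turn p y ≢ y
  turn-free {[]} o = ⊥-elim (Ok.target o)
  turn-free {x ∷ []} o = ⊥-elim (Ok.target o)
  turn-free {x ∷ w ∷ p} {y} o = proj₁ (third≢ x y w)

  -- The edge from the free end to the goal replaces the path edge leading into the goal. The
  -- replaced edge joins the new free end to the same goal, so the move undoes itself. With goal
  -- `v₀` the path closes to a Hamiltonian cycle and is left alone.
  rotateAt : X → List X → List X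
  rotateAt y p with y ≟′ v₀
  ... | yes _ = p
  ... | no _  = rotate y [] p

  ok-unique : ∀ {p y} → Ok p y → Unique p
  ok-unique o = Permₛ.Unique-resp-↭ (setoid X) (↭⇒↭ₛ (↭-sym (Ok.perm o))) p₀-unique

  ok-split : ∀ {p y} → Ok p y → ∃₂ λ x w → ∃₂ λ pre rest → p ≡ x ∷ w ∷ pre ++ y ∷ rest × y ∉ x ∷ w ∷ pre
  ok-split {p} {y} o with ∈-split _≟′_ p (∈-resp-↭ (↭-sym (Ok.perm o)) (p₀-complete y)) | Ok.target o
  ... | [] , [] , refl , _ | ()
  ... | [] , w ∷ rest , refl , _ | a , _ = contradiction a adj-irreflexive
  ... | x ∷ [] , rest , refl , _ | _ , y≢w = contradiction refl y≢w
  ... | x ∷ w ∷ pre , rest , refl , y∉ | _ = x , w , pre , rest , refl , y∉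

  rotate-ok : ∀ {p y} → Ok p y → y ≢ v₀ → Ok (rotate y [] p) y
  rotate-ok {p} {y} o y≢v₀ with ok-split o
  ... | x , w , pre , rest , refl , y∉ = subst (λ q → Ok q y) (sym eq) (record
    { perm   = ↭-trans (subst (_↭ x ∷ w ∷ pre ++ y ∷ rest) (sym (ʳ++-defn (x ∷ w ∷ pre)))
                          (++⁺ʳ (y ∷ rest) (↭-reverse (x ∷ w ∷ pre)))) (Ok.perm o)
    ; linked = linked-ʳ++ adj-sym x (w ∷ pre) (linked-++ˡ (x ∷ w ∷ pre) (Ok.linked o))
                 (proj₁ (Ok.target o) ∷ linked-++ʳ (x ∷ w ∷ pre) (Ok.linked o))
    ; ends   = prepend (x ∷ w ∷ pre) (drop-ends (x ∷ w ∷ pre) refl (Ok.ends o))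
    ; target = target-ʳ++ x w pre (Ok.linked o) y∉
    })
    where
    eq : rotate y [] (x ∷ w ∷ pre ++ y ∷ rest) ≡ (x ∷ w ∷ pre) ʳ++ (y ∷ rest)
    eq = trans (rotate-++ (x ∷ w ∷ pre) y∉) (sym (ʳ++-defn (x ∷ w ∷ pre)))
    drop-ends : ∀ pre {l} → l ≡ pre ++ y ∷ rest → Ends l → Ends (y ∷ rest)
    drop-ends []        refl e         = e
    drop-ends (a ∷ pre) eq   (there e) = drop-ends pre (∷-injectiveʳ eq) e
    drop-ends (a ∷ [])  refl here      = contradiction refl y≢v₀
    drop-ends (a ∷ b ∷ []) () here
    drop-ends (a ∷ b ∷ c ∷ pre) () here
    prepend : ∀ pre {l} → Ends l → Ends (pre ʳ++ l)
    prepend []        e = e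
    prepend (a ∷ pre) e = prepend pre (there e)
    target-ʳ++ : ∀ a b r {acc} → Linked Adj (a ∷ b ∷ r ++ y ∷ rest) → y ∉ a ∷ b ∷ r → Target ((a ∷ b ∷ r) ʳ++ acc) y
    target-ʳ++ a b []      (_ ∷ l ∷ _) y∉ = l , λ { refl → y∉ (here refl) }
    target-ʳ++ a b (c ∷ r) (_ ∷ l)     y∉ = target-ʳ++ b c r l (y∉ ∘ there)

  rotateAt-ok : ∀ {p y} → Ok p y → Ok (rotateAt y p) y
  rotateAt-ok {p} {y} o with y ≟′ v₀
  ... | yes _  = o
  ... | no y≢v₀ = rotate-ok o y≢v₀

  rotateAt-involutive : ∀ {p y} → Ok p y → rotateAt y (rotateAt y p) ≡ p
  rotateAt-involutive {p} {y} o with y ≟′ v₀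
  ... | yes _ = refl
  ... | no y≢v₀ with ok-split o
  ... | x , w , pre , rest , refl , y∉ = begin
    rotate y [] (rotate y [] (x ∷ w ∷ pre ++ y ∷ rest))   ≡⟨ cong (rotate y []) (rotate-++ (x ∷ w ∷ pre) y∉) ⟩
    rotate y [] (reverse (x ∷ w ∷ pre) ++ y ∷ rest)       ≡⟨ rotate-++ (reverse (x ∷ w ∷ pre)) (y∉ ∘ ∈-resp-↭ (↭-reverse (x ∷ w ∷ pre))) ⟩
    reverse (reverse (x ∷ w ∷ pre)) ++ y ∷ rest           ≡⟨ cong (_++ y ∷ rest) (reverse-involutive (x ∷ w ∷ pre)) ⟩
    x ∷ w ∷ pre ++ y ∷ rest                               ∎
    where open ≡-Reasoning

  -- A genuine rotation reverses a prefix of at least two distinct vertices, which cannot be a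
  -- palindrome.
  rotateAt-fixed : ∀ {p y} → Ok p y → rotateAt y p ≡ p → y ≡ v₀
  rotateAt-fixed {p} {y} o e with y ≟′ v₀
  ... | yes y≡v₀ = y≡v₀
  ... | no y≢v₀ with ok-split o
  ... | x , w , pre , rest , refl , y∉ = contradiction palindrome not-palindrome
    where
    palindrome : reverse (x ∷ w ∷ pre) ≡ x ∷ w ∷ pre
    palindrome = ++-cancelʳ (y ∷ rest) (reverse (x ∷ w ∷ pre)) (x ∷ w ∷ pre) (trans (sym (rotate-++ (x ∷ w ∷ pre) y∉)) e)
    unique : Unique (x ∷ w ∷ pre ++ y ∷ rest)
    unique = ok-unique o
    x∉ : x ∉ w ∷ pre
    x∉ i with unique
    ... | d ∷ _ = All.lookup (Allₚ.++⁻ˡ (w ∷ pre) d) i refl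
    head∈ : ∀ zs → zs ++ x ∷ [] ≡ x ∷ w ∷ pre → x ∈ zs
    head∈ []       ()
    head∈ (z ∷ zs) eq = here (sym (∷-injectiveˡ eq))
    not-palindrome : reverse (x ∷ w ∷ pre) ≢ x ∷ w ∷ pre
    not-palindrome eq = x∉ (∈-resp-↭ (↭-reverse (w ∷ pre))
      (head∈ (reverse (w ∷ pre)) (trans (sym (unfold-reverse x (w ∷ pre))) eq)))

  module Second (start : Ok p₀ v₀) where

    turnₛ rotateₛ : State → State
    turnₛ   (state p y o) = state p (turn p y) (turn-ok o)
    rotateₛ (state p y o) = state (rotateAt y p) y (rotateAt-ok o)

    _≟ₗ_ : ∀ (p q : List X) → Dec (p ≡ q)
    _≟ₗ_ = ≡-dec _≟′_

    turnₛ-involutive : ∀ σ → turnₛ (turnₛ σ) ≡ σ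
    turnₛ-involutive (state p y o) = state-≡ refl (recompute (_ ≟′ _) (turn-turn o))

    rotateₛ-involutive : ∀ σ → rotateₛ (rotateₛ σ) ≡ σ
    rotateₛ-involutive (state p y o) = state-≡ (recompute (_ ≟ₗ _) (rotateAt-involutive o)) refl

    turnₛ-free : ∀ σ → turnₛ σ ≢ σ
    turnₛ-free (state p y o) e = ⊥-elim-irr (turn-free o (cong goal e))

    σ₀ : State
    σ₀ = state p₀ v₀ start

    σ₀-fixed : rotateₛ σ₀ ≡ σ₀
    σ₀-fixed = state-≡ (base v₀ refl) refl
      where
      base : ∀ y → y ≡ v₀ → rotateAt y p₀ ≡ p₀
      base y y≡v₀ with y ≟′ v₀
      ... | yes _ = refl
      ... | no y≢ = contradiction y≡v₀ y≢

    open Involutions states turnₛ rotateₛ turnₛ-involutive rotateₛ-involutive turnₛ-free σ₀-fixed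

    iterate-ok : ∀ n → Ok (path (iter f n σ₀)) (goal (iter f n σ₀))
    iterate-ok zero    = start
    iterate-ok (suc n) = rotateAt-ok (turn-ok (iterate-ok n))

    -- The other end of the chain of states is again a closed path. Both ends have goal `v₀`, so
    -- being different states they have different paths.
    second : ∃ λ p → p ≢ p₀ × Unique p × Ok p v₀
    second = conclude other-end
      where
      conclude : (∃ λ n → rotateₛ (iter f n σ₀) ≡ iter f n σ₀ × iter f n σ₀ ≢ σ₀) →
                 ∃ λ p → p ≢ p₀ × Unique p × Ok p v₀
      conclude (n , fixed , ≢start) = path σ , (λ e → ≢start (state-≡ {σ} {σ₀} e goal≡v₀)) ,
          ok-unique (iterate-ok n) , subst (Ok (path σ)) goal≡v₀ (iterate-ok n)
        where
        σ : State
        σ = iter f n σ₀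
        goal≡v₀ : goal σ ≡ v₀
        goal≡v₀ = rotateAt-fixed (iterate-ok n) (cong path fixed)

module _ {A : Set} where

  data Consec (x y : A) : List A → Set where
    here  : ∀ {l} → Consec x y (x ∷ y ∷ l)
    there : ∀ {z l} → Consec x y l → Consec x y (z ∷ l)

  consec? : (∀ (x y : A) → Dec (x ≡ y)) → ∀ x y l → Dec (Consec x y l)
  consec? _≟_ x y []      = no λ ()
  consec? _≟_ x y (z ∷ []) = no λ { (there ()) }
  consec? _≟_ x y (z ∷ w ∷ l) with x ≟ z | y ≟ w | consec? _≟_ x y (w ∷ l)
  ... | yes refl | yes refl | _     = yes here
  ... | _        | _        | yes c = yes (there c)
  ... | no x≢z   | _        | no ¬c = no λ { here → x≢z refl ; (there c) → ¬c c }
  ... | yes _    | no y≢w   | no ¬c = no λ { here → y≢w refl ; (there c) → ¬c c }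

  consec-∈ˡ : ∀ {x y l} → Consec x y l → x ∈ l
  consec-∈ˡ here      = here refl
  consec-∈ˡ (there c) = there (consec-∈ˡ c)

  consec-∈ʳ : ∀ {x y z l} → Consec x y (z ∷ l) → y ∈ l
  consec-∈ʳ here      = here refl
  consec-∈ʳ {l = _ ∷ _} (there c) = there (consec-∈ʳ c)

  consec-∈ʳ′ : ∀ {x y l} → Consec x y l → y ∈ l
  consec-∈ʳ′ {l = _ ∷ _} c = there (consec-∈ʳ c)

  next-unique : ∀ {x y z l} → Unique l → Consec x y l → Consec x z l → y ≡ z
  next-unique u       here      here       = refl
  next-unique (d ∷ u) here      (there c)  = contradiction refl (All.lookup d (consec-∈ˡ c))
  next-unique (d ∷ u) (there c) here       = contradiction refl (All.lookup d (consec-∈ˡ c))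
  next-unique (d ∷ u) (there c) (there c′) = next-unique u c c′

  previous-unique : ∀ {x y z l} → Unique l → Consec x z l → Consec y z l → x ≡ y
  previous-unique u       here      here       = refl
  previous-unique (d ∷ d′ ∷ u) here (there c)  = contradiction refl (All.lookup d′ (consec-∈ʳ c))
  previous-unique (d ∷ d′ ∷ u) (there c) here  = contradiction refl (All.lookup d′ (consec-∈ʳ c))
  previous-unique (d ∷ u) (there c) (there c′) = previous-unique u c c′

  consec-asym : ∀ {x y l} → Unique l → Consec x y l → ¬ Consec y x l
  consec-asym (d ∷ u) here      c         = All.lookup d (consec-∈ʳ c) refl
  consec-asym (d ∷ u) (there c) here      = All.lookup d (consec-∈ʳ′ c) refl
  consec-asym (d ∷ u) (there c) (there c′) = consec-asym u c c′

  linked-consec : ∀ {R : A → A → Set} {x y l} → Linked R l → Consec x y l → R x y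
  linked-consec (r ∷ l) here      = r
  linked-consec (r ∷ l) (there c) = linked-consec l c

  previous-exists : ∀ {x z l} → x ∈ l → ∃ λ y → Consec y x (z ∷ l)
  previous-exists (here refl) = _ , here
  previous-exists (there i) with previous-exists i
  ... | y , c = y , there c

-- A cycle x₀, s x₀, s² x₀, … with chords χ, as a cubic (multi)graph.
module Chords {X : Set} (fin : Finite X) (s s⁻ χ : X → X) (s⁻s : ∀ x → s⁻ (s x) ≡ x)
  (χχ : ∀ x → χ (χ x) ≡ x) (χ-free : ∀ x → χ x ≢ x) (x₀ : X) (reach : ∀ x → ∃ λ n → iter s n x₀ ≡ x) where

  open Finite fin
  open Permutation fin s s⁻ s⁻s renaming (fg to ss⁻)

  -- Every equivalence relation containing the remaining edges is total. In this form connectedness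
  -- can be applied directly to `_~_` between the frames of a row.
  Connects : (X → Set) → Set₁
  Connects Removed = ∀ (R : X → X → Set) → (∀ {x} → R x x) → (∀ {x y} → R x y → R y x) →
    (∀ {x y z} → R x y → R y z → R x z) → (∀ x → ¬ Removed x → R x (s x)) →
    (∀ x → Removed x ⊎ Removed (s⁻ x) → R x (χ x)) → ∀ x y → R x y

  -- A Hamiltonian cycle through at least one chord: Removed x says that it
  -- avoids the edge from x to s x.
  record SecondCycle : Set₁ where
    field
      Removed   : X → Set
      removed?  : ∀ x → Dec (Removed x)
      exclusive : ∀ {x} → Removed x → ¬ Removed (s⁻ x)
    Used : X → Set
    Used x = Removed x ⊎ Removed (s⁻ x)
    field
      used-χ    : ∀ {x} → Used x → Used (χ x)
      some-used : ∃ Used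
      connected : Connects Removed

  reach-from : ∀ x y → ∃ λ n → iter s n x ≡ y
  reach-from x y with reach x | reach y
  ... | i , refl | k , refl with reach-sym i refl
  ... | j , e = k + j , trans (iter-+ s k j _) (cong (iter s k) e)

  -- The lollipop method identifies an edge by its ends. A chord parallel to an edge of the cycle is
  -- handled apart: exchanging the two gives the second cycle.
  module Parallel {a : X} (χa : χ a ≡ s a) where

    second-cycle : SecondCycle
    second-cycle = record
      { Removed   = _≡ a
      ; removed?  = _≟′ a
      ; exclusive = λ { {x} refl e → χ-free x (trans χa (trans (cong s (sym e)) (ss⁻ x))) }
      ; used-χ    = λ { (inj₁ refl) → inj₂ (trans (cong s⁻ χa) (s⁻s _))
                      ; {x} (inj₂ e) → inj₁ (trans (cong χ (trans (sym (ss⁻ x)) (trans (cong s e) (sym χa)))) (χχ a)) }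
      ; some-used = a , inj₁ refl
      ; connected = connected
      }
      where
      connected : Connects (_≡ a)
      connected R R-refl R-sym R-trans R-s R-χ x y = R-trans (R-sym (from x)) (from y)
        where
        walk : ∀ n → R (s a) (iter s n (s a))
        walk zero = R-refl
        walk (suc n) with iter s n (s a) ≟′ a
        ... | yes e = subst (λ z → R (s a) (s z)) (sym e) R-refl
        ... | no ≢a = R-trans (walk n) (R-s _ ≢a)
        from : ∀ x → R (s a) x
        from x with reach-from (s a) x
        ... | n , refl = walk n

  module Simple (χ≢s : ∀ x → χ x ≢ s x) where

    χ≢s⁻ : ∀ x → χ x ≢ s⁻ x
    χ≢s⁻ x e = χ≢s (s⁻ x) (trans (cong χ (sym e)) (trans (χχ x) (sym (ss⁻ x))))

    s≢ : ∀ x → s x ≢ x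
    s≢ x e with reach-from x (χ x)
    ... | n , e′ = χ-free x (trans (sym e′) (iter-fixed s e n))

    -- Otherwise the cycle has at most two vertices and leaves no place for the other end of the
    -- chord.
    s≢s⁻ : ∀ x → s x ≢ s⁻ x
    s≢s⁻ x e with reach-from x (χ x)
    ... | n , e′ = [ (λ f → χ-free x (trans (sym e′) f)) , (λ f → χ≢s x (trans (sym e′) f)) ]′ (two n)
      where
      two : ∀ n → iter s n x ≡ x ⊎ iter s n x ≡ s x
      two zero = inj₁ refl
      two (suc n) with two n
      ... | inj₁ f = inj₂ (cong s f)
      ... | inj₂ f = inj₁ (trans (cong s (trans f e)) (ss⁻ x))

    data Adj (x : X) : X → Set where
      forth : Adj x (s x)
      back  : Adj x (s⁻ x)
      chord : Adj x (χ x)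

    adj-sym : ∀ {x y} → Adj x y → Adj y x
    adj-sym {x} forth = subst (Adj (s x)) (s⁻s x) back
    adj-sym {x} back  = subst (Adj (s⁻ x)) (ss⁻ x) forth
    adj-sym {x} chord = subst (Adj (χ x)) (χχ x) chord

    adj-irreflexive : ∀ {x} → ¬ Adj x x
    adj-irreflexive a = loop a refl
      where
      loop : ∀ {x y} → Adj x y → y ≢ x
      loop {x} forth e = s≢ x e
      loop {x} back  e = s≢ x (trans (cong s (sym e)) (ss⁻ x))
      loop {x} chord e = χ-free x e

    adj-cases : ∀ {x y} → Adj x y → y ≡ s x ⊎ y ≡ s⁻ x ⊎ y ≡ χ x
    adj-cases forth = inj₁ refl
    adj-cases back  = inj₂ (inj₁ refl)
    adj-cases chord = inj₂ (inj₂ refl)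

    third : X → X → X → X
    third x y w with (s x ≟′ y) ⊎-dec (s x ≟′ w) | (s⁻ x ≟′ y) ⊎-dec (s⁻ x ≟′ w)
    ... | no _  | _     = s x
    ... | yes _ | no _  = s⁻ x
    ... | yes _ | yes _ = χ x

    third-adj : ∀ {x y w} → Adj x y → Adj x w → y ≢ w → Adj x (third x y w)
    third-adj {x} {y} {w} _ _ _ with (s x ≟′ y) ⊎-dec (s x ≟′ w) | (s⁻ x ≟′ y) ⊎-dec (s⁻ x ≟′ w)
    ... | no _  | _     = forth
    ... | yes _ | no _  = back
    ... | yes _ | yes _ = chord

    third≢ : ∀ x y w → third x y w ≢ y × third x y w ≢ w
    third≢ x y w with (s x ≟′ y) ⊎-dec (s x ≟′ w) | (s⁻ x ≟′ y) ⊎-dec (s⁻ x ≟′ w)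
    ... | no ¬e | _     = ¬e ∘ inj₁ , ¬e ∘ inj₂
    ... | yes _ | no ¬e = ¬e ∘ inj₁ , ¬e ∘ inj₂
    ... | yes (inj₁ e) | yes (inj₁ f) = contradiction (trans e (sym f)) (s≢s⁻ x)
    ... | yes (inj₂ e) | yes (inj₂ f) = contradiction (trans e (sym f)) (s≢s⁻ x)
    ... | yes (inj₁ e) | yes (inj₂ f) = (λ g → χ≢s x (trans g (sym e))) , (λ g → χ≢s⁻ x (trans g (sym f)))
    ... | yes (inj₂ e) | yes (inj₁ f) = (λ g → χ≢s⁻ x (trans g (sym f))) , (λ g → χ≢s x (trans g (sym e)))

    third-unique : ∀ {x y w u} → Adj x y → Adj x w → y ≢ w → Adj x u → u ≢ y → u ≢ w → u ≡ third x y w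
    third-unique {x} {y} {w} {u} a a′ y≢w b u≢y u≢w
      with (s x ≟′ y) ⊎-dec (s x ≟′ w) | (s⁻ x ≟′ y) ⊎-dec (s⁻ x ≟′ w)
    third-unique forth a′    y≢w b     u≢y u≢w | no ¬e | _ = contradiction (inj₁ refl) ¬e
    third-unique a     forth y≢w b     u≢y u≢w | no ¬e | _ = contradiction (inj₂ refl) ¬e
    third-unique back  back  y≢w b     u≢y u≢w | no ¬e | _ = contradiction refl y≢w
    third-unique chord chord y≢w b     u≢y u≢w | no ¬e | _ = contradiction refl y≢w
    third-unique back  chord y≢w forth u≢y u≢w | no ¬e | _ = refl
    third-unique back  chord y≢w back  u≢y u≢w | no ¬e | _ = contradiction refl u≢y
    third-unique back  chord y≢w chord u≢y u≢w | no ¬e | _ = contradiction refl u≢w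
    third-unique chord back  y≢w forth u≢y u≢w | no ¬e | _ = refl
    third-unique chord back  y≢w back  u≢y u≢w | no ¬e | _ = contradiction refl u≢w
    third-unique chord back  y≢w chord u≢y u≢w | no ¬e | _ = contradiction refl u≢y
    third-unique back  a′    y≢w b     u≢y u≢w | yes _ | no ¬e = contradiction (inj₁ refl) ¬e
    third-unique a     back  y≢w b     u≢y u≢w | yes _ | no ¬e = contradiction (inj₂ refl) ¬e
    third-unique forth forth y≢w b     u≢y u≢w | yes _ | no ¬e = contradiction refl y≢w
    third-unique chord chord y≢w b     u≢y u≢w | yes _ | no ¬e = contradiction refl y≢w
    third-unique forth chord y≢w forth u≢y u≢w | yes _ | no ¬e = contradiction refl u≢y
    third-unique forth chord y≢w back  u≢y u≢w | yes _ | no ¬e = refl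
    third-unique forth chord y≢w chord u≢y u≢w | yes _ | no ¬e = contradiction refl u≢w
    third-unique chord forth y≢w forth u≢y u≢w | yes _ | no ¬e = contradiction refl u≢w
    third-unique chord forth y≢w back  u≢y u≢w | yes _ | no ¬e = refl
    third-unique chord forth y≢w chord u≢y u≢w | yes _ | no ¬e = contradiction refl u≢y
    third-unique a a′ y≢w chord u≢y u≢w | yes _ | yes _ = refl
    third-unique a a′ y≢w forth u≢y u≢w | yes (inj₁ e) | yes _ = contradiction e u≢y
    third-unique a a′ y≢w forth u≢y u≢w | yes (inj₂ e) | yes _ = contradiction e u≢w
    third-unique a a′ y≢w back  u≢y u≢w | yes _ | yes (inj₁ e) = contradiction e u≢y
    third-unique a a′ y≢w back  u≢y u≢w | yes _ | yes (inj₂ e) = contradiction e u≢w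

    -- The cycle is listed backwards, so that the edge from `s x₀` to `x₀` is the end that all
    -- lollipop paths share.
    down : ℕ → List X
    down zero    = x₀ ∷ []
    down (suc n) = iter s (suc n) x₀ ∷ down n

    length-down : ∀ n → length (down n) ≡ suc n
    length-down zero    = refl
    length-down (suc n) = cong suc (length-down n)

    ∈-down⁻ : ∀ n {x} → x ∈ down n → ∃ λ k → k ≤ n × iter s k x₀ ≡ x
    ∈-down⁻ zero    (here refl) = 0 , z≤n , refl
    ∈-down⁻ (suc n) (here refl) = suc n , ≤-refl , refl
    ∈-down⁻ (suc n) (there i) with ∈-down⁻ n i
    ... | k , k≤n , e = k , m≤n⇒m≤1+n k≤n , e

    ∈-down⁺ : ∀ n {k} → k ≤ n → iter s k x₀ ∈ down n
    ∈-down⁺ zero z≤n = here refl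
    ∈-down⁺ (suc n) {k} k≤n with m≤n⇒m<n∨m≡n k≤n
    ... | inj₁ (s≤s k≤n′) = there (∈-down⁺ n k≤n′)
    ... | inj₂ refl       = here refl

    module Base (n : ℕ) (period-n : iter s (suc n) x₀ ≡ x₀)
                (minimal : ∀ k → 0 < k → k < suc n → iter s k x₀ ≢ x₀) where

      down-unique : ∀ k → k ≤ n → Unique (down k)
      down-unique zero    _   = [] ∷ []
      down-unique (suc k) k<n = All.tabulate fresh ∷ down-unique k (<⇒≤ k<n)
        where
        fresh : ∀ {x} → x ∈ down k → iter s (suc k) x₀ ≢ x
        fresh i e with ∈-down⁻ k i
        ... | j , j≤k , e′ = minimal (suc k ∸ j) (m<n⇒0<n∸m (s≤s j≤k)) (≤-<-trans (m∸n≤m (suc k) j) (s≤s k<n))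
          (iter-cancel (m≤n⇒m≤1+n j≤k) (trans e′ (sym e)))

      down-complete : ∀ x → x ∈ down n
      down-complete x with reach x
      ... | k , refl = subst (_∈ down n) (iter-% s period-n k) (∈-down⁺ n (s≤s⁻¹ (m%n<n k (suc n))))

      open Lollipop fin Adj adj-sym adj-irreflexive third third-adj third≢ third-unique
        (s x₀) x₀ (down n) (down-unique n ≤-refl) down-complete

      down-linked : ∀ k → Linked Adj (down k)
      down-linked zero          = [-]
      down-linked (suc zero)    = adj-sym forth ∷ [-]
      down-linked (suc (suc k)) = adj-sym forth ∷ down-linked (suc k)

      down-ends : ∀ k → Ends (down (suc k))
      down-ends zero    = here
      down-ends (suc k) = there (down-ends k)

      ends-target : ∀ n → iter s (suc n) x₀ ≡ x₀ → (∀ k → 0 < k → k < suc n → iter s k x₀ ≢ x₀) →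
                    Ends (down n) × Target (down n) x₀
      ends-target 0 e _ = contradiction e (s≢ x₀)
      ends-target 1 e _ = contradiction (trans (sym (s⁻s _)) (cong s⁻ e)) (s≢s⁻ x₀)
      ends-target (suc (suc k)) e min = down-ends (suc k) , subst (Adj _) e forth ,
        λ f → min (suc k) (s≤s z≤n) (s≤s (s≤s (n≤1+n k))) (sym f)

      start : Ok (down n) x₀
      start = record
        { perm = ↭-refl ; linked = down-linked n
        ; ends = proj₁ (ends-target n period-n minimal) ; target = proj₂ (ends-target n period-n minimal) }

      module Analysis (v w : X) (r : List X) (p≢ : v ∷ w ∷ r ≢ down n) (unique : Unique (v ∷ w ∷ r))
                      (ok : Ok (v ∷ w ∷ r) x₀) where

        p q : List X
        p = v ∷ w ∷ r
        -- Since `p` ends in `x₀` as well, the consecutive pairs of `q` are the edges of the closed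
        -- cycle.
        q = x₀ ∷ p

        p-complete : ∀ x → x ∈ p
        p-complete x = ∈-resp-↭ (↭-sym (Ok.perm ok)) (down-complete x)

        ends-∈ : ∀ {l} → Ends l → x₀ ∈ l
        ends-∈ here      = there (here refl)
        ends-∈ (there e) = there (ends-∈ e)

        last-no-next : ∀ {y l} → Ends l → Unique l → ¬ Consec x₀ y l
        last-no-next here      u       c         = s≢ x₀ (sym (first c))
          where
          first : ∀ {a b x y : X} → Consec x y (a ∷ b ∷ []) → x ≡ a
          first here               = refl
          first (there (there ()))
        last-no-next (there e) (d ∷ u) here      = All.lookup d (ends-∈ e) refl
        last-no-next (there e) (d ∷ u) (there c) = last-no-next e u c

        next-exists : ∀ {x l} → Ends l → x ∈ l → x ≢ x₀ → ∃ λ y → Consec x y l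
        next-exists here      (here refl)         x≢ = _ , here
        next-exists here      (there (here refl)) x≢ = contradiction refl x≢
        next-exists (there here)      (here refl) x≢ = _ , here
        next-exists (there (there e)) (here refl) x≢ = _ , here
        next-exists (there e) (there i)           x≢ with next-exists e i x≢
        ... | y , c = y , there c

        next-q : ∀ x → ∃ λ y → Consec x y q
        next-q x with x ≟′ x₀
        ... | yes refl = v , here
        ... | no x≢ with next-exists (Ok.ends ok) (p-complete x) x≢
        ... | y , c = y , there c

        previous-q : ∀ x → ∃ λ y → Consec y x q
        previous-q x = previous-exists (p-complete x)

        next-q-unique : ∀ {x y z} → Consec x y q → Consec x z q → y ≡ z
        next-q-unique here      here       = refl
        next-q-unique here      (there c)  = contradiction c (last-no-next (Ok.ends ok) unique)
        next-q-unique (there c) here       = contradiction c (last-no-next (Ok.ends ok) unique)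
        next-q-unique (there c) (there c′) = next-unique unique c c′

        no-previous : ∀ {y} → ¬ Consec y v p
        no-previous c = All.lookup (AllPairs.head unique) (consec-∈ʳ c) refl

        previous-q-unique : ∀ {x y z} → Consec x z q → Consec y z q → x ≡ y
        previous-q-unique here      here       = refl
        previous-q-unique here      (there c)  = contradiction c no-previous
        previous-q-unique (there c) here       = contradiction c no-previous
        previous-q-unique (there c) (there c′) = previous-unique unique c c′

        not-back : ¬ Consec v x₀ q
        not-back here         = adj-irreflexive (proj₁ (Ok.target ok))
        not-back (there here) = proj₂ (Ok.target ok) refl
        not-back (there (there c)) = All.lookup (AllPairs.head unique) (consec-∈ˡ c) refl

        q-asym : ∀ {x y} → Consec x y q → ¬ Consec y x q
        q-asym here      c          = not-back c
        q-asym (there c) here       = not-back (there c)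
        q-asym (there c) (there c′) = consec-asym unique c c′

        Nb : X → X → Set
        Nb x y = Consec x y q ⊎ Consec y x q

        nb? : ∀ x y → Dec (Nb x y)
        nb? x y = consec? _≟′_ x y q ⊎-dec consec? _≟′_ y x q

        nb-sym : ∀ {x y} → Nb x y → Nb y x
        nb-sym = Sum.swap

        nb-adj : ∀ {x y} → Nb x y → Adj x y
        nb-adj = [ linked-consec q-linked , adj-sym ∘ linked-consec q-linked ]′
          where
          q-linked : Linked Adj q
          q-linked = adj-sym (proj₁ (Ok.target ok)) ∷ Ok.linked ok

        two : ∀ x → ∃₂ λ a b → a ≢ b × Nb x a × Nb x b × (∀ {z} → Nb x z → z ≡ a ⊎ z ≡ b)
        two x with next-q x | previous-q x
        ... | a , c | b , c′ = a , b , (λ { refl → q-asym c c′ }) , inj₁ c , inj₂ c′ ,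
          Sum.map (λ d → next-q-unique d c) (λ d → previous-q-unique d c′)

        Removed : X → Set
        Removed x = ¬ Nb x (s x)

        without-back : ∀ {x} → Removed (s⁻ x) → ¬ Nb x (s⁻ x)
        without-back {x} r c = r (subst (Nb (s⁻ x)) (sym (ss⁻ x)) (nb-sym c))

        only-chord : ∀ {x z} → ¬ Nb x (s x) → ¬ Nb x (s⁻ x) → Nb x z → z ≡ χ x
        only-chord ¬f ¬b c with nb-adj c
        ... | forth = contradiction c ¬f
        ... | back  = contradiction c ¬b
        ... | chord = refl

        -- If both row edges at `x` were avoided, both neighbours on the new cycle would be `χ x`.
        exclusive : ∀ {x} → Removed x → ¬ Removed (s⁻ x)
        exclusive {x} r r′ with two x
        ... | a , b , a≢b , na , nb , _ = a≢b (trans (only-chord r (without-back r′) na)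
                                                     (sym (only-chord r (without-back r′) nb)))

        Used : X → Set
        Used x = Removed x ⊎ Removed (s⁻ x)

        used⇒nb : ∀ {x} → Used x → Nb x (χ x)
        used⇒nb {x} u with two x
        ... | a , b , a≢b , na , nb , _ with nb-adj na | nb-adj nb
        ... | chord | _     = na
        ... | _     | chord = nb
        ... | forth | forth = contradiction refl a≢b
        ... | back  | back  = contradiction refl a≢b
        ... | forth | back  = ⊥-elim ([ (λ r → r na) , (λ r → without-back r nb) ]′ u)
        ... | back  | forth = ⊥-elim ([ (λ r → r nb) , (λ r → without-back r na) ]′ u)

        nb⇒used : ∀ {x} → Nb x (χ x) → Used x
        nb⇒used {x} c with nb? x (s x) | nb? x (s⁻ x)
        ... | no ¬f | _ = inj₁ ¬f
        ... | yes _ | no ¬b = inj₂ (λ f → ¬b (nb-sym (subst (Nb (s⁻ x)) (ss⁻ x) f)))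
        ... | yes f | yes b′ with two x
        ... | a , b , _ , _ , _ , only with only c | only f | only b′
        ... | inj₁ e | inj₁ e′ | _       = contradiction (trans e (sym e′)) (χ≢s x)
        ... | inj₂ e | inj₂ e′ | _       = contradiction (trans e (sym e′)) (χ≢s x)
        ... | inj₁ e | _       | inj₁ e′ = contradiction (trans e (sym e′)) (χ≢s⁻ x)
        ... | inj₂ e | _       | inj₂ e′ = contradiction (trans e (sym e′)) (χ≢s⁻ x)
        ... | _      | inj₁ e  | inj₁ e′ = contradiction (trans e (sym e′)) (s≢s⁻ x)
        ... | _      | inj₂ e  | inj₂ e′ = contradiction (trans e (sym e′)) (s≢s⁻ x)

        removed? : ∀ x → Dec (Removed x)
        removed? x = ¬? (nb? x (s x))

        used-χ : ∀ {x} → Used x → Used (χ x)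
        used-χ {x} u = nb⇒used (subst (Nb (χ x)) (sym (χχ x)) (nb-sym (used⇒nb u)))

        -- Without chords, the path is forced from its fixed end.
        chordless : (∀ x → ¬ Nb x (χ x)) → ∀ {l} → Ends l → Unique l → (∀ {x y} → Consec x y l → Nb x y) →
                    ∃ λ k → l ≡ down (suc k)
        chordless none here _ _ = 0 , refl
        chordless none (there {a} e) (d ∷ u) nb with chordless none e u (nb ∘ there)
        ... | k , refl with adj-cases (nb-adj (nb here))
        ... | inj₁ e = contradiction (trans (sym (s⁻s a)) (trans (cong s⁻ (sym e)) (s⁻s _)))
                                     (All.lookup d (there (∈-down⁺ k ≤-refl)))
        ... | inj₂ (inj₁ e) = suc k , cong (_∷ down (suc k)) (trans (sym (ss⁻ a)) (cong s (sym e)))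
        ... | inj₂ (inj₂ e) = contradiction (subst (Nb a) e (nb here)) (none a)

        some-used : ∃ Used
        some-used with any-iter? (λ x → nb? x (χ x)) x₀
        ... | yes (k , c) = iter s k x₀ , nb⇒used c
        ... | no ¬c with chordless none (Ok.ends ok) unique (inj₁ ∘ there)
          where
          none : ∀ x → ¬ Nb x (χ x)
          none x c with reach x
          ... | k , refl = ¬c (k , c)
        ... | k , e = contradiction (trans e (cong down (suc-injective (trans (sym (length-down (suc k)))
                        (trans (sym (cong length e)) (trans (↭-length (Ok.perm ok)) (length-down n))))))) p≢

        connected : Connects Removed
        connected R R-refl R-sym R-trans R-s R-χ x y =
          R-trans (R-sym (along (w ∷ r) (λ c → step (inj₁ (there c))) (p-complete x)))
                  (along (w ∷ r) (λ c → step (inj₁ (there c))) (p-complete y))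
          where
          step : ∀ {x y} → Nb x y → R x y
          step {x} {y} c with adj-cases (nb-adj c)
          ... | inj₁ refl        = R-s x λ r → r c
          ... | inj₂ (inj₂ refl) = R-χ x (nb⇒used c)
          ... | inj₂ (inj₁ refl) = R-sym (subst (R (s⁻ x)) (ss⁻ x)
                  (R-s (s⁻ x) λ r → r (subst (Nb (s⁻ x)) (sym (ss⁻ x)) (nb-sym c))))
          along : ∀ {a z} l → (∀ {x y} → Consec x y (a ∷ l) → R x y) → z ∈ a ∷ l → R a z
          along l       h (here refl) = R-refl
          along (b ∷ l) h (there i)   = R-trans (h here) (along l (h ∘ there) i)

        second-cycle : SecondCycle
        second-cycle = record
          { Removed = Removed ; removed? = removed? ; exclusive = exclusive
          ; used-χ = used-χ ; some-used = some-used ; connected = connected }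

      second-cycle : SecondCycle
      second-cycle = analyse (Second.second start)
        where
        analyse : (∃ λ p → p ≢ down n × Unique p × Ok p x₀) → SecondCycle
        analyse ([] , _ , _ , ok)    = ⊥-elim (Ok.target ok)
        analyse (_ ∷ [] , _ , _ , ok) = ⊥-elim (Ok.target ok)
        analyse (v ∷ w ∷ r , p≢ , u , ok) = Analysis.second-cycle v w r p≢ u ok

  abstract
    second-cycle : SecondCycle
    second-cycle with any-iter? (λ x → χ x ≟′ s x) x₀ | minimal-period x₀
    ... | yes (k , e) | _ = Parallel.second-cycle e
    ... | no ¬e | n , per , min = Simple.Base.second-cycle parallel n per min
      where
      parallel : ∀ x → χ x ≢ s x
      parallel x f with reach x
      ... | k , refl = ¬e (k , f)

-- The sequence of rows

module Ends {G : Graph} (R : Rows G) where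
  open Rows R
  open Finite finite
  open Sides R public
  open Graph G using (Adj; loopless)

  -- The third edges on the side of φ lead back to that side.
  U-end : Frame → Set
  U-end φ = φ ∥ U φ

  -- The row of φ has only one side.
  E-end : Frame → Set
  E-end φ = φ ∥ E φ

  -- The reversed alternative is a half-turn.
  U-end⇒⟶ : ∀ {φ} → U-end φ → φ ⟶ U φ
  U-end⇒⟶ (inj₁ p) = p
  U-end⇒⟶ (inj₂ (n , e)) = contradiction (sym e) (ρU-free n _)

  E-end⇒⟶ : ∀ {φ} → E-end φ → φ ⟶ E φ
  E-end⇒⟶ (inj₁ p) = p
  E-end⇒⟶ {φ} (inj₂ (n , e)) = contradiction (trans (sym (ρρ _)) (cong ρ (sym e))) (E-free n φ)

  E≢id : ∀ φ → E φ ≢ φ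
  E≢id φ e = loopless _ (subst (Adj (vertex φ)) (cong vertex e) (adj-E φ))

  -- The two frames at the ends of the row edge ahead of a.
  Edge : Frame → Frame → Set
  Edge a φ = φ ≡ a ⊎ φ ≡ ρ (E a)

  edge-E : ∀ {a φ} → Edge a φ → Edge a (ρ (E φ))
  edge-E (inj₁ refl) = inj₂ refl
  edge-E (inj₂ refl) = inj₁ (ρE-involutive _)

  edge-ρ : ∀ {a φ} → Edge a φ → ¬ Edge a (ρ φ)
  edge-ρ (inj₁ refl) (inj₁ e) = ρ-free _ e
  edge-ρ {a} (inj₁ refl) (inj₂ e) = E≢id a (sym (trans (sym (ρρ a)) (trans (cong ρ e) (ρρ _))))
  edge-ρ {a} (inj₂ refl) (inj₁ e) = E≢id a (trans (sym (ρρ _)) e)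
  edge-ρ (inj₂ refl) (inj₂ e) = ρ-free _ e

  edge-side : ∀ {a φ} → E-end a → Edge a φ → a ∥ φ
  edge-side p (inj₁ refl) = ∥-refl
  edge-side p (inj₂ refl) = ∥-trans p ∥-ρ

  edge? : ∀ a φ → Dec (Edge a φ)
  edge? a φ = (φ ≟′ a) ⊎-dec (φ ≟′ ρ (E a))

  -- A relation between powers of `A` also holds for powers of `A⁻`. This carries the order of `A`
  -- from row to row, although `K` inverts `A`.
  relation : ∀ {f} → (∀ φ → f (A φ) ≡ A⁻ (f φ)) → ∀ {m n φ} →
             iter A m φ ≡ iter A n φ → iter A m (f φ) ≡ iter A n (f φ)
  relation {f} fA {m} {n} {φ} e = begin
    iter A m (f φ)                      ≡⟨ cong (iter A m) (sym (iter-inverse A⁻ A AA⁻ n _)) ⟩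
    iter A m (iter A n (iter A⁻ n (f φ))) ≡⟨ cong (λ χ → iter A m (iter A n χ)) (trans (sym (iter-conj f A A⁻ fA n φ)) (trans (cong f (sym e)) (iter-conj f A A⁻ fA m φ))) ⟩
    iter A m (iter A n (iter A⁻ m (f φ))) ≡⟨ iter-comm A m n _ ⟩
    iter A n (iter A m (iter A⁻ m (f φ))) ≡⟨ cong (iter A n) (iter-inverse A⁻ A AA⁻ m _) ⟩
    iter A n (f φ)                      ∎
    where open ≡-Reasoning

  relation-K : ∀ q {m n φ} → iter A m φ ≡ iter A n φ → iter A m (iter K q φ) ≡ iter A n (iter K q φ)
  relation-K zero    e = e
  relation-K (suc q) {m} {n} e = relation KA {m} {n} (relation-K q {m} {n} e)

  relation-K⁻ : ∀ q {m n φ} → iter A m φ ≡ iter A n φ → iter A m (iter K⁻ q φ) ≡ iter A n (iter K⁻ q φ)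
  relation-K⁻ zero    e = e
  relation-K⁻ (suc q) {m} {n} e = relation K⁻A {m} {n} (relation-K⁻ q {m} {n} e)

  relation-U : ∀ {m n φ} → iter A m φ ≡ iter A n φ → iter A m (U φ) ≡ iter A n (U φ)
  relation-U {m} {n} {φ} e = trans (sym (iter-conj U A A UA m φ)) (trans (cong U e) (iter-conj U A A UA n φ))

  iterA-K : ∀ q → (∀ n φ → iter A n (iter K q φ) ≡ iter K q (iter A n φ)) ⊎
                  (∀ n φ → iter A⁻ n (iter K q φ) ≡ iter K q (iter A n φ))
  iterA-K zero = inj₁ λ n φ → refl
  iterA-K (suc q) with iterA-K q
  ... | inj₁ h = inj₂ λ n φ → trans (sym (iter-conj K A A⁻ KA n _)) (cong K (h n φ))
  ... | inj₂ h = inj₁ λ n φ → trans (sym (iter-conj K A⁻ A KA⁻ n _)) (cong K (h n φ))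

  -- The order of A is even at a U-end …
  U-end-order : ∀ {d φ} → iter A d φ ≡ U φ → iter A (d + d) φ ≡ φ
  U-end-order {d} {φ} e = trans (iter-+ A d d φ) (trans (cong (iter A d) e)
    (trans (sym (iter-conj U A A UA d φ)) (trans (cong U e) (UU φ))))

  -- … and odd at an E-end.
  E-end-order : ∀ {j φ} → iter A j φ ≡ E φ → iter A (j + j) φ ≡ A φ
  E-end-order {j} {φ} e = trans (iter-+ A j j φ) (trans (cong (iter A j) e)
    (trans (sym (iter-conj E A A (λ _ → refl) j φ)) (cong E e)))

  odd-order : ∀ {j φ} → iter A (j + j) φ ≡ A φ → ∀ n → iter A (n * (j + j)) φ ≡ iter A n φ
  odd-order {j} {φ} e zero    = refl
  odd-order {j} {φ} e (suc n) = begin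
    iter A (j + j + n * (j + j)) φ           ≡⟨ iter-+ A (j + j) (n * (j + j)) φ ⟩
    iter A (j + j) (iter A (n * (j + j)) φ)  ≡⟨ cong (iter A (j + j)) (odd-order {j} e n) ⟩
    iter A (j + j) (iter A n φ)              ≡⟨ iter-comm A (j + j) n φ ⟩
    iter A n (iter A (j + j) φ)              ≡⟨ cong (iter A n) e ⟩
    iter A n (A φ)                           ≡⟨ iter-suc A n φ ⟩
    iter A (suc n) φ                         ∎
    where open ≡-Reasoning

  *-swap-double : ∀ m n → m * (n + n) ≡ n * (m + m)
  *-swap-double m n = begin
    m * (n + n)    ≡⟨ *-distribˡ-+ m n n ⟩
    m * n + m * n  ≡⟨ cong₂ _+_ (*-comm m n) (*-comm m n) ⟩
    n * m + n * m  ≡⟨ sym (*-distribˡ-+ n m m) ⟩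
    n * (m + m)    ∎
    where open ≡-Reasoning

  -- The exponent d · 2j acts as d, because 2j acts as 1, and as 0, because 2d acts as 0.
  ends-differ : ∀ {d j φ} → iter A d φ ≡ U φ → iter A (j + j) φ ≡ A φ → ⊥
  ends-differ {d} {j} {φ} u e = U-free φ (begin
    U φ                       ≡⟨ sym u ⟩
    iter A d φ                ≡⟨ sym (odd-order {j} e d) ⟩
    iter A (d * (j + j)) φ    ≡⟨ cong (λ k → iter A k φ) (*-swap-double d j) ⟩
    iter A (j * (d + d)) φ    ≡⟨ iter-periodic A {d + d} (U-end-order {d} u) j ⟩
    φ                         ∎)
    where open ≡-Reasoning

  -- Modulo an odd order, 2 is invertible, so only one exponent is half of 1.
  E-end-unique : ∀ {i j φ} → iter A (i + i) φ ≡ A φ → iter A (j + j) φ ≡ A φ → iter A i φ ≡ iter A j φ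
  E-end-unique {i} {j} {φ} e e′ = trans (sym (odd-order {j} e′ i))
    (trans (cong (λ k → iter A k φ) (*-swap-double i j)) (odd-order {i} e j))

  half-period : ∀ {n d φ} → iter A (suc n) φ ≡ φ → (∀ k → 0 < k → k < suc n → iter A k φ ≢ φ) →
                iter A (d + d) φ ≡ φ → iter A d φ ≢ φ → d % suc n + d % suc n ≡ suc n
  half-period {n} {d} {φ} per min e ≢φ = decide (<-cmp (r + r) (suc n))
    where
    r : ℕ
    r = d % suc n
    twice : iter A (r + r) φ ≡ φ
    twice = trans (iter-+ A r r φ) (trans (cong (iter A r) (iter-% A per d))
      (trans (iter-comm A r d φ) (trans (cong (iter A d) (iter-% A per d)) (trans (sym (iter-+ A d d φ)) e))))
    positive : ∀ k → k ≡ r → 0 < k + k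
    positive zero    eq = contradiction (trans (sym (iter-% A per d)) (cong (λ k → iter A k φ) (sym eq))) ≢φ
    positive (suc _) eq = s≤s z≤n
    decide : Tri (r + r < suc n) (r + r ≡ suc n) (suc n < r + r) → r + r ≡ suc n
    decide (tri≈ _ eq _) = eq
    decide (tri< lt _ _) = contradiction twice (min (r + r) (positive r refl) lt)
    decide (tri> _ _ gt) = contradiction (𝔸.iter-cancel (<⇒≤ gt) (trans per (sym twice)))
      (min _ (m<n⇒0<n∸m gt) (+-cancelʳ-< (suc n) _ _ (subst (_< suc n + suc n) (sym (m∸n+n≡m (<⇒≤ gt)))
        (+-mono-< (m%n<n d (suc n)) (m%n<n d (suc n))))))

  double-injective : ∀ {m n} → m + m ≡ n + n → m ≡ n
  double-injective {m} {n} e with <-cmp m n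
  ... | tri≈ _ eq _ = eq
  ... | tri< lt _ _ = contradiction e (<⇒≢ (+-mono-< lt lt))
  ... | tri> _ _ gt = contradiction (sym e) (<⇒≢ (+-mono-< gt gt))

  -- A cyclic group has at most one element of order two.
  half-unique : ∀ {d e φ} → iter A (d + d) φ ≡ φ → iter A d φ ≢ φ →
                iter A (e + e) φ ≡ φ → iter A e φ ≢ φ → iter A d φ ≡ iter A e φ
  half-unique {d} {e} {φ} d² d≢ e² e≢ with 𝔸.minimal-period φ
  ... | n , per , min = trans (sym (iter-% A {suc n} per d)) (trans (cong (λ k → iter A k φ)
    (double-injective {d % suc n} {e % suc n}
      (trans (half-period {d = d} per min d² d≢) (sym (half-period {d = e} per min e² e≢)))))
    (iter-% A {suc n} per e))

  module Period {φ₀} (v₀ : Valid φ₀) (star : ∀ u v → Star Adj u v) where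

    side-period : ∃ λ n → φ₀ ∥ iter K (suc n) φ₀ × (∀ k → 0 < k → k < suc n → ¬ φ₀ ∥ iter K k φ₀)
    side-period with 𝕂.period φ₀
    ... | p , e = least⁺ (λ n → φ₀ ∥? iter K n φ₀) (p , ∥-reflexive (sym e))

    on-side : (∀ {φ} → Valid φ → ∃ λ i → iter K i φ₀ ∥ φ ⊎ U (iter K i φ₀) ∥ φ) ×
              (∀ v → ∃ λ φ → Valid φ × vertex φ ≡ v)
    on-side = valid-induction star v₀ (0 , inj₁ ∥-refl)
      (λ _ (i , p) → i , Sum.map (λ q → ∥-trans q ∥-ρ) (λ q → ∥-trans q ∥-ρ) p)
      (λ _ → step-E)
      (λ _ → λ { (i , inj₁ p) → i , inj₂ (∥-U p)
               ; (i , inj₂ p) → i , inj₁ (∥-trans (∥-reflexive (sym (UU _))) (∥-U p)) })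
      where
      step-E : ∀ {φ} → (∃ λ i → iter K i φ₀ ∥ φ ⊎ U (iter K i φ₀) ∥ φ) →
               ∃ λ i → iter K i φ₀ ∥ E φ ⊎ U (iter K i φ₀) ∥ E φ
      step-E (i , inj₂ p) = suc i , inj₁ (∥-trans (∥-sym ∥-ρ) (∥-E p))
      step-E (suc i , inj₁ p) = i , inj₂ (∥-trans (∥-reflexive (sym (E⁻E _))) (∥-trans (∥-sym ∥-ρ) (∥-E p)))
      -- The side before the first one also occurs later, `K` being periodic.
      step-E (zero , inj₁ p) with 𝕂.inverse-reach φ₀
      ... | n , e = n , inj₂ (∥-trans (∥-reflexive (trans (cong U e) (UU _))) (∥-trans (∥-sym ∥-ρ) (∥-E p)))

    cover : ∀ v → ∃ λ φ → Valid φ × vertex φ ≡ v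
    cover = proj₂ on-side

    ∥-periodic : ∀ {m} → φ₀ ∥ iter K m φ₀ → ∀ k → φ₀ ∥ iter K (k * m) φ₀
    ∥-periodic p zero    = ∥-refl
    ∥-periodic {m} p (suc k) = ∥-trans p (∥-trans (∥-iter ∥-K m (∥-periodic p k)) (∥-reflexive (sym (iter-+ K m (k * m) φ₀))))

    ∥-% : ∀ {m} → φ₀ ∥ iter K (suc m) φ₀ → ∀ n → iter K (n % suc m) φ₀ ∥ iter K n φ₀
    ∥-% {m} p n = ∥-trans (∥-iter ∥-K (n % suc m) (∥-periodic p (n / suc m)))
      (∥-reflexive (trans (sym (iter-+ K (n % suc m) _ φ₀)) (cong (λ k → iter K k φ₀) (sym (m≡m%n+[m/n]*n n (suc m))))))

    cover-sides : ∀ {m} → φ₀ ∥ iter K (suc m) φ₀ → ∀ {φ} → Valid φ →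
                  ∃ λ i → i < suc m × (iter K i φ₀ ∥ φ ⊎ U (iter K i φ₀) ∥ φ)
    cover-sides {m} p vφ with proj₁ on-side vφ
    ... | i , q = i % suc m , m%n<n i (suc m) ,
      Sum.map (∥-trans (∥-% p i)) (∥-trans (∥-U (∥-% p i))) q

    iterK⁻-∥ : ∀ {m} → φ₀ ∥ iter K m φ₀ → ∀ {i} → i ≤ m → iter K⁻ i φ₀ ∥ iter K (m ∸ i) φ₀
    iterK⁻-∥ {m} p {i} i≤m = ∥-trans (∥-iter ∥-K⁻ i p) (∥-reflexive
      (trans (cong (iter K⁻ i) (trans (cong (λ k → iter K k φ₀) (sym (m+[n∸m]≡n i≤m))) (iter-+ K i (m ∸ i) φ₀)))
             (iter-inverse K K⁻ K⁻K i _)))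

    -- `U` conjugates `K` to its inverse. At an end it therefore folds the cyclic sequence of sides,
    -- and a second end appears half-way round.
    U-iterK : ∀ i → U (iter K i φ₀) ≡ iter K⁻ i (U φ₀)
    U-iterK i = iter-conj U K K⁻ (λ _ → refl) i φ₀

-- A side whose third edges lead back to it

module FoldedSide {G : Graph} (R : Rows G) {φ₀ : Rows.Frame R} (v₀ : Rows.Valid R φ₀)
  (star : ∀ u v → Star (Graph.Adj G) u v) (end : Ends.U-end R φ₀) where
  open Rows R
  open Finite finite
  open Ends R
  open Period v₀ star

  U-K : ∀ {m} → φ₀ ∥ iter K m φ₀ → ∀ {i} → i ≤ m → U (iter K i φ₀) ∥ iter K (m ∸ i) φ₀
  U-K p {i} i≤m = ∥-trans (∥-reflexive (U-iterK i)) (∥-trans (∥-iter ∥-K⁻ i (∥-sym end)) (iterK⁻-∥ p i≤m))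

  first : ∃ λ d → iter A d φ₀ ≡ U φ₀
  first = U-end⇒⟶ end

  d : ℕ
  d = proj₁ first

  -- Half-way round an odd period the fold produces a one-sided row, where the order of `A` would be
  -- odd; at `φ₀` it is even.
  odd-period : ∀ q → φ₀ ∥ iter K (suc (q + q)) φ₀ → ⊥
  odd-period q p with E-end⇒⟶ {U (iter K q φ₀)} (∥-trans
      (∥-trans (U-K p (≤-trans (m≤m+n q q) (n≤1+n _))) (∥-reflexive (cong (λ k → iter K k φ₀) (trans (+-∸-assoc 1 (m≤m+n q q)) (cong suc (m+n∸n≡m q q))))))
      (∥-sym ∥-ρ))
  ... | j , e = ends-differ {d} {j} (proj₂ first)
    (subst (λ φ → iter A (j + j) φ ≡ A φ) (iter-inverse K K⁻ K⁻K q φ₀)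
      (relation-K⁻ q {j + j} {1} (subst (λ φ → iter A (j + j) φ ≡ A φ) (UU _) (relation-U {j + j} {1} (E-end-order {j} e)))))

  module Even (q′ : ℕ) (period : φ₀ ∥ iter K (suc q′ + suc q′) φ₀)
    (minimal : ∀ k → 0 < k → k < suc q′ + suc q′ → ¬ φ₀ ∥ iter K k φ₀) where

    q : ℕ
    q = suc q′

    -- The strands start at the two ends of one third edge, which joins them at the bottom;
    -- `top-equation` shows that they are also joined at the top.
    P : Frame → Set
    P ψ = ψ ≡ φ₀ ⊎ ψ ≡ U φ₀

    P-side : ∀ {ψ} → P ψ → φ₀ ⟶ ψ
    P-side (inj₁ refl) = ⟶-refl
    P-side (inj₂ refl) = U-end⇒⟶ end

    q<q+q : q < q + q
    q<q+q = m<m+n q (s≤s z≤n)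

    m : ℕ
    m = q + q

    m∸q : m ∸ q ≡ q
    m∸q = m+n∸n≡m q q

    P? : ∀ ψ → Dec (P ψ)
    P? ψ = (ψ ≟′ φ₀) ⊎-dec (ψ ≟′ U φ₀)

    levels : ∀ d → 0 < d → d < q → ¬ φ₀ ∥ iter K d φ₀
    levels d 0<d d<q = minimal d 0<d (<-trans d<q q<q+q)

    sides : ∀ {i j} → i < q → j < q → ¬ iter K (suc i) φ₀ ∥ U (iter K j φ₀)
    sides {i} {j} i<q j<q p = minimal (m ∸ j ∸ suc i) (m<n⇒0<n∸m lt) (<-≤-trans (∸-monoʳ-< (s≤s z≤n) (<⇒≤ lt)) (m∸n≤m m j))
        (∥-K-difference (<⇒≤ lt) (∥-trans p (U-K period (<⇒≤ (<-trans j<q q<q+q)))))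
      where
      lt : suc i < m ∸ j
      lt = ≤-<-trans i<q (subst (q <_) (sym (+-∸-assoc q (<⇒≤ j<q))) (m<m+n q (m<n⇒0<n∸m j<q)))

    open Stack R q P P? P-side levels sides

    -- At both folds `U` acts as a translation of order two along the row, and there is only one.
    -- Being its own inverse, it passes through `K` whatever the parity of `q`.
    top-equation : U (iter K q φ₀) ≡ iter K q (U φ₀)
    top-equation with U-end⇒⟶ {iter K q φ₀} (∥-sym (∥-trans (U-K period (<⇒≤ q<q+q))
                        (∥-reflexive (cong (λ k → iter K k φ₀) m∸q))))
    ... | e , eq = sym (begin
      iter K q (U φ₀)         ≡⟨ cong (iter K q) (sym (proj₂ first)) ⟩
      iter K q (iter A d φ₀)  ≡⟨ cong (iter K q) (half-unique {d} {e} (U-end-order {d} (proj₂ first))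
                                   (λ f → U-free φ₀ (trans (sym (proj₂ first)) f)) back back≢) ⟩
      iter K q (iter A e φ₀)  ≡⟨ commute (iterA-K q) ⟩
      iter A e (iter K q φ₀)  ≡⟨ eq ⟩
      U (iter K q φ₀)         ∎)
      where
      open ≡-Reasoning
      order : iter A (e + e) (iter K q φ₀) ≡ iter K q φ₀
      order = U-end-order {e} eq
      back : iter A (e + e) φ₀ ≡ φ₀
      back = subst (λ φ → iter A (e + e) φ ≡ φ) (iter-inverse K K⁻ K⁻K q φ₀) (relation-K⁻ q {e + e} {0} order)
      back≢ : iter A e φ₀ ≢ φ₀
      back≢ f = U-free _ (trans (sym eq) (relation-K q {e} {0} f))
      commute : (∀ n φ → iter A n (iter K q φ) ≡ iter K q (iter A n φ)) ⊎
                (∀ n φ → iter A⁻ n (iter K q φ) ≡ iter K q (iter A n φ)) →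
                iter K q (iter A e φ₀) ≡ iter A e (iter K q φ₀)
      commute (inj₁ h) = sym (h e φ₀)
      commute (inj₂ h) = trans (sym (h e φ₀)) (trans
        (cong (iter A⁻ e) (trans (sym order) (iter-+ A e e _))) (iter-inverse A A⁻ A⁻A e _))

    base-stacked : Stacked φ₀
    base-stacked = 0 , U φ₀ , s≤s z≤n , inj₂ refl , inj₂ (UU φ₀)

    bottom : ∀ {ψ} → P ψ → Boundary.Cut± None ψ
    bottom (inj₁ refl) = inj₁ (inj₁ base-stacked)
    bottom (inj₂ refl) = inj₁ (inj₁ (0 , φ₀ , s≤s z≤n , inj₁ refl , inj₂ refl))

    top : ∀ {ψ} → P ψ → Boundary.Cut± None (U (iter K q ψ))
    top (inj₁ refl) = inj₁ (inj₁ (q′ , U φ₀ , n<1+n q′ , inj₂ refl , inj₁ (sym top-equation)))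
    top (inj₂ refl) = inj₁ (inj₁ (q′ , φ₀ , n<1+n q′ , inj₁ refl , inj₁ (trans (sym (UU _)) (cong U top-equation))))

    open Extend None none? ⊥-elim ⊥-elim ⊥-elim ⊥-elim bottom top

    valid-in-stack : ∀ {φ} → Valid φ → InStack φ
    valid-in-stack vφ = place (cover-sides period vφ)
      where
      back : ∀ {i φ} → i < m → q ≤ i → U (iter K i φ₀) ∥ φ → InStack φ
      back {i} {φ} i<m q≤i p = go (m ∸ i) (m<n⇒0<n∸m i<m) (subst (m ∸ i ≤_) m∸q (∸-monoʳ-≤ m q≤i)) (U-K period (<⇒≤ i<m))
        where
        go : ∀ k → 0 < k → k ≤ q → U (iter K i φ₀) ∥ iter K k φ₀ → InStack φ
        go (suc k) _ k<q r = k , k<q , inj₁ (∥-trans (∥-sym r) p)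
      far : ∀ {i φ} → suc i < m → ¬ suc i ≤ q → iter K (suc i) φ₀ ∥ φ → InStack φ
      far {i} i<m i≥q p = m ∸ suc i , subst (m ∸ suc i <_) m∸q (∸-monoʳ-< (≰⇒> i≥q) (<⇒≤ i<m)) ,
        inj₂ (∥-trans (U-K period (m∸n≤m m (suc i))) (∥-trans (∥-reflexive (cong (λ k → iter K k φ₀) (m∸[m∸n]≡n (<⇒≤ i<m)))) p))
      near : ∀ {i φ} → suc i < m → Dec (suc i ≤ q) → iter K (suc i) φ₀ ∥ φ → InStack φ
      near _   (yes i<q) p = _ , i<q , inj₁ p
      near i<m (no i≥q)  p = far i<m i≥q p
      up : ∀ {i φ} → i < m → Dec (i < q) → U (iter K i φ₀) ∥ φ → InStack φ
      up _   (yes i<q) p = _ , i<q , inj₂ p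
      up i<m (no i≮q)  p = back i<m (≮⇒≥ i≮q) p
      place : ∀ {φ} → (∃ λ i → i < m × (iter K i φ₀ ∥ φ ⊎ U (iter K i φ₀) ∥ φ)) → InStack φ
      place (zero  , _ , inj₁ p)   = 0 , s≤s z≤n , inj₂ (∥-trans (∥-sym end) p)
      place (suc i , i<m , inj₁ p) = near i<m (suc i ≤? q) p
      place (i , i<m , inj₂ p)     = up i<m (i <? q) p

    connected : ∀ {φ} → Valid φ → φ₀ ~ φ
    connected {φ} vφ = from (in-stack (inj₁ refl) (valid-in-stack vφ))
      where
      from : (∃ λ ψ → P ψ × φ ~ U ψ) → φ₀ ~ φ
      from (ψ , inj₁ refl , e) = ~-trans (~-U (inj₁ base-stacked)) (~-sym e)
      from (ψ , inj₂ refl , e) = ~-sym (~-trans e (~-reflexive (UU φ₀)))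

    hamiltonian : Hamiltonian G
    hamiltonian = Cyclic.hamiltonian v₀ connected cover

  hamiltonian : Hamiltonian G
  hamiltonian = choose side-period
    where
    choose : (∃ λ n → φ₀ ∥ iter K (suc n) φ₀ × (∀ k → 0 < k → k < suc n → ¬ φ₀ ∥ iter K k φ₀)) → Hamiltonian G
    choose (n , period , minimal) = split (halve (suc n))
      where
      split : (∃ λ q → suc n ≡ q + q ⊎ suc n ≡ suc (q + q)) → Hamiltonian G
      split (q , inj₂ eq) = ⊥-elim (odd-period q (subst (λ k → φ₀ ∥ iter K k φ₀) eq period))
      split (suc q , inj₁ eq) = Even.hamiltonian q (subst (λ k → φ₀ ∥ iter K k φ₀) eq period)
        (λ k 0<k k<m → minimal k 0<k (subst (k <_) (sym eq) k<m))

-- A row with only one side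

module OneSidedRow {G : Graph} (R : Rows G) {φ₀ : Rows.Frame R} (v₀ : Rows.Valid R φ₀)
  (star : ∀ u v → Star (Graph.Adj G) u v) (end : Ends.E-end R φ₀) where
  open Rows R
  open Finite finite
  open Ends R
  open Period v₀ star

  U-K : ∀ {m} → φ₀ ∥ iter K m φ₀ → ∀ {i} → suc i ≤ m → U (iter K i φ₀) ∥ iter K (m ∸ suc i) φ₀
  U-K p {i} i<m = ∥-trans (∥-reflexive (U-iterK i)) (∥-trans
    (∥-iter ∥-K⁻ i (∥-U (∥-trans end ∥-ρ))) (∥-trans (∥-reflexive (iter-suc K⁻ i φ₀)) (iterK⁻-∥ p i<m)))

  first : ∃ λ j → iter A j φ₀ ≡ E φ₀
  first = E-end⇒⟶ end

  j₀ : ℕ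
  j₀ = proj₁ first

  odd-period : ∀ q → φ₀ ∥ iter K (suc (q + q)) φ₀ → ⊥
  odd-period q p with U-end⇒⟶ {iter K q φ₀} (∥-sym (∥-trans (U-K p (s≤s (m≤m+n q q)))
                        (∥-reflexive (cong (λ k → iter K k φ₀) (m+n∸n≡m q q)))))
  ... | d , e = ends-differ {d} {j₀} e (relation-K q {j₀ + j₀} {1} (E-end-order {j₀} (proj₂ first)))

  -- With a single edge removed, a one-sided row is a path through all of its vertices, from `E a`
  -- around to `a`.
  module EndRow (S : Strands) {a} (a-end : E-end a)
    (a-cut : ∀ {φ} → a ⟶ φ → Strands.Cut S φ → Edge a φ) where
    open Strands S

    a⟶E : a ⟶ E a
    a⟶E = E-end⇒⟶ a-end

    a⟶iterE : ∀ n → a ⟶ iter E n a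
    a⟶iterE zero    = ⟶-refl
    a⟶iterE (suc n) = ⟶-trans a⟶E (⟶-E (a⟶iterE n))

    Ea⟶iterE : ∀ n → a ⟶ iter E n (E a)
    Ea⟶iterE n = subst (a ⟶_) (sym (iter-suc E n a)) (a⟶iterE (suc n))

    from-Ea : ∀ n → E a ~ iter E n (E a)
    from-Ea zero    = ~-refl
    from-Ea (suc n) = step (cut? (iter E n (E a)))
      where
      end-of-row : Edge a (iter E n (E a)) → E a ~ iter E (suc n) (E a)
      end-of-row (inj₁ e) = ~-reflexive (cong E (sym e))
      end-of-row (inj₂ e) = contradiction (subst (E a ⟶_) e (⟶-trans (⟶-sym a⟶E) (Ea⟶iterE n))) ⟶-¬ρ
      step : Dec (Cut (iter E n (E a))) → E a ~ iter E (suc n) (E a)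
      step (no ¬c) = ~-trans (from-Ea n) (~-E ¬c)
      step (yes c) = end-of-row (a-cut (Ea⟶iterE n) c)

    module 𝔼 = Permutation finite E E⁻ E⁻E

    from-a : ∀ {φ} → a ⟶ φ → a ~ φ
    from-a p = ~-trans (~-sym (reach ⟶-refl)) (reach p)
      where
      reach : ∀ {φ} → a ⟶ φ → E a ~ φ
      reach (n , refl) = let (t , per) = 𝔼.period a in ~-trans (from-Ea (n + n + t)) (~-reflexive (begin
        iter E (n + n + t) (E a)          ≡⟨ iter-suc E (n + n + t) a ⟩
        iter E (suc (n + n + t)) a        ≡⟨ cong (λ k → iter E k a) (sym (+-suc (n + n) t)) ⟩
        iter E (n + n + suc t) a          ≡⟨ iter-+ E (n + n) (suc t) a ⟩
        iter E (n + n) (iter E (suc t) a) ≡⟨ cong (iter E (n + n)) per ⟩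
        iter E (n + n) a                  ≡⟨ trans (iter-+ E n n a) (sym (iter-A-E n a)) ⟩
        iter A n a                        ∎))
        where open ≡-Reasoning

    from-side : ∀ {φ} → a ∥ φ → a ~ φ
    from-side (inj₁ p) = from-a p
    from-side (inj₂ p) = ~-trans (from-a p) (~-sym ~-ρ)

  module Even (q : ℕ) (period : φ₀ ∥ iter K (suc q + suc q) φ₀)
    (minimal : ∀ k → 0 < k → k < suc q + suc q → ¬ φ₀ ∥ iter K k φ₀) where

    m : ℕ
    m = suc q + suc q

    m∸q : m ∸ suc q ≡ suc q
    m∸q = m+n∸n≡m (suc q) (suc q)

    q<m : suc q < m
    q<m = m<m+n (suc q) (s≤s z≤n)

    -- The strands start at the two ends of one edge of the bottom row, and this edge is removed
    -- too.
    P : Frame → Set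
    P ψ = ψ ≡ φ₀ ⊎ ψ ≡ E φ₀

    P-side : ∀ {ψ} → P ψ → φ₀ ⟶ ψ
    P-side (inj₁ refl) = ⟶-refl
    P-side (inj₂ refl) = E-end⇒⟶ end

    K-apart : ∀ {i j} → i < j → j ≤ m → ¬ (i ≡ 0 × j ≡ m) → ¬ iter K i φ₀ ∥ iter K j φ₀
    K-apart {zero} {j} i<j j≤m ¬z p with m≤n⇒m<n∨m≡n j≤m
    ... | inj₁ j<m = minimal j i<j j<m p
    ... | inj₂ j≡m = ¬z (refl , j≡m)
    K-apart {suc i} {j} i<j j≤m _ p = minimal (j ∸ suc i) (m<n⇒0<n∸m i<j)
      (<-≤-trans (∸-monoʳ-< (s≤s z≤n) (<⇒≤ i<j)) j≤m) (∥-K-difference (<⇒≤ i<j) p)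

    q<m∸ : ∀ {j} → j < q → suc q < m ∸ suc j
    q<m∸ {j} j<q = subst (suc q <_) (sym (+-∸-assoc (suc q) (≤-trans j<q (n≤1+n q)))) (m<m+n (suc q) (m<n⇒0<n∸m (s≤s j<q)))

    P? : ∀ ψ → Dec (P ψ)
    P? ψ = (ψ ≟′ φ₀) ⊎-dec (ψ ≟′ E φ₀)

    levels : ∀ d → 0 < d → d < q → ¬ φ₀ ∥ iter K d φ₀
    levels d 0<d d<q = minimal d 0<d (<-trans (<-trans d<q (n<1+n q)) q<m)

    sides : ∀ {i j} → i < q → j < q → ¬ iter K (suc i) φ₀ ∥ U (iter K j φ₀)
    sides {i} {j} i<q j<q p =
      K-apart (<-trans (s≤s i<q) (q<m∸ j<q)) (m∸n≤m m (suc j)) (λ ())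
        (∥-trans p (U-K period (≤-trans j<q (≤-trans (n≤1+n q) (<⇒≤ q<m)))))

    open Stack R q P P? P-side levels sides

    w : Frame
    w = U (iter K q φ₀)

    w-side : w ∥ iter K (suc q) φ₀
    w-side = ∥-trans (U-K period (<⇒≤ q<m)) (∥-reflexive (cong (λ k → iter K k φ₀) m∸q))

    w-end : E-end w
    w-end = ∥-trans w-side (∥-sym ∥-ρ)

    w⟶E : ∃ λ e → iter A e w ≡ E w
    w⟶E = E-end⇒⟶ w-end

    -- By uniqueness of the half of 1, the power of `A` that acts as `E` in the bottom row does so
    -- in the top row.
    Aʲw : iter A j₀ w ≡ E w
    Aʲw = trans (E-end-unique {j₀} {proj₁ w⟶E}
        (relation-U {j₀ + j₀} {1} (relation-K q {j₀ + j₀} {1} (E-end-order {j₀} (proj₂ first))))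
        (E-end-order {proj₁ w⟶E} (proj₂ w⟶E))) (proj₂ w⟶E)

    A⁻ʲw : iter A⁻ j₀ w ≡ E⁻ w
    A⁻ʲw = trans (cong (iter A⁻ j₀) (trans (sym (E⁻E w)) (trans (cong E⁻ (sym Aʲw))
      (iter-conj E⁻ A A (λ φ → trans (E⁻E _) (sym (cong E (EE⁻ φ)))) j₀ w)))) (iter-inverse A A⁻ A⁻A j₀ _)

    -- `E φ₀` is `φ₀` shifted `j₀` times by `A`; along the strands this becomes a shift by `A` or by
    -- `A⁻`, according to the parity of `q`. So the strands arrive at adjacent vertices of the top
    -- row as well.
    top-equation : U (iter K q (E φ₀)) ≡ E w ⊎ U (iter K q (E φ₀)) ≡ E⁻ w
    top-equation = Sum.map
        (λ h → trans start (trans (cong U (sym (h j₀ φ₀))) (trans (iter-conj U A A UA j₀ _) Aʲw)))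
        (λ h → trans start (trans (cong U (sym (h j₀ φ₀))) (trans (iter-conj U A⁻ A⁻ UA⁻ j₀ _) A⁻ʲw)))
        (iterA-K q)
      where
      start : U (iter K q (E φ₀)) ≡ U (iter K q (iter A j₀ φ₀))
      start = cong (U ∘ iter K q) (sym (proj₂ first))

    record TopEdge : Set where
      field
        τ      : Frame
        w∥τ    : w ∥ τ
        edge⇒P : ∀ {φ} → Edge τ φ → ∃ λ ψ → P ψ × (φ ≡ U (iter K q ψ) ⊎ φ ≡ ρ (U (iter K q ψ)))
        P⇒edge : ∀ {ψ} → P ψ → Edge τ (U (iter K q ψ)) ⊎ Edge τ (ρ (U (iter K q ψ)))

    top-edge : U (iter K q (E φ₀)) ≡ E w ⊎ U (iter K q (E φ₀)) ≡ E⁻ w → TopEdge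
    top-edge (inj₁ e) = record
      { τ = w ; w∥τ = ∥-refl
      ; edge⇒P = λ { (inj₁ refl) → φ₀ , inj₁ refl , inj₁ refl ; (inj₂ refl) → E φ₀ , inj₂ refl , inj₂ (cong ρ (sym e)) }
      ; P⇒edge = λ { (inj₁ refl) → inj₁ (inj₁ refl) ; (inj₂ refl) → inj₂ (inj₂ (cong ρ e)) } }
    top-edge (inj₂ e) = record
      { τ = ρ w ; w∥τ = ∥-ρ
      ; edge⇒P = λ { (inj₁ refl) → φ₀ , inj₁ refl , inj₂ refl ; (inj₂ refl) → E φ₀ , inj₂ refl , inj₁ (sym e) }
      ; P⇒edge = λ { (inj₁ refl) → inj₂ (inj₁ refl) ; (inj₂ refl) → inj₁ (inj₂ e) } }

    abstract
      chosen-top : TopEdge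
      chosen-top = top-edge top-equation

    open TopEdge chosen-top

    τ-end : E-end τ
    τ-end = ∥-trans (∥-sym w∥τ) (∥-trans w-end (∥-E w∥τ))

    τ-side : iter K (suc q) φ₀ ∥ τ
    τ-side = ∥-trans (∥-sym w-side) w∥τ

    X : Frame → Set
    X φ = Edge φ₀ φ ⊎ Edge τ φ

    ¬φ₀∥τ : ¬ φ₀ ∥ τ
    ¬φ₀∥τ p = minimal (suc q) (s≤s z≤n) q<m (∥-trans p (∥-sym τ-side))

    X-ρ : ∀ {φ} → X φ → ¬ X (ρ φ)
    X-ρ (inj₁ e) (inj₁ e′) = edge-ρ e e′
    X-ρ (inj₂ e) (inj₂ e′) = edge-ρ e e′
    X-ρ (inj₁ e) (inj₂ e′) = ¬φ₀∥τ (∥-trans (edge-side end e) (∥-trans ∥-ρ (∥-sym (edge-side τ-end e′))))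
    X-ρ (inj₂ e) (inj₁ e′) = ¬φ₀∥τ (∥-trans (edge-side end e′) (∥-trans (∥-sym ∥-ρ) (∥-sym (edge-side τ-end e))))

    X-out : ∀ {φ} → X φ → ¬ InStack φ
    X-out (inj₁ e) (i , i<q , inj₁ p) =
      minimal (suc i) (s≤s z≤n) (<-trans (s≤s i<q) q<m) (∥-trans (edge-side end e) (∥-sym p))
    X-out (inj₁ e) (i , i<q , inj₂ p) =
      minimal (m ∸ suc i) (≤-<-trans z≤n (q<m∸ i<q)) (∸-monoʳ-< (s≤s z≤n) (≤-trans (≤-trans i<q (n≤1+n q)) (<⇒≤ q<m)))
        (∥-trans (edge-side end e) (∥-trans (∥-sym p) (U-K period (≤-trans (≤-trans i<q (n≤1+n q)) (<⇒≤ q<m)))))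
    X-out (inj₂ e) (i , i<q , inj₁ p) =
      K-apart (s≤s i<q) (<⇒≤ q<m) (λ ())
        (∥-trans p (∥-sym (∥-trans τ-side (edge-side τ-end e))))
    X-out (inj₂ e) (i , i<q , inj₂ p) =
      K-apart (q<m∸ i<q) (m∸n≤m m (suc i)) (λ ())
        (∥-trans (∥-trans τ-side (edge-side τ-end e)) (∥-trans (∥-sym p)
          (U-K period (≤-trans (≤-trans i<q (n≤1+n q)) (<⇒≤ q<m)))))

    open Boundary X

    bottom : ∀ {ψ} → P ψ → Cut± ψ
    bottom (inj₁ refl) = inj₁ (inj₂ (inj₁ (inj₁ refl)))
    bottom (inj₂ refl) = inj₂ (inj₂ (inj₁ (inj₂ refl)))

    top : ∀ {ψ} → P ψ → Cut± (U (iter K q ψ))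
    top p = [ (λ e → inj₁ (inj₂ (inj₂ e))) , (λ e → inj₂ (inj₂ (inj₂ e))) ]′ (P⇒edge p)

    X-U : ∀ {φ} → X φ → Cut± (U φ)
    X-U (inj₁ (inj₁ refl)) = above bottom top (inj₁ refl)
    X-U (inj₁ (inj₂ refl)) = subst Cut± (sym (Uρ _)) (cut±-ρ (above bottom top (inj₂ refl)))
    X-U {φ} (inj₂ e) = from-top (edge⇒P e)
      where
      from-top : (∃ λ ψ → P ψ × (φ ≡ U (iter K q ψ) ⊎ φ ≡ ρ (U (iter K q ψ)))) → Cut± (U φ)
      from-top (ψ , p , inj₁ refl) = subst Cut± (sym (UU _)) (below bottom top p)
      from-top (ψ , p , inj₂ refl) = subst Cut± (sym (trans (Uρ _) (cong ρ (UU _)))) (cut±-ρ (below bottom top p))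

    X? : ∀ φ → Dec (X φ)
    X? φ = edge? φ₀ φ ⊎-dec edge? τ φ

    open Extend X X? (Sum.map edge-E edge-E) X-ρ X-out X-U bottom top

    in-stack-∥ : ∀ {φ ψ} → φ ∥ ψ → InStack ψ → InStack φ
    in-stack-∥ p (i , i<q , inj₁ r) = i , i<q , inj₁ (∥-trans r (∥-sym p))
    in-stack-∥ p (i , i<q , inj₂ r) = i , i<q , inj₂ (∥-trans r (∥-sym p))

    bottom-cut : ∀ {φ} → φ₀ ⟶ φ → Cut φ → Edge φ₀ φ
    bottom-cut p (inj₁ s)        = contradiction (in-stack-∥ (inj₁ p) (stacked⇒in s)) (X-out (inj₁ (inj₁ refl)))
    bottom-cut p (inj₂ (inj₁ e)) = e
    bottom-cut p (inj₂ (inj₂ e)) = contradiction (∥-trans (inj₁ p) (∥-sym (edge-side τ-end e))) ¬φ₀∥τ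

    top-cut : ∀ {φ} → τ ⟶ φ → Cut φ → Edge τ φ
    top-cut p (inj₁ s)        = contradiction (in-stack-∥ (inj₁ p) (stacked⇒in s)) (X-out (inj₂ (inj₁ refl)))
    top-cut p (inj₂ (inj₁ e)) = contradiction (∥-trans (edge-side end e) (∥-sym (inj₁ p))) ¬φ₀∥τ
    top-cut p (inj₂ (inj₂ e)) = e

    module Bottom = EndRow strands end bottom-cut
    module Top = EndRow strands τ-end top-cut

    stack-connected : ∀ {φ} → InStack φ → φ₀ ~ φ
    stack-connected {φ} s = from (in-stack (inj₁ refl) s)
      where
      from : (∃ λ ψ → P ψ × φ ~ U ψ) → φ₀ ~ φ
      from (ψ , p , e) = ~-trans (Bottom.from-a (P-side p)) (~-trans (~-U± (bottom p)) (~-sym e))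

    top-connected : φ₀ ~ τ
    top-connected = ~-trans lower (~-trans (~-trans (~-reflexive (sym (UU _))) (~-sym (~-U± (top (inj₁ refl)))))
                                           (~-sym (Top.from-side (∥-sym w∥τ))))
      where
      lower : φ₀ ~ iter K q φ₀
      lower = go q refl
        where
        go : ∀ k → k ≡ q → φ₀ ~ iter K k φ₀
        go zero    _    = ~-refl
        go (suc k) refl = stack-connected (k , n<1+n k , inj₁ ∥-refl)

    data Place (φ : Frame) : Set where
      bottom-row : φ₀ ∥ φ → Place φ
      top-row    : τ ∥ φ → Place φ
      stack      : InStack φ → Place φ

    place-K : ∀ {i φ} → i < m → iter K i φ₀ ∥ φ → Place φ
    place-K {zero} _ p = bottom-row p
    place-K {suc i} {φ} i<m p with suc i ≤? q | suc i ≤? suc q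
    ... | yes i<q | _ = stack (i , i<q , inj₁ p)
    ... | no ¬i<q | yes i≤q = top-row (∥-trans (∥-sym τ-side)
          (subst (λ k → iter K k φ₀ ∥ φ) (≤-antisym i≤q (≰⇒> ¬i<q)) p))
    ... | no _ | no i>q = stack (m ∸ suc (suc i) , bound , inj₂ (∥-trans (U-K period lt)
          (∥-trans (∥-reflexive (cong (λ k → iter K k φ₀) eq)) p)))
      where
      eq₀ : suc (m ∸ suc (suc i)) ≡ m ∸ suc i
      eq₀ = sym (+-∸-assoc 1 i<m)
      lt : suc (m ∸ suc (suc i)) ≤ m
      lt = subst (_≤ m) (sym eq₀) (m∸n≤m m (suc i))
      eq : m ∸ suc (m ∸ suc (suc i)) ≡ suc i
      eq = trans (cong (m ∸_) eq₀) (m∸[m∸n]≡n (<⇒≤ i<m))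
      bound : m ∸ suc (suc i) < q
      bound = s≤s⁻¹ (subst₂ _<_ (sym eq₀) m∸q (∸-monoʳ-< (≰⇒> i>q) (<⇒≤ i<m)))

    place : ∀ {φ} → Valid φ → Place φ
    place vφ = go (cover-sides period vφ)
      where
      go : ∀ {φ} → (∃ λ i → i < m × (iter K i φ₀ ∥ φ ⊎ U (iter K i φ₀) ∥ φ)) → Place φ
      go (i , i<m , inj₁ p) = place-K i<m p
      go (i , i<m , inj₂ p) = place-K {m ∸ suc i} (∸-monoʳ-< {m} {suc i} {0} (s≤s z≤n) i<m) (∥-trans (∥-sym (U-K period i<m)) p)

    connected : ∀ {φ} → Valid φ → φ₀ ~ φ
    connected vφ = go (place vφ)
      where
      go : ∀ {φ} → Place φ → φ₀ ~ φ
      go (bottom-row p) = Bottom.from-side p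
      go (top-row p)    = ~-trans top-connected (Top.from-side p)
      go (stack s)      = stack-connected s

    hamiltonian : Hamiltonian G
    hamiltonian = Cyclic.hamiltonian v₀ connected cover

  hamiltonian : Hamiltonian G
  hamiltonian = choose side-period
    where
    choose : (∃ λ n → φ₀ ∥ iter K (suc n) φ₀ × (∀ k → 0 < k → k < suc n → ¬ φ₀ ∥ iter K k φ₀)) → Hamiltonian G
    choose (n , period , minimal) = split (halve (suc n))
      where
      split : (∃ λ q → suc n ≡ q + q ⊎ suc n ≡ suc (q + q)) → Hamiltonian G
      split (q , inj₂ eq) = ⊥-elim (odd-period q (subst (λ k → φ₀ ∥ iter K k φ₀) eq period))
      split (suc q , inj₁ eq) = Even.hamiltonian q (subst (λ k → φ₀ ∥ iter K k φ₀) eq period)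
        (λ k 0<k k<m → minimal k 0<k (subst (k <_) (sym eq) k<m))

-- A cyclic sequence of two-sided rows

module NoEnds {G : Graph} (R : Rows G) {φ₀ : Rows.Frame R} (v₀ : Rows.Valid R φ₀)
  (star : ∀ u v → Star (Graph.Adj G) u v)
  (¬U-end : ∀ i → ¬ Ends.U-end R (iter (Ends.K R) i φ₀))
  (¬E-end : ∀ i → ¬ Ends.E-end R (Rows.U R (iter (Ends.K R) i φ₀))) where
  open Rows R
  open Finite finite
  open Ends R
  open Period v₀ star

  -- Folding the sequence of sides would create an end half-way.
  no-fold : ∀ i j → ¬ iter K i φ₀ ∥ U (iter K j φ₀)
  no-fold i j p = fold (j + i) (∥-trans (∥-reflexive (iter-+ K j i φ₀)) (∥-trans (∥-iter ∥-K j p)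
      (∥-reflexive (trans (cong (iter K j) (U-iterK j)) (iter-inverse K⁻ K KK⁻ j _)))))
    where
    fold : ∀ n → ¬ iter K n φ₀ ∥ U φ₀
    fold n p with halve n
    ... | l , inj₁ refl = ¬U-end l (∥-trans
      (∥-reflexive (trans (sym (iter-inverse K K⁻ K⁻K l _)) (cong (iter K⁻ l) (sym (iter-+ K l l φ₀)))))
      (∥-trans (∥-iter ∥-K⁻ l p) (∥-reflexive (sym (U-iterK l)))))
    ... | l , inj₂ refl = ¬E-end l (∥-sym (∥-trans (∥-trans ∥-ρ (∥-reflexive
        (trans (sym (iter-inverse K K⁻ K⁻K l _)) (cong (iter K⁻ l) (trans (sym (iter-+ K l (suc l) φ₀)) (cong (λ k → iter K k φ₀) (+-suc l l)))))))
      (∥-trans (∥-iter ∥-K⁻ l p) (∥-reflexive (sym (U-iterK l))))))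

  ⟶-iterK : ∀ n {φ ψ} → φ ⟶ ψ → iter K n φ ⟶ iter K n ψ
  ⟶-iterK = ⟶-iter ⟶-K

  -- Going once around the rows: g is Kᵐ, composed with ρ if the orientation
  -- is reversed.
  record Closing (m : ℕ) : Set where
    field
      g g⁻  : Frame → Frame
      g⁻g   : ∀ φ → g⁻ (g φ) ≡ φ
      g-K   : ∀ φ → g φ ≡ iter K m φ ⊎ g φ ≡ ρ (iter K m φ)
      g-⟶   : ∀ {φ ψ} → φ ⟶ ψ → g φ ⟶ g ψ
      g⁻-⟶  : ∀ {φ ψ} → φ ⟶ ψ → g⁻ φ ⟶ g⁻ ψ
      g-side : φ₀ ⟶ g φ₀
      -- The step along the row from `g φ` to the vertex at which the strand of `φ` arrives from the
      -- row before; its direction depends on whether `g` contains `ρ`.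
      across across⁻ : Frame → Frame
      across⁻-across : ∀ φ → across⁻ (across φ) ≡ φ
      across-across⁻ : ∀ φ → across (across⁻ φ) ≡ φ
      across-E : (∀ φ → across φ ≡ E φ × across⁻ φ ≡ E⁻ φ) ⊎ (∀ φ → across φ ≡ E⁻ φ × across⁻ φ ≡ E φ)
      across-g : ∀ {t} → m ≡ suc t → ∀ φ → across (g φ) ≡ U (iter K t φ) ⊎ across (g φ) ≡ ρ (U (iter K t φ))

    g-side′ : ∀ {ψ} → φ₀ ⟶ ψ → φ₀ ⟶ g ψ
    g-side′ p = ⟶-trans g-side (g-⟶ p)

    g⁻-side′ : ∀ {ψ} → φ₀ ⟶ ψ → φ₀ ⟶ g⁻ ψ
    g⁻-side′ p = ⟶-trans (⟶-sym (subst (g⁻ φ₀ ⟶_) (g⁻g φ₀) (g⁻-⟶ g-side))) (g⁻-⟶ p)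

  module EvenRows (m′ : ℕ) (l : ℕ) (m≡ : suc m′ ≡ 2 + 2 * l) (closing : Closing (suc m′))
    (period : φ₀ ∥ iter K (suc m′) φ₀)
    (minimal : ∀ k → 0 < k → k < suc m′ → ¬ φ₀ ∥ iter K k φ₀) where
    open Closing closing

    m : ℕ
    m = suc m′

    module 𝔾 = Permutation finite g g⁻ g⁻g

    P : Frame → Set
    P ψ = ∃ λ n → iter g n φ₀ ≡ ψ

    P-side : ∀ {ψ} → P ψ → φ₀ ⟶ ψ
    P-side (zero , refl)  = ⟶-refl
    P-side (suc n , refl) = g-side′ (P-side (n , refl))

    P-g : ∀ {ψ} → P ψ → P (g ψ)
    P-g (n , refl) = suc n , refl

    P-g⁻ : ∀ {ψ} → P ψ → ∃ λ χ → P χ × g χ ≡ ψ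
    P-g⁻ {ψ} (n , refl) with 𝔾.inverse-reach (iter g n φ₀)
    ... | k , e = g⁻ ψ , (k + n , trans (iter-+ g k n φ₀) e) , 𝔾.fg ψ

    sides : ∀ {i j} → i < m → j < m → ¬ iter K (suc i) φ₀ ∥ U (iter K j φ₀)
    sides {i} {j} _ _ = no-fold (suc i) j

    open Stack R m P (𝔾.reach? φ₀) P-side minimal sides

    top-stacked : ∀ {ψ} → P ψ → Stacked (iter K m ψ)
    top-stacked {ψ} p = m′ , ψ , n<1+n m′ , p , inj₁ refl

    bottom : ∀ {ψ} → P ψ → Boundary.Cut± None ψ
    bottom p with P-g⁻ p
    ... | χ , pχ , refl with g-K χ
    ... | inj₁ e = inj₁ (inj₁ (subst Stacked (sym e) (top-stacked pχ)))
    ... | inj₂ e = inj₂ (inj₁ (subst Stacked (trans (sym (ρρ _)) (cong ρ (sym e))) (top-stacked pχ)))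

    U-closing : ∀ ψ → U (iter K m ψ) ≡ U (g ψ) ⊎ ρ (U (iter K m ψ)) ≡ U (g ψ)
    U-closing ψ = Sum.map (λ e → cong U (sym e)) (λ e → trans (sym (Uρ _)) (cong U (sym e))) (g-K ψ)

    top : ∀ {ψ} → P ψ → Boundary.Cut± None (U (iter K m ψ))
    top {ψ} p = Sum.map (λ e → inj₁ (again e)) (λ e → inj₁ (again e)) (U-closing ψ)
      where
      again : ∀ {φ} → φ ≡ U (g ψ) → Stacked φ
      again refl = 0 , g ψ , s≤s z≤n , P-g p , inj₂ refl

    open Extend None none? ⊥-elim ⊥-elim ⊥-elim ⊥-elim bottom top

    base-P : P φ₀
    base-P = 0 , refl

    -- With an even number of rows, climbing in twos passes through all of them and arrives on the
    -- same strand, one turn further on. This links the members of the orbit successively.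
    around : ∀ {ψ} → P ψ → U ψ ~ U (g ψ)
    around {ψ} p = ~-trans (climb base-P l (≤-reflexive (sym m≡)) p)
      (~-trans (~-reflexive (cong (λ k → iter K k ψ) (sym m≡)))
      (~-trans (~-U (inj₁ (top-stacked p)))
        ([ ~-reflexive , (λ e → ~-trans ~-ρ (~-reflexive e)) ]′ (U-closing ψ))))

    bottom-connected : ∀ {ψ} → P ψ → φ₀ ~ U ψ
    bottom-connected (zero , refl)  = ~-U± (bottom base-P)
    bottom-connected (suc n , refl) = ~-trans (bottom-connected (n , refl)) (around (n , refl))

    valid-in-stack : ∀ {φ} → Valid φ → InStack φ
    valid-in-stack vφ with cover-sides period vφ
    ... | zero  , _ , inj₁ p   = m′ , n<1+n m′ , inj₁ (∥-trans (∥-sym period) p)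
    ... | suc i , i<m , inj₁ p = i , <-trans (n<1+n i) i<m , inj₁ p
    ... | i , i<m , inj₂ p     = i , i<m , inj₂ p

    connected : ∀ {φ} → Valid φ → φ₀ ~ φ
    connected {φ} vφ = from (in-stack base-P (valid-in-stack vφ))
      where
      from : (∃ λ ψ → P ψ × φ ~ U ψ) → φ₀ ~ φ
      from (ψ , p , e) = ~-trans (bottom-connected p) (~-sym e)

    hamiltonian : Hamiltonian G
    hamiltonian = Cyclic.hamiltonian v₀ connected cover

  ρ-iterK⁻ : ∀ m φ → iter K⁻ m (ρ (ρ (iter K m φ))) ≡ φ
  ρ-iterK⁻ m φ = trans (cong (iter K⁻ m) (ρρ _)) (iter-inverse K K⁻ K⁻K m φ)

  closing : ∀ {m} → φ₀ ∥ iter K m φ₀ → Closing m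
  closing {m} (inj₁ p) = record
    { g = iter K m ; g⁻ = iter K⁻ m ; g⁻g = iter-inverse K K⁻ K⁻K m ; g-K = λ _ → inj₁ refl
    ; g-⟶ = ⟶-iterK m ; g⁻-⟶ = ⟶-iter ⟶-K⁻ m ; g-side = p
    ; across = E ; across⁻ = E⁻ ; across⁻-across = E⁻E ; across-across⁻ = EE⁻ ; across-E = inj₁ (λ _ → refl , refl)
    ; across-g = λ { refl φ → inj₂ (EρE _) } }
  closing {m} (inj₂ p) = record
    { g = ρ ∘ iter K m ; g⁻ = iter K⁻ m ∘ ρ ; g⁻g = ρ-iterK⁻ m ; g-K = λ _ → inj₂ refl
    ; g-⟶ = ⟶-ρ ∘ ⟶-iterK m ; g⁻-⟶ = ⟶-iter ⟶-K⁻ m ∘ ⟶-ρ ; g-side = p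
    ; across = E⁻ ; across⁻ = E ; across⁻-across = EE⁻ ; across-across⁻ = E⁻E ; across-E = inj₂ (λ _ → refl , refl)
    ; across-g = λ { refl φ → inj₁ (trans (cong (ρ ∘ E) (ρρ _)) (trans (cong ρ (EρE _)) (ρρ _))) } }

  module OddRows (t : ℕ) (t-even : t ≡ 0 ⊎ ∃ λ l → t ≡ 2 + 2 * l) (closing : Closing (suc t))
    (period : φ₀ ∥ iter K (suc t) φ₀)
    (minimal : ∀ k → 0 < k → k < suc t → ¬ φ₀ ∥ iter K k φ₀) where
    open Closing closing

    module 𝔾 = Permutation finite g g⁻ g⁻g
    module 𝔼 = Permutation finite E E⁻ E⁻E

    -- One orientation of the row of `φ₀`: by `on-ρ` no frame occurs together with its reversal, so
    -- these frames stand for the vertices.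
    On : Frame → Set
    On φ = ∃ λ n → iter E n φ₀ ≡ φ

    on-E : ∀ {φ} → On φ → On (E φ)
    on-E (n , refl) = suc n , refl

    on-E⁻ : ∀ {φ} → On φ → On (E⁻ φ)
    on-E⁻ (n , refl) with 𝔼.inverse-reach (iter E n φ₀)
    ... | k , e = k + n , trans (iter-+ E k n φ₀) e

    Up : Frame → Set
    Up φ = φ₀ ⟶ φ

    up? : ∀ φ → Dec (Up φ)
    up? = φ₀ ⟶?_

    up⇒on : ∀ {φ} → Up φ → On φ
    up⇒on (n , refl) = n + n , trans (iter-+ E n n φ₀) (sym (iter-A-E n φ₀))

    on⇒up : ∀ {φ} → On φ → Up φ ⊎ Up (E⁻ φ)
    on⇒up (n , refl) with halve n
    ... | l , inj₁ refl = inj₁ (l , trans (iter-A-E l φ₀) (sym (iter-+ E l l φ₀)))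
    ... | l , inj₂ refl = inj₂ (l , trans (trans (iter-A-E l φ₀) (sym (iter-+ E l l φ₀))) (sym (E⁻E _)))

    Eφ₀-side : E φ₀ ∥ U (iter K t φ₀)
    Eφ₀-side = ∥-trans (∥-E period) (∥-trans (∥-reflexive (EρE _)) (∥-sym ∥-ρ))

    two-sided : ∀ {φ} → Up φ → ¬ Up (E φ)
    two-sided p p′ = no-fold 0 t (∥-trans (inj₁ p′) (∥-trans (∥-sym (inj₁ (⟶-E p))) Eφ₀-side))

    not-up : ∀ {φ} → Up (E⁻ φ) → ¬ Up φ
    not-up p p′ = two-sided p (subst Up (sym (EE⁻ _)) p′)

    down-up : ∀ {φ} → On φ → ¬ Up φ → Up (E⁻ φ)
    down-up o ¬p = [ (λ p → contradiction p ¬p) , (λ p → p) ]′ (on⇒up o)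

    on-ρ : ∀ {φ} → On φ → ¬ On (ρ φ)
    on-ρ (n , refl) (m , e) with 𝔼.reach-sym n refl
    ... | k , e′ with halve (m + k)
    ... | l , inj₁ eq = A-ρ-free l (iter E n φ₀) (trans (iter-A-E l _) (trans (sym (iter-+ E l l _))
          (trans (cong (λ j → iter E j (iter E n φ₀)) (sym eq)) (trans (iter-+ E m k _) (trans (cong (iter E m) e′) e)))))
    ... | l , inj₂ eq with 𝔸.iter-inverse-reach l (iter A l (iter E n φ₀))
    ... | j , e″ = E-free j (iter A l (iter E n φ₀)) (trans
          (trans (cong E (trans (iter-A-E l _) (sym (iter-+ E l l _))))
            (trans (cong (λ j → iter E j (iter E n φ₀)) (sym eq)) (trans (iter-+ E m k _) (trans (cong (iter E m) e′) e))))
          (cong ρ (sym (trans e″ (iter-inverse A A⁻ A⁻A l _)))))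

    across-on : ∀ {φ} → On φ → On (across φ)
    across-on {φ} o with across-E
    ... | inj₁ h = subst On (sym (proj₁ (h φ))) (on-E o)
    ... | inj₂ h = subst On (sym (proj₁ (h φ))) (on-E⁻ o)

    across-down : ∀ {φ} → Up φ → ¬ Up (across φ)
    across-down {φ} p p′ with across-E
    ... | inj₁ h = two-sided p (subst Up (proj₁ (h φ)) p′)
    ... | inj₂ h = not-up (subst Up (proj₁ (h φ)) p′) p

    across⁻-up : ∀ {φ} → On φ → ¬ Up φ → Up (across⁻ φ)
    across⁻-up {φ} o ¬p with across-E
    ... | inj₁ h = subst Up (sym (proj₂ (h φ))) (down-up o ¬p)
    ... | inj₂ h = subst Up (trans (cong E (EE⁻ φ)) (sym (proj₂ (h φ)))) (⟶-trans (down-up o ¬p) ⟶-A)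

    -- The chord of a vertex: from an upward frame along its strand through the other `t` rows, to
    -- where the strand comes back to the row from below. Downward frames take the inverse way.
    opposite : Frame → Frame
    opposite φ with up? φ
    ... | yes _ = across (g φ)
    ... | no _  = g⁻ (across⁻ φ)

    opposite-up : ∀ {φ} → Up φ → opposite φ ≡ across (g φ)
    opposite-up {φ} p with up? φ
    ... | yes _ = refl
    ... | no ¬p = contradiction p ¬p

    opposite-down : ∀ {φ} → ¬ Up φ → opposite φ ≡ g⁻ (across⁻ φ)
    opposite-down {φ} ¬p with up? φ
    ... | yes p = contradiction p ¬p
    ... | no _  = refl

    up-opposite : ∀ {φ} → On φ → ¬ Up φ → Up (opposite φ)
    up-opposite o ¬p = subst Up (sym (opposite-down ¬p)) (g⁻-side′ (across⁻-up o ¬p))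

    opposite-on : ∀ {φ} → On φ → On (opposite φ)
    opposite-on {φ} o with up? φ
    ... | yes p = across-on (up⇒on (g-side′ p))
    ... | no ¬p = up⇒on (g⁻-side′ (across⁻-up o ¬p))

    opposite-involutive : ∀ {φ} → On φ → opposite (opposite φ) ≡ φ
    opposite-involutive {φ} o with up? φ
    ... | yes p = trans (opposite-down (across-down (g-side′ p)))
                        (trans (cong g⁻ (across⁻-across _)) (g⁻g φ))
    ... | no ¬p = trans (opposite-up (g⁻-side′ (across⁻-up o ¬p)))
                        (trans (cong across (𝔾.fg _)) (across-across⁻ φ))

    opposite-free : ∀ {φ} → On φ → opposite φ ≢ φ
    opposite-free {φ} o e with up? φ
    ... | yes p = across-down (g-side′ p) (subst Up (sym e) p)
    ... | no ¬p = ¬p (subst Up e (g⁻-side′ (across⁻-up o ¬p)))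

    record RowVertex : Set where
      constructor at
      field
        frame : Frame
        .on   : On frame
    open RowVertex

    row-≡ : ∀ {x y} → frame x ≡ frame y → x ≡ y
    row-≡ refl = refl

    frame-on : ∀ x → On (frame x)
    frame-on (at φ o) = recompute (𝔼.reach? φ₀ φ) o

    row-finite : Finite RowVertex
    row-finite = record { size = size ; code = code ∘ frame ; code-injective = row-≡ ∘ code-injective }

    s s⁻ χ : RowVertex → RowVertex
    s  (at φ o) = at (E φ) (on-E o)
    s⁻ (at φ o) = at (E⁻ φ) (on-E⁻ o)
    χ  (at φ o) = at (opposite φ) (opposite-on o)

    x₀ : RowVertex
    x₀ = at φ₀ (0 , refl)

    frame-iter : ∀ n → frame (iter s n x₀) ≡ iter E n φ₀
    frame-iter zero    = refl
    frame-iter (suc n) = cong E (frame-iter n)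

    χ-involutive : ∀ x → χ (χ x) ≡ x
    χ-involutive x = row-≡ (opposite-involutive (frame-on x))

    χ-free : ∀ x → χ x ≢ x
    χ-free x e = opposite-free (frame-on x) (cong frame e)

    row-reach : ∀ x → ∃ λ n → iter s n x₀ ≡ x
    row-reach x = let (n , e) = frame-on x in n , row-≡ (trans (frame-iter n) e)

    s⁻s : ∀ x → s⁻ (s x) ≡ x
    s⁻s x = row-≡ (E⁻E (frame x))

    open Chords row-finite s s⁻ χ s⁻s χ-involutive χ-free x₀ row-reach

    open SecondCycle second-cycle renaming (connected to row-connected)

    X : Frame → Set
    X φ = ∃ λ x → Removed x × Edge (frame x) φ

    removed-at? : ∀ φ → Dec (∃ λ x → Removed x × φ ≡ frame x)
    removed-at? φ = decide (𝔼.reach? φ₀ φ)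
      where
      decide : Dec (On φ) → Dec (∃ λ x → Removed x × φ ≡ frame x)
      decide (no ¬o) = no λ (x , _ , e) → ¬o (subst On (sym e) (frame-on x))
      decide (yes o) = Dec.map′ (λ r → at φ o , r , refl) (λ (x , r , e) → subst Removed (row-≡ (sym e)) r) (removed? (at φ o))

    X? : ∀ φ → Dec (X φ)
    X? φ = Dec.map′
      (λ { (inj₁ (x , r , e)) → x , r , inj₁ e
         ; (inj₂ (x , r , e)) → x , r , inj₂ (trans (sym (ρE-involutive φ)) (cong (ρ ∘ E) e)) })
      (λ { (x , r , inj₁ e) → inj₁ (x , r , e)
         ; (x , r , inj₂ e) → inj₂ (x , r , trans (cong (ρ ∘ E) e) (ρE-involutive _)) })
      (removed-at? φ ⊎-dec removed-at? (ρ (E φ)))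

    X-ρ : ∀ {φ} → X φ → ¬ X (ρ φ)
    X-ρ (x , r , inj₁ refl) (y , r′ , inj₁ e) = on-ρ (frame-on x) (subst On (sym e) (frame-on y))
    X-ρ (x , r , inj₁ refl) (y , r′ , inj₂ e) = exclusive r (subst Removed (row-≡ (trans (sym (E⁻E _)) (cong E⁻ (sym
      (trans (sym (ρρ _)) (trans (cong ρ e) (ρρ _))))))) r′)
    X-ρ (x , r , inj₂ refl) (y , r′ , inj₁ e) = exclusive r′ (subst Removed (row-≡ (trans (sym (E⁻E _)) (cong E⁻
      (trans (sym (ρρ _)) e)))) r)
    X-ρ (x , r , inj₂ refl) (y , r′ , inj₂ e) = on-ρ (on-E (frame-on y)) (subst On (trans (sym (ρρ _)) e) (on-E (frame-on x)))

    P : Frame → Set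
    P ψ = ∃ λ x → Used x × ψ ≡ frame x × Up ψ

    P? : ∀ ψ → Dec (P ψ)
    P? ψ = decide (up? ψ)
      where
      decide : Dec (Up ψ) → Dec (P ψ)
      decide (no ¬p) = no λ (x , _ , _ , p) → ¬p p
      decide (yes p) = Dec.map′ (λ u → at ψ (up⇒on p) , u , refl , p) (λ (x , u , e , _) → subst Used (row-≡ (sym e)) u)
                         (removed? (at ψ (up⇒on p)) ⊎-dec removed? (s⁻ (at ψ (up⇒on p))))

    P-up : ∀ {ψ} → P ψ → Up ψ
    P-up (_ , _ , _ , p) = p

    levels : ∀ d → 0 < d → d < t → ¬ φ₀ ∥ iter K d φ₀
    levels d 0<d d<t = minimal d 0<d (m<n⇒m<1+n d<t)

    sides : ∀ {i j} → i < t → j < t → ¬ iter K (suc i) φ₀ ∥ U (iter K j φ₀)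
    sides {i} {j} _ _ = no-fold (suc i) j

    open Stack R t P P? P-up levels sides

    row-out : ∀ {φ} → On φ → ¬ InStack φ
    row-out o (i , i<t , r) with on⇒up o | r
    ... | inj₁ p | inj₁ r = minimal (suc i) (s≤s z≤n) (s≤s i<t) (∥-trans (inj₁ p) (∥-sym r))
    ... | inj₁ p | inj₂ r = no-fold 0 i (∥-trans (inj₁ p) (∥-sym r))
    ... | inj₂ p | inj₁ r = no-fold (suc i) t (∥-trans r (∥-trans (∥-sym (∥-trans (inj₁ (⟶-E p)) (∥-reflexive (EE⁻ _)))) Eφ₀-side))
    ... | inj₂ p | inj₂ r = minimal (t ∸ i) (m<n⇒0<n∸m i<t) (s≤s (m∸n≤m t i)) (∥-K-difference (<⇒≤ i<t)
          (subst₂ _∥_ (UU _) (UU _) (∥-U (∥-trans r (∥-trans (∥-sym (∥-trans (inj₁ (⟶-E p)) (∥-reflexive (EE⁻ _)))) Eφ₀-side)))))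

    X-out : ∀ {φ} → X φ → ¬ InStack φ
    X-out (x , r , inj₁ refl) = row-out (frame-on x)
    X-out (x , r , inj₂ refl) = row-out (on-E (frame-on x)) ∘ in-ρ

    open Boundary X

    used-cut : ∀ {x} → Used x → Cut± (frame x)
    used-cut {x} (inj₁ r) = inj₁ (inj₂ (x , r , inj₁ refl))
    used-cut {x} (inj₂ r) = inj₂ (inj₂ (s⁻ x , r , inj₂ (cong ρ (sym (EE⁻ _)))))

    bottom : ∀ {ψ} → P ψ → Cut± ψ
    bottom (x , u , refl , _) = used-cut u

    opposite-frame : ∀ {φ} → Up φ → opposite φ ≡ U (iter K t φ) ⊎ opposite φ ≡ ρ (U (iter K t φ))
    opposite-frame {φ} p = Sum.map (trans (opposite-up p)) (trans (opposite-up p)) (across-g refl φ)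

    top : ∀ {ψ} → P ψ → Cut± (U (iter K t ψ))
    top {ψ} (x , u , refl , p) = move (opposite-frame p)
      where
      move : opposite ψ ≡ U (iter K t ψ) ⊎ opposite ψ ≡ ρ (U (iter K t ψ)) → Cut± (U (iter K t ψ))
      move (inj₁ e) = subst Cut± e (used-cut (used-χ u))
      move (inj₂ e) = subst Cut± (ρρ _) (cut±-ρ (subst Cut± e (used-cut (used-χ u))))

    used-U : ∀ {x} → Used x → Cut± (U (frame x))
    used-U {x} u = choose (up? (frame x))
      where
      choose : Dec (Up (frame x)) → Cut± (U (frame x))
      choose (yes p) = above bottom top (x , u , refl , p)
      choose (no ¬p) = back (opposite-frame p′)
        where
        p′ : Up (opposite (frame x))
        p′ = up-opposite (frame-on x) ¬p
        pχ : P (opposite (frame x))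
        pχ = χ x , used-χ u , refl , p′
        back : opposite (opposite (frame x)) ≡ U (iter K t (opposite (frame x)))
             ⊎ opposite (opposite (frame x)) ≡ ρ (U (iter K t (opposite (frame x)))) → Cut± (U (frame x))
        back (inj₁ e) = subst Cut± (trans (sym (UU _)) (cong U (trans (sym e) (opposite-involutive (frame-on x))))) (below bottom top pχ)
        back (inj₂ e) = subst Cut± (trans (cong ρ (sym (UU _))) (trans (sym (Uρ _)) (cong U (trans (sym e) (opposite-involutive (frame-on x))))))
                          (cut±-ρ (below bottom top pχ))

    X-U : ∀ {φ} → X φ → Cut± (U φ)
    X-U (x , r , inj₁ refl) = used-U (inj₁ r)
    X-U (x , r , inj₂ refl) = subst Cut± (sym (Uρ _))
      (cut±-ρ (used-U {s x} (inj₂ (subst Removed (row-≡ (sym (E⁻E _))) r))))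

    X-E : ∀ {φ} → X φ → X (ρ (E φ))
    X-E (x , r , e) = x , r , edge-E e

    open Extend X X? X-E X-ρ X-out X-U bottom top

    -- Here `t` has to be even: the 2-factor then follows the strand to its top, so a used chord
    -- stands for an actual path between its ends.
    through : ∀ {ψ} → P ψ → ψ ~ U (iter K t ψ)
    through {ψ} p = ~-trans (~-U± (bottom p)) (go t-even)
      where
      go : t ≡ 0 ⊎ (∃ λ l → t ≡ 2 + 2 * l) → U ψ ~ U (iter K t ψ)
      go (inj₁ e) = ~-reflexive (cong (λ k → U (iter K k ψ)) (sym e))
      go (inj₂ (l , e)) = ~-trans (climb p l (≤-reflexive (sym e)) p)
        (~-trans (~-reflexive (cong (λ k → iter K k ψ) (sym e))) (~-U± (below bottom top p)))

    chord-connected : ∀ x → Used x → frame x ~ frame (χ x)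
    chord-connected x u = choose (up? (frame x))
      where
      upward : ∀ y → Used y → Up (frame y) → frame y ~ frame (χ y)
      upward y u p = ~-trans (through (y , u , refl , p))
        ([ (λ e → ~-reflexive (sym e)) , (λ e → ~-trans ~-ρ (~-reflexive (sym e))) ]′ (opposite-frame p))
      choose : Dec (Up (frame x)) → frame x ~ frame (χ x)
      choose (yes p) = upward x u p
      choose (no ¬p) = ~-sym (~-trans (upward (χ x) (used-χ u) (up-opposite (frame-on x) ¬p))
                                      (~-reflexive (opposite-involutive (frame-on x))))

    edge-connected : ∀ x → ¬ Removed x → frame x ~ E (frame x)
    edge-connected x ¬r = ~-E λ
      { (inj₁ st) → row-out (frame-on x) (stacked⇒in st)
      ; (inj₂ (y , r , inj₁ e)) → ¬r (subst Removed (row-≡ (sym e)) r)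
      ; (inj₂ (y , r , inj₂ e)) → on-ρ (frame-on x) (subst On (trans (sym (ρρ _)) (cong ρ (sym e))) (on-E (frame-on y))) }

    on-connected : ∀ {φ} → On φ → φ₀ ~ φ
    on-connected {φ} o = row-connected (λ x y → frame x ~ frame y) ~-refl ~-sym ~-trans
      edge-connected chord-connected x₀ (at φ o)

    -- The rows of the stack are connected to the first row only through strands. This is why the
    -- second cycle has to contain a chord.
    some-P : ∃ P
    some-P = choose (up? (frame x))
      where
      x : RowVertex
      x = proj₁ some-used
      u : Used x
      u = proj₂ some-used
      choose : Dec (Up (frame x)) → ∃ P
      choose (yes p) = frame x , x , u , refl , p
      choose (no ¬p) = opposite (frame x) , χ x , used-χ u , refl , up-opposite (frame-on x) ¬p

    stack-connected : ∀ {φ} → InStack φ → φ₀ ~ φ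
    stack-connected {φ} i = from (in-stack (proj₂ some-P) i)
      where
      from : (∃ λ ψ → P ψ × φ ~ U ψ) → φ₀ ~ φ
      from (ψ , p , e) = ~-trans (on-connected (up⇒on (P-up p))) (~-trans (~-U± (bottom p)) (~-sym e))

    side-connected : ∀ {φ} → φ₀ ∥ φ ⊎ E φ₀ ∥ φ → φ₀ ~ φ
    side-connected (inj₁ (inj₁ p)) = on-connected (up⇒on p)
    side-connected (inj₁ (inj₂ p)) = ~-trans (on-connected (up⇒on p)) (~-sym ~-ρ)
    side-connected (inj₂ (inj₁ p)) = on-connected (from-E p)
      where
      from-E : ∀ {φ} → E φ₀ ⟶ φ → On φ
      from-E p = subst On (EE⁻ _) (on-E (up⇒on (subst (_⟶ _) (E⁻E φ₀) (⟶-cong {E⁻} (inj₁ λ _ → trans (E⁻E _) (sym (cong E (EE⁻ _)))) p))))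
    side-connected (inj₂ (inj₂ p)) = ~-trans (side-connected (inj₂ (inj₁ p))) (~-sym ~-ρ)

    connected : ∀ {φ} → Valid φ → φ₀ ~ φ
    connected vφ = place (cover-sides period vφ)
      where
      upper : ∀ {φ} i → i < t ⊎ i ≡ t → U (iter K i φ₀) ∥ φ → φ₀ ~ φ
      upper i (inj₁ i<t) p = stack-connected (i , i<t , inj₂ p)
      upper {φ} i (inj₂ e) p = side-connected (inj₂ (∥-trans Eφ₀-side (subst (λ k → U (iter K k φ₀) ∥ φ) e p)))
      place : ∀ {φ} → (∃ λ i → i < suc t × (iter K i φ₀ ∥ φ ⊎ U (iter K i φ₀) ∥ φ)) → φ₀ ~ φ
      place (zero  , _ , inj₁ p)   = side-connected (inj₁ p)
      place (suc i , i<t , inj₁ p) = stack-connected (i , s≤s⁻¹ i<t , inj₁ p)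
      place (i , i<t , inj₂ p)     = upper i (m≤n⇒m<n∨m≡n (s≤s⁻¹ i<t)) p

    hamiltonian : Hamiltonian G
    hamiltonian = Cyclic.hamiltonian v₀ connected cover

  double : ∀ q → q + q ≡ 0 ⊎ ∃ λ l → q + q ≡ 2 + 2 * l
  double zero    = inj₁ refl
  double (suc q) = inj₂ (q , cong suc (trans (+-suc q q) (cong (λ k → suc (q + k)) (sym (+-identityʳ q)))))

  hamiltonian : Hamiltonian G
  hamiltonian = choose side-period
    where
    choose : (∃ λ n → φ₀ ∥ iter K (suc n) φ₀ × (∀ k → 0 < k → k < suc n → ¬ φ₀ ∥ iter K k φ₀)) → Hamiltonian G
    choose (n , period , minimal) = split (halve (suc n))
      where
      even : ∀ {k} → suc n ≡ k → k ≡ 0 ⊎ (∃ λ l → k ≡ 2 + 2 * l) → Hamiltonian G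
      even refl (inj₁ ())
      even refl (inj₂ (l , e)) = EvenRows.hamiltonian n l e (closing period) period minimal
      split : (∃ λ q → suc n ≡ q + q ⊎ suc n ≡ suc (q + q)) → Hamiltonian G
      split (q , inj₁ e) = even e (double q)
      split (q , inj₂ e) = OddRows.hamiltonian n
        (subst (λ k → k ≡ 0 ⊎ ∃ λ l → k ≡ 2 + 2 * l) (sym (suc-injective e)) (double q)) (closing period) period minimal

-- The flags of a 6-cycle double cover

module _ {A : Set} {P : Pred A 0ℓ} (P? : Decidable P) where

  filter-none : ∀ xs → length (filter P? xs) ≡ 0 → ∀ i → ¬ P (lookup xs i)
  filter-none (x ∷ xs) e i p with P? x
  filter-none (x ∷ xs) () i p | yes _
  filter-none (x ∷ xs) e zero p | no ¬p = ¬p p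
  filter-none (x ∷ xs) e (suc i) p | no ¬p = filter-none xs e i p

  filter-one : ∀ xs → length (filter P? xs) ≡ 1 →
               ∃ λ i → P (lookup xs i) × (∀ j → P (lookup xs j) → j ≡ i)
  filter-one (x ∷ xs) e with P? x
  ... | yes p = zero , p , λ { zero _ → refl ; (suc j) q → contradiction q (filter-none xs (suc-injective e) j) }
  ... | no ¬p with filter-one xs e
  ... | i , p , only = suc i , p , λ { zero q → contradiction q ¬p ; (suc j) q → cong suc (only j q) }

  filter-two : ∀ xs → length (filter P? xs) ≡ 2 →
               ∃₂ λ i j → i ≢ j × P (lookup xs i) × P (lookup xs j) ×
                          (∀ k → P (lookup xs k) → k ≡ i ⊎ k ≡ j)
  filter-two (x ∷ xs) e with P? x
  ... | yes p with filter-one xs (suc-injective e)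
  ... | j , q , only = zero , suc j , (λ ()) , p , q ,
        λ { zero _ → inj₁ refl ; (suc k) r → inj₂ (cong suc (only k r)) }
  filter-two (x ∷ xs) e | no ¬p with filter-two xs e
  ... | i , j , i≢j , p , q , only = suc i , suc j , i≢j ∘ Finₚ.suc-injective , p , q ,
        λ { zero r → contradiction r ¬p ; (suc k) r → Sum.map (cong suc) (cong suc) (only k r) }

module _ {A : Set} where

  three : ∀ {l : List A} {a b} → length l ≡ 3 → Unique l → a ∈ l → b ∈ l → a ≢ b →
          ∃ λ c → c ∈ l × c ≢ a × c ≢ b × (∀ {d} → d ∈ l → d ≡ a ⊎ d ≡ b ⊎ d ≡ c)
  three {x ∷ y ∷ z ∷ []} refl ((x≢y ∷ x≢z ∷ []) ∷ (y≢z ∷ []) ∷ [] ∷ []) = cases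
    where
    split : ∀ {d} → d ∈ x ∷ y ∷ z ∷ [] → d ≡ x ⊎ d ≡ y ⊎ d ≡ z
    split (here e)                 = inj₁ e
    split (there (here e))         = inj₂ (inj₁ e)
    split (there (there (here e))) = inj₂ (inj₂ e)
    cases : ∀ {a b} → a ∈ x ∷ y ∷ z ∷ [] → b ∈ x ∷ y ∷ z ∷ [] → a ≢ b →
            ∃ λ c → c ∈ x ∷ y ∷ z ∷ [] × c ≢ a × c ≢ b × (∀ {d} → d ∈ x ∷ y ∷ z ∷ [] → d ≡ a ⊎ d ≡ b ⊎ d ≡ c)
    cases (here refl) (here refl) a≢b = contradiction refl a≢b
    cases (there (here refl)) (there (here refl)) a≢b = contradiction refl a≢b
    cases (there (there (here refl))) (there (there (here refl))) a≢b = contradiction refl a≢b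
    cases (here refl) (there (here refl)) _ =
      z , there (there (here refl)) , x≢z ∘ sym , y≢z ∘ sym , split
    cases (there (here refl)) (here refl) _ =
      z , there (there (here refl)) , y≢z ∘ sym , x≢z ∘ sym , [ inj₂ ∘ inj₁ , [ inj₁ , inj₂ ∘ inj₂ ]′ ]′ ∘ split
    cases (here refl) (there (there (here refl))) _ =
      y , there (here refl) , x≢y ∘ sym , y≢z , [ inj₁ , [ inj₂ ∘ inj₂ , inj₂ ∘ inj₁ ]′ ]′ ∘ split
    cases (there (there (here refl))) (here refl) _ =
      y , there (here refl) , y≢z , x≢y ∘ sym , [ inj₂ ∘ inj₁ , [ inj₂ ∘ inj₂ , inj₁ ]′ ]′ ∘ split
    cases (there (here refl)) (there (there (here refl))) _ =
      x , here refl , x≢y , x≢z , [ inj₂ ∘ inj₂ , [ inj₁ , inj₂ ∘ inj₁ ]′ ]′ ∘ split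
    cases (there (there (here refl))) (there (here refl)) _ =
      x , here refl , x≢z , x≢y , [ inj₂ ∘ inj₂ , [ inj₂ ∘ inj₁ , inj₁ ]′ ]′ ∘ split

next₆ prev₆ : Fin 6 → Fin 6
next₆ 0F = 1F
next₆ 1F = 2F
next₆ 2F = 3F
next₆ 3F = 4F
next₆ 4F = 5F
next₆ 5F = 0F
prev₆ 0F = 5F
prev₆ 1F = 0F
prev₆ 2F = 1F
prev₆ 3F = 2F
prev₆ 4F = 3F
prev₆ 5F = 4F

prev₆-next₆ : ∀ i → prev₆ (next₆ i) ≡ i
prev₆-next₆ 0F = refl
prev₆-next₆ 1F = refl
prev₆-next₆ 2F = refl
prev₆-next₆ 3F = refl
prev₆-next₆ 4F = refl
prev₆-next₆ 5F = refl

next₆-prev₆ : ∀ i → next₆ (prev₆ i) ≡ i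
next₆-prev₆ 0F = refl
next₆-prev₆ 1F = refl
next₆-prev₆ 2F = refl
next₆-prev₆ 3F = refl
next₆-prev₆ 4F = refl
next₆-prev₆ 5F = refl

next₆≢prev₆ : ∀ i → next₆ i ≢ prev₆ i
next₆≢prev₆ 0F ()
next₆≢prev₆ 1F ()
next₆≢prev₆ 2F ()
next₆≢prev₆ 3F ()
next₆≢prev₆ 4F ()
next₆≢prev₆ 5F ()

module Hexagon {A : Set} where

  corner : (l : List A) → length l ≡ 6 → Fin 6 → A
  corner (a ∷ b ∷ c ∷ d ∷ e ∷ f ∷ []) refl i = lookup (a ∷ b ∷ c ∷ d ∷ e ∷ f ∷ []) i

  corner-injective : ∀ l e → Unique l → ∀ {i j} → corner l e i ≡ corner l e j → i ≡ j
  corner-injective (a ∷ b ∷ c ∷ d ∷ e ∷ f ∷ []) refl u {i} {j} = injective u i j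
    where
    injective : ∀ {l : List A} → Unique l → ∀ i j → lookup l i ≡ lookup l j → i ≡ j
    injective (d ∷ u) zero    zero    e = refl
    injective (d ∷ u) zero    (suc j) e = contradiction e (All.lookup d (∈-lookup j))
    injective (d ∷ u) (suc i) zero    e = contradiction (sym e) (All.lookup d (∈-lookup i))
    injective (d ∷ u) (suc i) (suc j) e = cong suc (injective u i j e)

  corner-pair : ∀ l e i → (corner l e i , corner l e (next₆ i)) ∈ cyclicPairs l
  corner-pair (a ∷ b ∷ c ∷ d ∷ e ∷ f ∷ []) refl 0F = here refl
  corner-pair (a ∷ b ∷ c ∷ d ∷ e ∷ f ∷ []) refl 1F = there (here refl)
  corner-pair (a ∷ b ∷ c ∷ d ∷ e ∷ f ∷ []) refl 2F = there (there (here refl))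
  corner-pair (a ∷ b ∷ c ∷ d ∷ e ∷ f ∷ []) refl 3F = there (there (there (here refl)))
  corner-pair (a ∷ b ∷ c ∷ d ∷ e ∷ f ∷ []) refl 4F = there (there (there (there (here refl))))
  corner-pair (a ∷ b ∷ c ∷ d ∷ e ∷ f ∷ []) refl 5F = there (there (there (there (there (here refl)))))

  pair-corner : ∀ l e {u v} → (u , v) ∈ cyclicPairs l → ∃ λ i → corner l e i ≡ u × corner l e (next₆ i) ≡ v
  pair-corner (a ∷ b ∷ c ∷ d ∷ e ∷ f ∷ []) refl (here refl) = 0F , refl , refl
  pair-corner (a ∷ b ∷ c ∷ d ∷ e ∷ f ∷ []) refl (there (here refl)) = 1F , refl , refl
  pair-corner (a ∷ b ∷ c ∷ d ∷ e ∷ f ∷ []) refl (there (there (here refl))) = 2F , refl , refl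
  pair-corner (a ∷ b ∷ c ∷ d ∷ e ∷ f ∷ []) refl (there (there (there (here refl)))) = 3F , refl , refl
  pair-corner (a ∷ b ∷ c ∷ d ∷ e ∷ f ∷ []) refl (there (there (there (there (here refl))))) = 4F , refl , refl
  pair-corner (a ∷ b ∷ c ∷ d ∷ e ∷ f ∷ []) refl (there (there (there (there (there (here refl)))))) = 5F , refl , refl

module Flags (G : Graph) (cubic : Cubic G) (𝒞 : List (Cycle G)) (cdc : CycleDoubleCover G 𝒞)
             (six : All (λ C → cycleLength C ≡ 6) 𝒞) where
  open Graph G hiding (Vertex; degree) renaming (symmetric to adj-sym)
  open Hexagon

  Face : Set
  Face = Fin (length 𝒞)

  face : Face → Cycle G
  face = lookup 𝒞

  face-6 : ∀ k → length (vertices (face k)) ≡ 6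
  face-6 k = All.lookup six (∈-lookup k)

  point : Face → Fin 6 → Vertex G
  point k = corner (vertices (face k)) (face-6 k)

  point-injective : ∀ k {i j} → point k i ≡ point k j → i ≡ j
  point-injective k = corner-injective (vertices (face k)) (face-6 k) (Cycle.distinct (face k))

  point-pair : ∀ k i → (point k i , point k (next₆ i)) ∈ cyclicPairs (vertices (face k))
  point-pair k = corner-pair (vertices (face k)) (face-6 k)

  pair-point : ∀ k {u v} → (u , v) ∈ cyclicPairs (vertices (face k)) → ∃ λ i → point k i ≡ u × point k (next₆ i) ≡ v
  pair-point k = pair-corner (vertices (face k)) (face-6 k)

  -- A face is a position in the list, so a repeated cycle counts as two faces. The Boolean tells
  -- whether the edge of the flag leads to the next or to the previous corner.
  Flag : Set
  Flag = Face × Fin 6 × Bool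

  r₀ r₁ : Flag → Flag
  r₀ (k , i , true)  = k , next₆ i , false
  r₀ (k , i , false) = k , prev₆ i , true
  r₁ (k , i , b) = k , i , not b

  vert end opp : Flag → Vertex G
  vert (k , i , _) = point k i
  end φ = vert (r₀ φ)
  opp φ = end (r₁ φ)

  r₀-involutive : ∀ φ → r₀ (r₀ φ) ≡ φ
  r₀-involutive (k , i , true)  = cong (λ j → k , j , true) (prev₆-next₆ i)
  r₀-involutive (k , i , false) = cong (λ j → k , j , false) (next₆-prev₆ i)

  r₁-involutive : ∀ φ → r₁ (r₁ φ) ≡ φ
  r₁-involutive (k , i , true)  = refl
  r₁-involutive (k , i , false) = refl

  face-r₀ : ∀ φ → proj₁ (r₀ φ) ≡ proj₁ φ
  face-r₀ (k , i , true)  = refl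
  face-r₀ (k , i , false) = refl

  end≢opp : ∀ φ → end φ ≢ opp φ
  end≢opp (k , i , true) e = next₆≢prev₆ i (point-injective k e)
  end≢opp (k , i , false) e = next₆≢prev₆ i (sym (point-injective k e))

  adj-end : ∀ φ → Adj (vert φ) (end φ)
  adj-end (k , i , true)  = All.lookup (Cycle.adjacent (face k)) (point-pair k i)
  adj-end (k , i , false) = adj-sym (subst (λ j → Adj (point k (prev₆ i)) (point k j)) (next₆-prev₆ i)
                              (All.lookup (Cycle.adjacent (face k)) (point-pair k (prev₆ i))))

  edge-of : ∀ φ → EdgeOf (vert φ) (end φ) (face (proj₁ φ))
  edge-of (k , i , true)  = inj₁ (point-pair k i)
  edge-of (k , i , false) = inj₂ (subst (λ j → (point k (prev₆ i) , point k j) ∈ cyclicPairs (vertices (face k)))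
                                   (next₆-prev₆ i) (point-pair k (prev₆ i)))

  flag-of : ∀ {u v} k → EdgeOf u v (face k) → ∃ λ φ → proj₁ φ ≡ k × vert φ ≡ u × end φ ≡ v
  flag-of k (inj₁ m) with pair-point k m
  ... | i , e , e′ = (k , i , true) , refl , e , e′
  flag-of k (inj₂ m) with pair-point k m
  ... | i , e , e′ = (k , next₆ i , false) , refl , e′ , trans (cong (point k) (prev₆-next₆ i)) e

  flag-unique : ∀ φ ψ → proj₁ φ ≡ proj₁ ψ → vert φ ≡ vert ψ → end φ ≡ end ψ → φ ≡ ψ
  flag-unique (k , i , b) (k , j , b′) refl e e′
    with point-injective k e
  flag-unique (k , i , true)  (k , i , true)  refl e e′ | refl = refl
  flag-unique (k , i , false) (k , i , false) refl e e′ | refl = refl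
  flag-unique (k , i , true)  (k , i , false) refl e e′ | refl = contradiction e′ (end≢opp (k , i , true))
  flag-unique (k , i , false) (k , i , true)  refl e e′ | refl = contradiction e′ (end≢opp (k , i , false))

  Partner : Flag → Flag → Set
  Partner φ ψ = proj₁ ψ ≢ proj₁ φ × vert ψ ≡ vert φ × end ψ ≡ end φ ×
                (∀ χ → vert χ ≡ vert φ → end χ ≡ end φ → χ ≡ φ ⊎ χ ≡ ψ)

  partner : ∀ φ → ∃ (Partner φ)
  partner φ with filter-two (edgeOf? (vert φ) (end φ)) 𝒞 (cdc _ _ (adj-end φ))
  ... | k , k′ , k≢k′ , p , p′ , only = [ (λ e → build k k′ k≢k′ p′ only e) ,
        (λ e → build k′ k (k≢k′ ∘ sym) p (λ j q → Sum.swap (only j q)) e) ]′ (only (proj₁ φ) (edge-of φ))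
    where
    build : ∀ k k′ → k ≢ k′ → EdgeOf (vert φ) (end φ) (face k′) →
            (∀ j → EdgeOf (vert φ) (end φ) (face j) → j ≡ k ⊎ j ≡ k′) → proj₁ φ ≡ k → ∃ (Partner φ)
    build k k′ k≢k′ p′ only e with flag-of k′ p′
    ... | ψ , fψ , vψ , eψ = ψ , (λ f → k≢k′ (trans (sym e) (trans (sym f) fψ))) , vψ , eψ , λ χ v w →
      Sum.map (λ f → flag-unique χ φ (trans f (sym e)) v w)
              (λ f → flag-unique χ ψ (trans f (sym fψ)) (trans v (sym vψ)) (trans w (sym eψ)))
              (only (proj₁ χ) (subst₂ (λ a b → EdgeOf a b (face (proj₁ χ))) v w (edge-of χ)))

  abstract
    r₂ : Flag → Flag
    r₂ φ = proj₁ (partner φ)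

    r₂-partner : ∀ φ → Partner φ (r₂ φ)
    r₂-partner φ = proj₂ (partner φ)

  face-r₂ : ∀ φ → proj₁ (r₂ φ) ≢ proj₁ φ
  face-r₂ φ = proj₁ (r₂-partner φ)

  vert-r₂ : ∀ φ → vert (r₂ φ) ≡ vert φ
  vert-r₂ φ = proj₁ (proj₂ (r₂-partner φ))

  end-r₂ : ∀ φ → end (r₂ φ) ≡ end φ
  end-r₂ φ = proj₁ (proj₂ (proj₂ (r₂-partner φ)))

  two-flags : ∀ φ χ → vert χ ≡ vert φ → end χ ≡ end φ → χ ≡ φ ⊎ χ ≡ r₂ φ
  two-flags φ = proj₂ (proj₂ (proj₂ (r₂-partner φ)))

  r₂-involutive : ∀ φ → r₂ (r₂ φ) ≡ φ
  r₂-involutive φ with two-flags φ (r₂ (r₂ φ)) (trans (vert-r₂ _) (vert-r₂ φ)) (trans (end-r₂ _) (end-r₂ φ))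
  ... | inj₁ e = e
  ... | inj₂ e = contradiction (cong proj₁ e) (face-r₂ (r₂ φ))

  r₀r₂ : ∀ φ → r₀ (r₂ φ) ≡ r₂ (r₀ φ)
  r₀r₂ φ with two-flags (r₀ φ) (r₀ (r₂ φ)) (end-r₂ φ)
                (trans (cong vert (r₀-involutive (r₂ φ))) (trans (vert-r₂ φ) (cong vert (sym (r₀-involutive φ)))))
  ... | inj₂ e = e
  ... | inj₁ e = contradiction (trans (sym (face-r₀ (r₂ φ))) (trans (cong proj₁ e) (face-r₀ φ))) (face-r₂ φ)

  neighbour-list : Vertex G → List (Vertex G)
  neighbour-list v = filter (adj? v) (allFin order)

  adj⇒∈ : ∀ {u v} → Adj u v → v ∈ neighbour-list u
  adj⇒∈ {u} {v} a = ∈-filter⁺ (adj? u) (∈-allFin v) a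

  ∈⇒adj : ∀ {u v} → v ∈ neighbour-list u → Adj u v
  ∈⇒adj {u} i = proj₂ (∈-filter⁻ (adj? u) {xs = allFin order} i)

  neighbour-unique : ∀ v → Unique (neighbour-list v)
  neighbour-unique v = Uniqueₚ.filter⁺ (adj? v) (Uniqueₚ.allFin⁺ order)

  adj-opp : ∀ φ → Adj (vert φ) (opp φ)
  adj-opp φ = adj-end (r₁ φ)

  opp-r₁ : ∀ φ → opp (r₁ φ) ≡ end φ
  opp-r₁ φ = cong end (r₁-involutive φ)

  flag-at : ∀ {u v} → Adj u v → ∃ λ φ → vert φ ≡ u × end φ ≡ v
  flag-at {u} {v} a with filter-two (edgeOf? u v) 𝒞 (cdc u v a)
  ... | k , _ , _ , p , _ with flag-of k p
  ... | φ , _ , e , e′ = φ , e , e′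

  -- If both faces at the edge of φ also shared the edge of r₁ φ, then no face
  -- could contain the third edge at the vertex of φ.
  opp-r₂ : ∀ φ → opp (r₂ φ) ≢ opp φ
  opp-r₂ φ same with three (cubic (vert φ)) (neighbour-unique (vert φ)) (adj⇒∈ (adj-end φ)) (adj⇒∈ (adj-opp φ)) (end≢opp φ)
  ... | c , c∈ , c≢a , c≢b , only with flag-at (∈⇒adj c∈)
  ... | ψ , vψ , eψ with only (adj⇒∈ (subst (λ v → Adj v (opp ψ)) vψ (adj-opp ψ)))
  ... | inj₂ (inj₂ e) = end≢opp ψ (trans eψ (sym e))
  ... | inj₁ e with two-flags φ (r₁ ψ) vψ e
  ... | inj₁ f = c≢b (trans (sym eψ) (trans (sym (opp-r₁ ψ)) (cong opp f)))
  ... | inj₂ f = c≢b (trans (sym eψ) (trans (sym (opp-r₁ ψ)) (trans (cong opp f) same)))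
  opp-r₂ φ same | c , c∈ , c≢a , c≢b , only | ψ , vψ , eψ | inj₂ (inj₁ e)
    with two-flags (r₁ φ) (r₁ ψ) vψ e | two-flags (r₁ φ) (r₁ (r₂ φ)) (vert-r₂ φ) same
  ... | inj₁ f | _      = c≢a (trans (sym eψ) (trans (sym (opp-r₁ ψ)) (trans (cong opp f) (opp-r₁ φ))))
  ... | inj₂ f | inj₁ g = face-r₂ φ (cong proj₁ g)
  ... | inj₂ f | inj₂ g = c≢a (trans (sym eψ) (trans (sym (opp-r₁ ψ)) (trans (cong opp (trans f (sym g)))
                            (trans (opp-r₁ (r₂ φ)) (end-r₂ φ)))))

  end≢opp-r₂ : ∀ φ → end φ ≢ opp (r₂ φ)
  end≢opp-r₂ φ e = end≢opp (r₂ φ) (trans (end-r₂ φ) e)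

  adj-opp-r₂ : ∀ φ → Adj (vert φ) (opp (r₂ φ))
  adj-opp-r₂ φ = subst (λ v → Adj v (opp (r₂ φ))) (vert-r₂ φ) (adj-opp (r₂ φ))

  neighbours : ∀ φ {v} → Adj (vert φ) v → v ≡ end φ ⊎ v ≡ opp φ ⊎ v ≡ opp (r₂ φ)
  neighbours φ a with three (cubic (vert φ)) (neighbour-unique (vert φ)) (adj⇒∈ (adj-end φ)) (adj⇒∈ (adj-opp φ)) (end≢opp φ)
  ... | c , _ , _ , _ , only with only (adj⇒∈ a) | only (adj⇒∈ (adj-opp-r₂ φ))
  ... | inj₁ e | _ = inj₁ e
  ... | inj₂ (inj₁ e) | _ = inj₂ (inj₁ e)
  ... | inj₂ (inj₂ e) | inj₂ (inj₂ f) = inj₂ (inj₂ (trans e (sym f)))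
  ... | _ | inj₁ f = contradiction (sym f) (end≢opp-r₂ φ)
  ... | _ | inj₂ (inj₁ f) = contradiction f (opp-r₂ φ)

  opp-r₂r₁ : ∀ φ → opp (r₂ (r₁ φ)) ≡ opp (r₂ φ)
  opp-r₂r₁ φ with neighbours φ (adj-opp-r₂ (r₁ φ))
  ... | inj₁ e        = contradiction (trans e (sym (opp-r₁ φ))) (opp-r₂ (r₁ φ))
  ... | inj₂ (inj₁ e) = contradiction (sym e) (end≢opp-r₂ (r₁ φ))
  ... | inj₂ (inj₂ e) = e

  -- Three faces meet at a vertex. Both sides are flags at the edge off the face of `φ`, and both
  -- have `opp φ` as their other neighbour, which decides between the two faces at that edge.
  r₁r₂ : ∀ φ → r₁ (r₂ (r₁ φ)) ≡ r₂ (r₁ (r₂ φ))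
  r₁r₂ φ with two-flags (r₂ (r₁ (r₂ φ))) (r₁ (r₂ (r₁ φ)))
                (trans (vert-r₂ (r₁ φ)) (trans (sym (vert-r₂ φ)) (sym (vert-r₂ (r₁ (r₂ φ))))))
                (trans (opp-r₂r₁ φ) (sym (end-r₂ (r₁ (r₂ φ)))))
  ... | inj₁ e = e
  ... | inj₂ e = contradiction (trans (cong opp (sym e)) (trans lhs (sym rhs))) (opp-r₂ (r₂ (r₁ (r₂ φ))))
    where
    lhs : opp (r₁ (r₂ (r₁ φ))) ≡ opp φ
    lhs = trans (opp-r₁ (r₂ (r₁ φ))) (end-r₂ (r₁ φ))
    rhs : opp (r₂ (r₁ (r₂ φ))) ≡ opp φ
    rhs = trans (opp-r₂r₁ (r₂ φ)) (cong opp (r₂-involutive φ))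

  r₀r₁-braid : ∀ φ → r₀ (r₁ (r₀ (r₁ (r₀ (r₁ φ))))) ≡ r₁ (r₀ (r₁ (r₀ (r₁ (r₀ φ)))))
  r₀r₁-braid (k , 0F , true)  = refl
  r₀r₁-braid (k , 1F , true)  = refl
  r₀r₁-braid (k , 2F , true)  = refl
  r₀r₁-braid (k , 3F , true)  = refl
  r₀r₁-braid (k , 4F , true)  = refl
  r₀r₁-braid (k , 5F , true)  = refl
  r₀r₁-braid (k , 0F , false) = refl
  r₀r₁-braid (k , 1F , false) = refl
  r₀r₁-braid (k , 2F , false) = refl
  r₀r₁-braid (k , 3F , false) = refl
  r₀r₁-braid (k , 4F , false) = refl
  r₀r₁-braid (k , 5F , false) = refl

  r₀r₁²-free : ∀ φ → r₀ (r₁ (r₀ (r₁ φ))) ≢ φ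
  r₀r₁²-free (k , 0F , true) ()
  r₀r₁²-free (k , 1F , true) ()
  r₀r₁²-free (k , 2F , true) ()
  r₀r₁²-free (k , 3F , true) ()
  r₀r₁²-free (k , 4F , true) ()
  r₀r₁²-free (k , 5F , true) ()
  r₀r₁²-free (k , 0F , false) ()
  r₀r₁²-free (k , 1F , false) ()
  r₀r₁²-free (k , 2F , false) ()
  r₀r₁²-free (k , 3F , false) ()
  r₀r₁²-free (k , 4F , false) ()
  r₀r₁²-free (k , 5F , false) ()

  r₀r₁³-free : ∀ φ → r₀ (r₁ (r₀ (r₁ (r₀ (r₁ φ))))) ≢ φ
  r₀r₁³-free (k , 0F , true) ()
  r₀r₁³-free (k , 1F , true) ()
  r₀r₁³-free (k , 2F , true) ()
  r₀r₁³-free (k , 3F , true) ()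
  r₀r₁³-free (k , 4F , true) ()
  r₀r₁³-free (k , 5F , true) ()
  r₀r₁³-free (k , 0F , false) ()
  r₀r₁³-free (k , 1F , false) ()
  r₀r₁³-free (k , 2F , false) ()
  r₀r₁³-free (k , 3F , false) ()
  r₀r₁³-free (k , 4F , false) ()
  r₀r₁³-free (k , 5F , false) ()

  bit : Bool → Fin 2
  bit true  = 0F
  bit false = 1F

  bit-injective : ∀ {a b} → bit a ≡ bit b → a ≡ b
  bit-injective {true}  {true}  _ = refl
  bit-injective {false} {false} _ = refl

  flag-finite : Finite Flag
  flag-finite = record
    { size = length 𝒞 * (6 * 2)
    ; code = λ (k , i , b) → combine k (combine i (bit b))
    ; code-injective = injective }
    where
    injective : ∀ {φ ψ : Flag} → combine (proj₁ φ) (combine (proj₁ (proj₂ φ)) (bit (proj₂ (proj₂ φ)))) ≡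
                combine (proj₁ ψ) (combine (proj₁ (proj₂ ψ)) (bit (proj₂ (proj₂ ψ)))) → φ ≡ ψ
    injective {k , i , b} {k′ , i′ , b′} e with Finₚ.combine-injective k (combine i (bit b)) k′ (combine i′ (bit b′)) e
    ... | refl , e′ with Finₚ.combine-injective i (bit b) i′ (bit b′) e′
    ... | refl , e″ = cong (λ c → k , i , c) (bit-injective e″)

  r₀-free : ∀ φ → r₀ φ ≢ φ
  r₀-free (k , i , true)  ()
  r₀-free (k , i , false) ()

  hexagonal : Hexagonal Flag
  hexagonal = record
    { finite = flag-finite
    ; r₀ = r₀ ; r₁ = r₁ ; r₂ = r₂
    ; r₀-involutive = r₀-involutive ; r₁-involutive = r₁-involutive ; r₂-involutive = r₂-involutive
    ; r₀r₂ = r₀r₂ ; r₁r₂ = r₁r₂ ; r₀r₁ = r₀r₁-braid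
    ; r₀-free = r₀-free
    ; r₂-free = λ φ e → face-r₂ φ (cong proj₁ e)
    ; r₂r₀-free = λ φ e → face-r₂ (r₀ φ) (trans (cong proj₁ e) (sym (face-r₀ φ)))
    ; r₂r₁-free = λ φ e → face-r₂ (r₁ φ) (cong proj₁ e)
    ; r₀r₁²-free = r₀r₁²-free
    ; r₀r₁³-free = r₀r₁³-free
    }

-- The three cases put together

rows-hamiltonian : ∀ {G} → Rows G → (∀ u v → Star (Graph.Adj G) u v) → Hamiltonian G
rows-hamiltonian {G} R star = dispatch (any-iter? (λ φ → φ ∥? U φ) φ₀) (any-iter? (λ φ → U φ ∥? E (U φ)) φ₀)
  where
  open Rows R
  open Ends R
  open 𝕂 using (any-iter?)
  φ₀ : Frame
  φ₀ = proj₁ base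
  valid-iterK : ∀ n → Valid (iter K n φ₀)
  valid-iterK zero    = proj₂ base
  valid-iterK (suc n) = valid-ρ (valid-E (valid-U (valid-iterK n)))
  dispatch : Dec (∃ λ n → U-end (iter K n φ₀)) → Dec (∃ λ n → E-end (U (iter K n φ₀))) → Hamiltonian G
  dispatch (yes (n , end)) _ = FoldedSide.hamiltonian R (valid-iterK n) star end
  dispatch (no _) (yes (n , end)) = OneSidedRow.hamiltonian R (valid-U (valid-iterK n)) star end
  dispatch (no ¬u) (no ¬e) = NoEnds.hamiltonian R (proj₂ base) star (λ n end → ¬u (n , end)) (λ n end → ¬e (n , end))

-- The rows of the given graph

module FlagRows (G : Graph) (cubic : Cubic G) (𝒞 : List (Cycle G)) (cdc : CycleDoubleCover G 𝒞)
                (six : All (λ C → cycleLength C ≡ 6) 𝒞) where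
  open Flags G cubic 𝒞 cdc six
  open Translations hexagonal hiding (module X; module Y)

  -- Leaves along the edge that is not on the face of `φ`. As the glide reflection `y ∘ r₀`, it
  -- keeps to edges of the chosen direction.
  step : Flag → Flag
  step φ = r₁ (r₀ (r₁ (r₂ (r₁ φ))))

  step-step : ∀ φ → step (step φ) ≡ x φ
  step-step φ = trans (step≡yr₀ _) (trans (cong (y ∘ r₀) (step≡yr₀ φ))
    (trans (yr₀y (r₀ φ)) (cong x (r₀-involutive φ))))

  iter-step-step : ∀ n φ → iter (step ∘ step) n φ ≡ iter x n φ
  iter-step-step zero    φ = refl
  iter-step-step (suc n) φ = trans (step-step _) (cong x (iter-step-step n φ))

  iter-≈-step : ∀ n φ → φ ≈ iter (step ∘ step) n φ
  iter-≈-step n φ = n , 0 , sym (iter-step-step n φ)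

  step-r₂-step : ∀ φ → step (r₂ (step φ)) ≡ r₂ φ
  step-r₂-step φ = begin
    r₁ (r₀ (r₁ (r₂ (r₁ (r₂ (r₁ (r₀ (r₁ (r₂ (r₁ φ)))))))))) ≡⟨ cong (r₁ ∘ r₀) (middle _) ⟩
    r₁ (r₀ (r₂ (r₀ (r₁ (r₂ (r₁ φ))))))                     ≡⟨ cong r₁ (r₀r₂ _) ⟩
    r₁ (r₂ (r₀ (r₀ (r₁ (r₂ (r₁ φ))))))                     ≡⟨ cong (r₁ ∘ r₂) (r₀-involutive _) ⟩
    r₁ (r₂ (r₁ (r₂ (r₁ φ))))                               ≡⟨ middle φ ⟩
    r₂ φ                                                   ∎
    where
    open ≡-Reasoning
    middle : ∀ ψ → r₁ (r₂ (r₁ (r₂ (r₁ ψ)))) ≡ r₂ ψ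
    middle ψ = trans (r₁r₂ _) (cong r₂ (trans (cong r₁ (r₂-involutive _)) (r₁-involutive ψ)))

  end-step : ∀ φ → vert (step φ) ≡ opp (r₂ φ)
  end-step φ = opp-r₂r₁ φ

  end-step-r₂ : ∀ φ → vert (step (r₂ φ)) ≡ opp φ
  end-step-r₂ φ = trans (end-step (r₂ φ)) (cong opp (r₂-involutive φ))

  module _ {φ₀ : Flag} (good : Good φ₀) where

    class-r₂ : ∀ {ψ} → Class φ₀ ψ → Class φ₀ (r₂ ψ)
    class-r₂ {ψ} a = subst (Class φ₀) (sym (r₂≡hxr₀ ψ)) (class-h (class-≈ x-≈ (class-r₀ a)))

    class-step : ∀ {ψ} → Class φ₀ ψ → Class φ₀ (step ψ)
    class-step {ψ} a = subst (Class φ₀) (sym (step≡yr₀ ψ)) (class-≈ y-≈ (class-r₀ a))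

    class-injective : ∀ {φ ψ} → Class φ₀ φ → Class φ₀ ψ → vert φ ≡ vert ψ → ψ ≡ φ ⊎ ψ ≡ r₂ φ
    class-injective {φ} {ψ} a a′ e = [ two-flags φ ψ (sym e) , [ (λ f → ⊥-elim (off a (two-flags (r₁ φ) ψ (sym e) f)))
        , (λ f → ⊥-elim (off (class-r₂ a) (two-flags (r₁ (r₂ φ)) ψ (trans (sym e) (sym (vert-r₂ φ))) f))) ]′ ]′
        (neighbours φ (subst (λ v → Graph.Adj G v (end ψ)) (sym e) (adj-end ψ)))
      where
      off : ∀ {φ} → Class φ₀ φ → ¬ (ψ ≡ r₁ φ ⊎ ψ ≡ r₂ (r₁ φ))
      off a (inj₁ g) = class-r₁ good a (subst (Class φ₀) g a′)
      off a (inj₂ g) = class-r₁ good a (subst (Class φ₀) (trans (cong r₂ g) (r₂-involutive _)) (class-r₂ a′))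

    -- Up to a translation, `r₂ ∘ r₀` is the half-turn `h`.
    r₂r₀-translation : ∀ n φ → r₂ (r₀ φ) ≢ iter (step ∘ step) n φ
    r₂r₀-translation n φ e = h≉ (≈-trans (≈-sym x-≈) (≈-trans (iter-≈-step n φ)
      (≈-reflexive (trans (sym e) (sym (hh _))))))

    step-translation : ∀ n φ → step φ ≢ r₂ (iter (step ∘ step) n φ)
    step-translation n φ e = h≉ {x (r₀ (iter (step ∘ step) n φ))}
      (≈-trans (≈-sym x-≈) (≈-trans (≈-sym (r₀-≈ (iter-≈-step n φ))) (≈-trans y-≈
        (≈-reflexive (trans (sym (step≡yr₀ φ)) (trans e (r₂≡hxr₀ _)))))))

    rows : Rows G
    rows = record
      { Frame = Flag ; finite = flag-finite
      ; E = step ; U = r₀ ; ρ = r₂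
      ; ρρ = r₂-involutive ; UU = r₀-involutive ; Uρ = r₀r₂ ; EρE = step-r₂-step
      ; EEU = λ φ → trans (step-step _) (trans (sym (r₀x φ)) (cong r₀ (sym (step-step φ))))
      ; ρ-free = λ φ e → face-r₂ φ (cong proj₁ e)
      ; U-free = r₀-free
      ; ρU-free = r₂r₀-translation
      ; E-free = step-translation
      ; Valid = Class φ₀
      ; base = φ₀ , class-refl
      ; valid-E = class-step ; valid-U = class-r₀ ; valid-ρ = class-r₂
      ; vertex = vert
      ; vertex-ρ = vert-r₂
      ; vertex-injective = class-injective
      ; adj-U = adj-end
      ; adj-E = λ φ → subst (Graph.Adj G (vert φ)) (sym (end-step φ)) (adj-opp-r₂ φ)
      ; U≢E = λ φ e → end≢opp-r₂ φ (trans e (end-step φ))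
      ; E≢E = λ φ e → opp-r₂ φ (trans (sym (end-step φ)) (trans e (end-step-r₂ φ)))
      ; neighbours = λ φ a → [ inj₁ , [ (λ e → inj₂ (inj₂ (trans e (sym (end-step-r₂ φ)))))
                                      , (λ e → inj₂ (inj₁ (trans e (sym (end-step φ))))) ]′ ]′ (neighbours φ a)
      }

  some-flag : Vertex G → Flag
  some-flag v = pick (neighbour-list v) (cubic v) ∈⇒adj
    where
    pick : ∀ l → length l ≡ 3 → (∀ {u} → u ∈ l → Graph.Adj G v u) → Flag
    pick (u ∷ _) _ adj = proj₁ (flag-at (adj (here refl)))

  hamiltonian : Vertex G → (∀ u v → Star (Graph.Adj G) u v) → Hamiltonian G
  hamiltonian v star = rows-hamiltonian (rows (proj₂ (good-flag (some-flag v)))) star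

mainTheorem1 : (G : Graph) → Connected G → Cubic G → Has6CDC G → Hamiltonian G
mainTheorem1 G (nonZero , star) cubic (𝒞 , cdc , six) = FlagRows.hamiltonian G cubic 𝒞 cdc six (first nonZero) star
  where
  first : ∀ {n} → NonZero n → Fin n
  first {suc n} _ = zero
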